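{- A definably compact, definably connected definable ring has zero multiplication.
   Context: $\mathcal N=(N,<,\dots)$ is an o-minimal structure and "definable" means definable in $\mathcal N$ with parameters. A definable ring is a (not necessarily associative or unital) ring whose universe and operations are definable. It is definably connected if its additive group has no proper definable subgroup of finite index, and definably compact if for every definable continuous injective curve $\sigma:(a,b)\to U$ ($-\infty\le a<b\le+\infty$) into it (with the unique definable manifold topology of its additive group) both one-sided endpoint limits exist in $U$. -}

module Defs where

open import Algebra.Definitions using (Congruent₂; _DistributesOver_)
open import Algebra.Structures using (IsAbelianGroup)
open import Data.Empty.Polymorphic using (⊥)
open import Data.Fin.Base using (Fin)
open import Data.List.Base using (List)
open import Data.List.Relation.Unary.Any using (Any)
open import Data.Nat.Base as ℕ using (ℕ; suc)
open import Data.Product using (Σ-syntax; ∃; ∃-syntax; _×_; _,_; proj₁; proj₂)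
open import Data.Sum.Base using (_⊎_)
open import Data.Vec.Base using (Vec; []; _∷_; _++_; lookup)
open import Data.Vec.Relation.Binary.Pointwise.Inductive using (Pointwise)
open import Function.Bundles using (Func; Inverse; _⇔_)
open import Function.Definitions using (Injective)
open import Level using (Level) renaming (suc to lsuc)
open import Relation.Binary.Bundles using (Setoid)
open import Relation.Binary.Core using (Rel)
open import Relation.Binary.Structures using (IsDenseLinearOrder)
open import Relation.Binary.PropositionalEquality as ≡ using (_≡_)
open import Relation.Nullary.Construct.Add.Extrema using (_±; [_])
open import Relation.Unary using (Pred; _∈_; _⊆_)
import Relation.Binary.Construct.Add.Extrema.Strict as Extrema
import Relation.Binary.Construct.On as On

-- A first-order structure (N, <, …) in an arbitrary language containing _<_.
record OrderedStructure (ℓ : Level) : Set (lsuc ℓ) where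
  infix 4 _<_
  field
    Carrier : Set ℓ
    _<_     : Rel Carrier ℓ
    FunSym  : ℕ → Set ℓ
    RelSym  : ℕ → Set ℓ
    fun     : ∀ {k} → FunSym k → Vec Carrier k → Carrier
    rel     : ∀ {k} → RelSym k → Pred (Vec Carrier k) ℓ

module _ {ℓ : Level} (𝒩 : OrderedStructure ℓ) where

  open OrderedStructure 𝒩 renaming (Carrier to N)
  open Extrema _<_ using (_<±_)

  data Term (n : ℕ) : Set ℓ where
    var   : Fin n → Term n
    param : N → Term n
    app   : ∀ {k} → FunSym k → Vec (Term n) k → Term n

  data Formula (n : ℕ) : Set ℓ where
    _≐_ _≺_     : Term n → Term n → Formula n
    atom        : ∀ {k} → RelSym k → Vec (Term n) k → Formula n
    ⊥'          : Formula n
    _∧_ _∨_ _⇒_ : Formula n → Formula n → Formula n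
    ∀' ∃'       : Formula (suc n) → Formula n

  eval  : ∀ {n} → Term n → Vec N n → N
  evals : ∀ {n k} → Vec (Term n) k → Vec N n → Vec N k

  eval (var i)    v = lookup v i
  eval (param a)  v = a
  eval (app f ts) v = fun f (evals ts v)

  evals []       v = []
  evals (t ∷ ts) v = eval t v ∷ evals ts v

  ⟦_⟧ : ∀ {n} → Formula n → Pred (Vec N n) ℓ
  ⟦ s ≐ t ⟧     v = eval s v ≡ eval t v
  ⟦ s ≺ t ⟧     v = eval s v < eval t v
  ⟦ atom R ts ⟧ v = rel R (evals ts v)
  ⟦ ⊥' ⟧        v = ⊥
  ⟦ φ ∧ ψ ⟧     v = ⟦ φ ⟧ v × ⟦ ψ ⟧ v
  ⟦ φ ∨ ψ ⟧     v = ⟦ φ ⟧ v ⊎ ⟦ ψ ⟧ v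
  ⟦ φ ⇒ ψ ⟧     v = ⟦ φ ⟧ v → ⟦ ψ ⟧ v
  ⟦ ∀' φ ⟧      v = ∀ a → ⟦ φ ⟧ (a ∷ v)
  ⟦ ∃' φ ⟧      v = ∃[ a ] ⟦ φ ⟧ (a ∷ v)

  Definable : ∀ {n} → Pred (Vec N n) ℓ → Set ℓ
  Definable {n} S = Σ[ φ ∈ Formula n ] (∀ v → S v ⇔ ⟦ φ ⟧ v)

  -- A subset of Nⁿ as a setoid: points are compared by their coordinates, not
  -- by their membership proofs.
  Subset : ∀ {n} → Pred (Vec N n) ℓ → Setoid ℓ ℓ
  Subset {n} S = On.setoid (≡.setoid (Vec N n)) (proj₁ {B = S})

  Graph : ∀ {m n} {A : Pred (Vec N m) ℓ} {B : Pred (Vec N n) ℓ} →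
          (∃ A → ∃ B) → Pred (Vec N (m ℕ.+ n)) ℓ
  Graph {A = A} f v = Σ[ x ∈ ∃ A ] proj₁ x ++ proj₁ (f x) ≡ v

  Graph₂ : ∀ {m} {A : Pred (Vec N m) ℓ} →
           (∃ A → ∃ A → ∃ A) → Pred (Vec N (m ℕ.+ (m ℕ.+ m))) ℓ
  Graph₂ {A = A} f v =
    Σ[ x ∈ ∃ A ] Σ[ y ∈ ∃ A ] proj₁ x ++ (proj₁ y ++ proj₁ (f x y)) ≡ v

  -- The endpoints range over N ∪ {-∞, +∞}.
  Interval : N ± → N ± → Pred (Vec N 1) ℓ
  Interval a b (t ∷ []) = a <± [ t ] × [ t ] <± b

  data Piece : Set ℓ where
    point    : N → Piece
    interval : N ± → N ± → Piece

  _∈ᴾ_ : N → Piece → Set ℓ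
  x ∈ᴾ point a      = x ≡ a
  x ∈ᴾ interval a b = (x ∷ []) ∈ Interval a b

  -- The order is dense without endpoints, the setting in which definable groups
  -- carry a manifold topology.
  record IsOMinimal : Set (lsuc ℓ) where
    field
      nonempty           : N
      isDenseLinearOrder : IsDenseLinearOrder _≡_ _<_
      no-least           : ∀ x → ∃[ y ] y < x
      no-greatest        : ∀ x → ∃[ y ] x < y
      tame               : (S : Pred (Vec N 1) ℓ) → Definable S →
                           Σ[ ps ∈ List Piece ] (∀ x → S (x ∷ []) ⇔ Any (x ∈ᴾ_) ps)

  -- Not necessarily associative or unital.
  record DefinableRing : Set (lsuc ℓ) where
    infix  8 -_
    infixl 7 _*_
    infixl 6 _+_
    infix  4 _≈_
    field
      {m}       : ℕ
      U         : Pred (Vec N m) ℓ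
      definable : Definable U

    Elem : Set ℓ
    Elem = ∃ U

    _≈_ : Rel Elem ℓ
    _≈_ = Setoid._≈_ (Subset U)

    field
      _+_ _*_        : Elem → Elem → Elem
      -_             : Elem → Elem
      0#             : Elem
      isAbelianGroup : IsAbelianGroup _≈_ _+_ 0# -_
      *-cong         : Congruent₂ _≈_ _*_
      distrib        : _DistributesOver_ _≈_ _*_ _+_
      +-definable    : Definable (Graph₂ _+_)
      *-definable    : Definable (Graph₂ _*_)

  module _ (R : DefinableRing) where
    open DefinableRing R

    record IsDefinableSubgroup (H : Pred (Vec N m) ℓ) : Set ℓ where
      field
        H-definable : Definable H
        H⊆U         : H ⊆ U
        0∈H         : proj₁ 0# ∈ H
        +-closed    : ∀ x y → proj₁ x ∈ H → proj₁ y ∈ H → proj₁ (x + y) ∈ H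
        neg-closed  : ∀ x → proj₁ x ∈ H → proj₁ (- x) ∈ H

    FiniteIndex : Pred (Vec N m) ℓ → Set ℓ
    FiniteIndex H =
      Σ[ reps ∈ List Elem ] (∀ x → Any (λ r → proj₁ (x + (- r)) ∈ H) reps)

    DefinablyConnected : Set (lsuc ℓ)
    DefinablyConnected =
      ∀ H → IsDefinableSubgroup H → FiniteIndex H → U ⊆ H

  -- Openness in the product of the order topologies; without endpoints, boxes
  -- with corners in N form a basis.
  IsOpen : ∀ {n} → Pred (Vec N n) ℓ → Set ℓ
  IsOpen {n} S = ∀ x → x ∈ S →
    Σ[ lo ∈ Vec N n ] Σ[ hi ∈ Vec N n ]
      Pointwise _<_ lo x × Pointwise _<_ x hi ×
      (∀ y → Pointwise _<_ lo y → Pointwise _<_ y hi → y ∈ S)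

  record Chart {m : ℕ} (U : Pred (Vec N m) ℓ) (n : ℕ) : Set (lsuc ℓ) where
    field
      V           : Pred (Vec N m) ℓ
      V-definable : Definable V
      V⊆U         : V ⊆ U
      O           : Pred (Vec N n) ℓ
      O-open      : IsOpen O
      φ           : Inverse (Subset V) (Subset O)
      φ-definable : Definable (Graph (Inverse.to φ))

    -- φ(W ∩ V)
    image : Pred (Vec N m) ℓ → Pred (Vec N n) ℓ
    image W y = Σ[ y∈O ∈ O y ] proj₁ (Inverse.from φ (y , y∈O)) ∈ W

    -- φ⁻¹(Q)
    preimage : Pred (Vec N n) ℓ → Pred (Vec N m) ℓ
    preimage Q x = Σ[ x∈V ∈ V x ] proj₁ (Inverse.to φ (x , x∈V)) ∈ Q

  record DefinableManifold {m : ℕ} (U : Pred (Vec N m) ℓ) : Set (lsuc ℓ) where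
    field
      dimension : ℕ
      size      : ℕ
      chart     : Fin size → Chart U dimension
      cover     : ∀ x → x ∈ U → ∃[ i ] x ∈ Chart.V (chart i)
      -- φᵢ(Vᵢ ∩ φⱼ⁻¹(Q)) is the preimage of Q under the transition map φⱼ ∘ φᵢ⁻¹
      -- on φᵢ(Vᵢ ∩ Vⱼ). For Q = Nⁿ the condition says that this domain is open,
      -- for general Q that the transition map is continuous.
      transition : ∀ i j Q → IsOpen Q →
                   IsOpen (Chart.image (chart i) (Chart.preimage (chart j) Q))

    -- Says that W ∩ U is open in the manifold topology on U.
    Open : Pred (Vec N m) ℓ → Set ℓ
    Open W = ∀ i → IsOpen (Chart.image (chart i) W)

  record GroupTopology (R : DefinableRing) : Set (lsuc ℓ) where
    open DefinableRing R
    field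
      manifold : DefinableManifold U
    open DefinableManifold manifold public
    field
      +-continuous : ∀ x y W → Open W → proj₁ (x + y) ∈ W →
        Σ[ A ∈ Pred (Vec N m) ℓ ] Σ[ B ∈ Pred (Vec N m) ℓ ]
          Open A × Open B × proj₁ x ∈ A × proj₁ y ∈ B ×
          (∀ x' y' → proj₁ x' ∈ A → proj₁ y' ∈ B → proj₁ (x' + y') ∈ W)
      neg-continuous : ∀ W → Open W →
        Open (λ v → Σ[ v∈U ∈ U v ] proj₁ (- (v , v∈U)) ∈ W)

  module _ {m : ℕ} {U : Pred (Vec N m) ℓ} (M : DefinableManifold U) where
    open DefinableManifold M using (Open)

    Curve : N ± → N ± → Set ℓ
    Curve a b = Func (Subset (Interval a b)) (Subset U)

    module _ {a b : N ±} (σ : Curve a b) where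
      open Func σ using (to)

      -- The interval is open in N, so relatively open subsets are open in N.
      IsContinuous : Set (lsuc ℓ)
      IsContinuous = ∀ W → Open W →
        IsOpen (λ t → Σ[ t∈I ∈ Interval a b t ] proj₁ (to (t , t∈I)) ∈ W)

      LeftEndpointLimit : ∃ U → Set (lsuc ℓ)
      LeftEndpointLimit u = ∀ W → Open W → proj₁ u ∈ W →
        Σ[ c ∈ N ] (c ∷ []) ∈ Interval a b ×
          (∀ t (t∈I : (t ∷ []) ∈ Interval a b) → t < c →
             proj₁ (to (t ∷ [] , t∈I)) ∈ W)

      RightEndpointLimit : ∃ U → Set (lsuc ℓ)
      RightEndpointLimit u = ∀ W → Open W → proj₁ u ∈ W →
        Σ[ c ∈ N ] (c ∷ []) ∈ Interval a b ×
          (∀ t (t∈I : (t ∷ []) ∈ Interval a b) → c < t →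
             proj₁ (to (t ∷ [] , t∈I)) ∈ W)

    DefinablyCompact : Set (lsuc ℓ)
    DefinablyCompact = ∀ a b → a <± b → (σ : Curve a b) →
      Definable (Graph (Func.to σ)) → IsContinuous σ →
      Injective (Setoid._≈_ (Subset (Interval a b))) (Setoid._≈_ (Subset U)) (Func.to σ) →
      ∃ (LeftEndpointLimit σ) × ∃ (RightEndpointLimit σ)

{-# OPTIONS --safe #-}

-- Suppose that x U ≠ 0 for some x.  The annihilator of U is then a proper definable
-- subgroup, hence of infinite index, and some definable curve γ meets each of its
-- cosets at most once.  By compactness γ has a limit w, so σ = γ - w tends to 0#,
-- σ t U ≠ 0, and the definable subgroups σ t U shrink to 0 because multiplication
-- is continuous.  Choosing t₁, t₂, … suitably, no σ tᵢ U is contained in the sum of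
-- the later, much smaller ones; a transversal in each of them gives definable
-- injections of boxes of every dimension into U, which is impossible because U is
-- a subset of some Nᵐ.
module Submission where

open import Defs
open import Axiom.ExcludedMiddle using (ExcludedMiddle)
open import Data.Empty using (⊥; ⊥-elim)
import Data.Empty.Polymorphic as ⊥ₚ
import Data.Unit.Polymorphic as ⊤ₚ
open import Data.Fin.Base using (Fin; zero; suc; splitAt; _↑ˡ_; _↑ʳ_)
open import Data.List.Base as List using (List; []; _∷_) renaming (_++_ to _++ˡ_)
open import Data.List.Relation.Unary.Any using (Any; here; there) renaming (map to Any-map)
import Data.List.Relation.Unary.Any.Properties as Any
open import Data.Nat.Base as ℕ using (ℕ; zero; suc)
open import Data.Product using (Σ-syntax; ∃; ∃-syntax; _×_; _,_; proj₁; proj₂)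
open import Data.Sum.Base using (_⊎_; inj₁; inj₂; [_,_]′)
open import Data.Vec.Base as Vec using (Vec; []; _∷_; _++_; lookup)
import Data.Vec.Properties as Vec
open import Data.Vec.Relation.Binary.Pointwise.Inductive as Pw using (Pointwise; []; _∷_)
open import Function.Base using (_∘_; id; case_of_)
open import Function.Bundles using (_⇔_; mk⇔; Equivalence; Func; Inverse)
open import Level using () renaming (suc to lsuc)
open import Relation.Binary.Core using (Rel)
open import Relation.Binary.Definitions using (tri<; tri≈; tri>)
open import Relation.Binary.PropositionalEquality using (_≡_; _≢_; refl; sym; trans; cong; cong₂; subst)
open import Relation.Binary.Structures using (IsDenseLinearOrder)
open import Relation.Nullary using (¬_; yes; no)
open import Relation.Nullary.Construct.Add.Extrema using (_±; ⊥±; ⊤±) renaming ([_] to ⟨_⟩)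
open import Relation.Unary using (Pred)
import Relation.Binary.Construct.Add.Extrema.Strict as ExtremaStrict
import Relation.Binary.Construct.Add.Supremum.Strict as SupremumStrict
open import Algebra.Bundles using (AbelianGroup)
import Algebra.Properties.AbelianGroup as AbelianGroupProperties
open import Algebra.Definitions using (Congruent₂)
import Relation.Binary.Reasoning.Setoid as SetoidReasoning

open Equivalence using (to; from)
open ExtremaStrict using (⊥±<[_]; [_]<⊤±; [_])

-- This suffices wherever the chosen point matters only up to a small error, for example up to the
-- coset of an open subgroup. That a proper definable subgroup is crossed by a curve comes from a
-- dichotomy. If no curve is injective modulo the subgroup, some box of a chart lies in one coset
-- and the subgroup is open; an open subgroup has finite index by compactness, and then it is
-- everything by connectedness. The topology is given as compatible with addition alone.
-- Multiplication is continuous at zero because a definable map is continuous at some point of every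
-- box, and bilinearity carries this to zero. Of dimension theory only one fact is used: a box of
-- dimension m + 1 has no definable injection into the m-tuples. Shrinking boxes again and again
-- replaces cell decomposition.

module Definability {ℓ} (𝒩 : OrderedStructure ℓ) where

  open OrderedStructure 𝒩 renaming (Carrier to N)

  -- Formulas with parameters, and substitution into them.

  infix 3 _⊨_
  _⊨_ : ∀ {n} → Vec N n → Formula 𝒩 n → Set ℓ
  v ⊨ φ = ⟦_⟧ 𝒩 φ v

  -- Variables are replaced by variables or parameters only; maps enter formulas through their
  -- graphs, never as compound terms.
  Subst : ℕ → ℕ → Set ℓ
  Subst m n = Fin m → Fin n ⊎ N

  value : ∀ {n} → Vec N n → Fin n ⊎ N → N
  value v (inj₁ i) = lookup v i
  value v (inj₂ a) = a

  weaken : ∀ {n} → Fin n ⊎ N → Fin (suc n) ⊎ N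
  weaken (inj₁ i) = inj₁ (suc i)
  weaken (inj₂ a) = inj₂ a

  lift : ∀ {m n} → Subst m n → Subst (suc m) (suc n)
  lift ρ zero    = inj₁ zero
  lift ρ (suc i) = weaken (ρ i)

  asTerm : ∀ {n} → Fin n ⊎ N → Term 𝒩 n
  asTerm (inj₁ i) = var i
  asTerm (inj₂ a) = param a

  substT  : ∀ {m n} → Subst m n → Term 𝒩 m → Term 𝒩 n
  substTs : ∀ {m n k} → Subst m n → Vec (Term 𝒩 m) k → Vec (Term 𝒩 n) k
  substT ρ (var i)    = asTerm (ρ i)
  substT ρ (param a)  = param a
  substT ρ (app f ts) = app f (substTs ρ ts)
  substTs ρ []        = []
  substTs ρ (t ∷ ts)  = substT ρ t ∷ substTs ρ ts

  substF : ∀ {m n} → Subst m n → Formula 𝒩 m → Formula 𝒩 n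
  substF ρ (s ≐ t)     = substT ρ s ≐ substT ρ t
  substF ρ (s ≺ t)     = substT ρ s ≺ substT ρ t
  substF ρ (atom r ts) = atom r (substTs ρ ts)
  substF ρ ⊥'          = ⊥'
  substF ρ (φ ∧ ψ)     = substF ρ φ ∧ substF ρ ψ
  substF ρ (φ ∨ ψ)     = substF ρ φ ∨ substF ρ ψ
  substF ρ (φ ⇒ ψ)     = substF ρ φ ⇒ substF ρ ψ
  substF ρ (∀' φ)      = ∀' (substF (lift ρ) φ)
  substF ρ (∃' φ)      = ∃' (substF (lift ρ) φ)

  record Agree {m n} (ρ : Subst m n) (v : Vec N n) (w : Vec N m) : Set ℓ where
    constructor agree
    field agrees : ∀ i → value v (ρ i) ≡ lookup w i
  open Agree public

  agree-lift : ∀ {m n} {ρ : Subst m n} {v w} a → Agree ρ v w → Agree (lift ρ) (a ∷ v) (a ∷ w)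
  agrees (agree-lift a h) zero = refl
  agrees (agree-lift {ρ = ρ} a h) (suc i) with ρ i | agrees h i
  ... | inj₁ _ | e = e
  ... | inj₂ _ | e = e

  eval-subst  : ∀ {m n} {ρ : Subst m n} {v w} → Agree ρ v w →
                ∀ t → eval 𝒩 (substT ρ t) v ≡ eval 𝒩 t w
  evals-subst : ∀ {m n k} {ρ : Subst m n} {v w} → Agree ρ v w →
                ∀ (ts : Vec _ k) → evals 𝒩 (substTs ρ ts) v ≡ evals 𝒩 ts w
  eval-subst {ρ = ρ} h (var i) with ρ i | agrees h i
  ... | inj₁ _ | e = e
  ... | inj₂ _ | e = e
  eval-subst h (param a)  = refl
  eval-subst h (app f ts) = cong (fun f) (evals-subst h ts)
  evals-subst h []        = refl
  evals-subst h (t ∷ ts)  = cong₂ _∷_ (eval-subst h t) (evals-subst h ts)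

  sat-subst : ∀ {m n} {ρ : Subst m n} {v w} → Agree ρ v w →
              ∀ φ → (v ⊨ substF ρ φ) ⇔ (w ⊨ φ)
  sat-subst {ρ = ρ} {v} {w} h (s ≐ t) = mk⇔
    (λ e → trans (sym (eval-subst h s)) (trans e (eval-subst h t)))
    (λ e → trans (eval-subst h s) (trans e (sym (eval-subst h t))))
  sat-subst h (s ≺ t)
    rewrite eval-subst h s | eval-subst h t = mk⇔ id id
  sat-subst h (atom r ts) rewrite evals-subst h ts = mk⇔ id id
  sat-subst h ⊥' = mk⇔ id id
  sat-subst h (φ ∧ ψ) = mk⇔
    (λ (p , q) → to (sat-subst h φ) p , to (sat-subst h ψ) q)
    (λ (p , q) → from (sat-subst h φ) p , from (sat-subst h ψ) q)
  sat-subst h (φ ∨ ψ) = mk⇔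
    [ inj₁ ∘ to (sat-subst h φ) , inj₂ ∘ to (sat-subst h ψ) ]′
    [ inj₁ ∘ from (sat-subst h φ) , inj₂ ∘ from (sat-subst h ψ) ]′
  sat-subst h (φ ⇒ ψ) = mk⇔
    (λ f → to (sat-subst h ψ) ∘ f ∘ from (sat-subst h φ))
    (λ f → from (sat-subst h ψ) ∘ f ∘ to (sat-subst h φ))
  sat-subst h (∀' φ) = mk⇔
    (λ f a → to (sat-subst (agree-lift a h) φ) (f a))
    (λ f a → from (sat-subst (agree-lift a h) φ) (f a))
  sat-subst h (∃' φ) = mk⇔
    (λ (a , p) → a , to (sat-subst (agree-lift a h) φ) p)
    (λ (a , p) → a , from (sat-subst (agree-lift a h) φ) p)

  -- Each further quantifier goes innermost, so that it binds the head of the tuple `w` in `w ++ v`.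
  ∀^ ∃^ : ∀ k {n} → Formula 𝒩 (k ℕ.+ n) → Formula 𝒩 n
  ∀^ zero    φ = φ
  ∀^ (suc k) φ = ∀^ k (∀' φ)
  ∃^ zero    φ = φ
  ∃^ (suc k) φ = ∃^ k (∃' φ)

  sat-∀^ : ∀ k {n} {v : Vec N n} φ → (v ⊨ ∀^ k φ) ⇔ (∀ (w : Vec N k) → w ++ v ⊨ φ)
  sat-∀^ zero    φ = mk⇔ (λ { p [] → p }) (λ f → f [])
  sat-∀^ (suc k) φ = mk⇔
    (λ { p (a ∷ w) → to (sat-∀^ k (∀' φ)) p w a })
    (λ f → from (sat-∀^ k (∀' φ)) (λ w a → f (a ∷ w)))

  sat-∃^ : ∀ k {n} {v : Vec N n} φ → (v ⊨ ∃^ k φ) ⇔ (∃[ w ] (w ++ v ⊨ φ))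
  sat-∃^ zero    φ = mk⇔ (λ p → [] , p) (λ { ([] , p) → p })
  sat-∃^ (suc k) φ = mk⇔
    (λ p → let w , a , q = to (sat-∃^ k (∃' φ)) p in a ∷ w , q)
    (λ { (a ∷ w , q) → from (sat-∃^ k (∃' φ)) (w , a , q) })

  -- Definable sets and definable maps between sorts.

  infixr 5 _⊗_
  data Sort : Set (lsuc ℓ) where
    𝐍   : Sort
    𝐕   : ℕ → Sort
    sub : ∀ {k} (S : Pred (Vec N k) ℓ) → Definable 𝒩 S → Sort
    _⊗_ : Sort → Sort → Sort

  Car : Sort → Set ℓ
  Car 𝐍         = N
  Car (𝐕 k)     = Vec N k
  Car (sub S _) = ∃ S
  Car (A ⊗ B)   = Car A × Car B

  dim : Sort → ℕ
  dim 𝐍             = 1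
  dim (𝐕 k)         = k
  dim (sub {k} _ _) = k
  dim (A ⊗ B)       = dim A ℕ.+ dim B

  code : ∀ A → Car A → Vec N (dim A)
  code 𝐍         a       = a ∷ []
  code (𝐕 k)     v       = v
  code (sub _ _) x       = proj₁ x
  code (A ⊗ B)   (a , b) = code A a ++ code B b

  Eq : ∀ A → Car A → Car A → Set ℓ
  Eq A x y = code A x ≡ code A y

  record IsDef (A : Sort) (P : Car A → Set ℓ) : Set ℓ where
    constructor mkDef
    field
      fm  : Formula 𝒩 (dim A)
      iff : ∀ x → P x ⇔ (code A x ⊨ fm)
  open IsDef public

  -- A formula is evaluated at the coordinates, so proofs of membership in a `sub` sort cannot
  -- influence it.
  IsDef-resp : ∀ {A P} → IsDef A P → ∀ {x y} → Eq A x y → P x → P y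
  IsDef-resp D {x} {y} e p = from (iff D y) (subst (_⊨ fm D) e (to (iff D x) p))

  -- The graph condition is replaced by stability of definability under pulling
  -- back, which makes composition immediate; see graphDef and describe.
  record DefFun (A B : Sort) (f : Car A → Car B) : Set (lsuc ℓ) where
    field
      pull : ∀ {C P} → IsDef (B ⊗ C) P → IsDef (A ⊗ C) (λ (a , c) → P (f a , c))
  open DefFun public

  -- Maps each of whose coordinates is a coordinate of the argument or a constant. Pulling back
  -- along them is a substitution and introduces no quantifier.
  record Substitutive (A B : Sort) (f : Car A → Car B) : Set ℓ where
    field
      ren : Subst (dim B) (dim A)
      agr : ∀ a → Agree ren (code A a) (code B (f a))
  open Substitutive public

  substDef : ∀ {A B f P} → Substitutive A B f → IsDef B P → IsDef A (P ∘ f)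
  fm  (substDef S D)   = substF (ren S) (fm D)
  iff (substDef S D) x = mk⇔
    (from (sat-subst (agr S x) (fm D)) ∘ to (iff D _))
    (from (iff D _) ∘ to (sat-subst (agr S x) (fm D)))

  agree-↑ˡ : ∀ {m n} (v : Vec N m) (w : Vec N n) → Agree (λ i → inj₁ (i ↑ˡ n)) (v ++ w) v
  agree-↑ˡ v w = agree (Vec.lookup-++ˡ v w)

  agree-↑ʳ : ∀ {m n} (v : Vec N m) (w : Vec N n) → Agree (λ i → inj₁ (m ↑ʳ i)) (v ++ w) w
  agree-↑ʳ v w = agree (Vec.lookup-++ʳ v w)

  agree-++ : ∀ {k m n} (g : Fin m → Fin k ⊎ N) (h : Fin n → Fin k ⊎ N) (u : Vec N k)
                    {v : Vec N m} {w : Vec N n} → Agree g u v → Agree h u w →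
                    Agree ([ g , h ]′ ∘ splitAt m) u (v ++ w)
  agrees (agree-++ {m = m} g h u {v} {w} p q) i =
    trans (lem (splitAt m i)) (sym (Vec.lookup-splitAt m v w i))
    where
    lem : ∀ s → value u ([ g , h ]′ s) ≡ [ lookup v , lookup w ]′ s
    lem (inj₁ i) = agrees p i
    lem (inj₂ i) = agrees q i

  subst-id : ∀ {A} → Substitutive A A id
  ren subst-id   = inj₁
  agr subst-id a = agree (λ i → refl)

  subst-proj₁ : ∀ {A B} → Substitutive (A ⊗ B) A proj₁
  ren (subst-proj₁ {A} {B}) i = inj₁ (i ↑ˡ dim B)
  agr (subst-proj₁ {A} {B}) (a , b) = agree-↑ˡ (code A a) (code B b)

  subst-proj₂ : ∀ {A B} → Substitutive (A ⊗ B) B proj₂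
  ren (subst-proj₂ {A} {B}) i = inj₁ (dim A ↑ʳ i)
  agr (subst-proj₂ {A} {B}) (a , b) = agree-↑ʳ (code A a) (code B b)

  subst-pair : ∀ {A B C f g} → Substitutive A B f → Substitutive A C g →
               Substitutive A (B ⊗ C) (λ a → f a , g a)
  ren (subst-pair {B = B} S T)   = [ ren S , ren T ]′ ∘ splitAt (dim B)
  agr (subst-pair {A} S T) a = agree-++ (ren S) (ren T) (code A a) (agr S a) (agr T a)

  subst-∘ : ∀ {A B C f g} → Substitutive B C g → Substitutive A B f → Substitutive A C (g ∘ f)
  ren (subst-∘ S T) i = [ ren T , inj₂ ]′ (ren S i)
  agrees (agr (subst-∘ {f = f} S T) a) i with ren S i | agrees (agr S (f a)) i
  ... | inj₁ j | e = trans (agrees (agr T a) j) e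
  ... | inj₂ _ | e = e

  substFun : ∀ {A B f} → Substitutive A B f → DefFun A B f
  pull (substFun S) = substDef (subst-pair (subst-∘ S subst-proj₁) subst-proj₂)

  abstract

    idᶠ : ∀ {A} → DefFun A A id
    idᶠ = substFun subst-id

    fstᶠ : ∀ {A B} → DefFun (A ⊗ B) A proj₁
    fstᶠ = substFun subst-proj₁

    sndᶠ : ∀ {A B} → DefFun (A ⊗ B) B proj₂
    sndᶠ = substFun subst-proj₂

    constᶠ : ∀ {A B} (b : Car B) → DefFun A B (λ _ → b)
    constᶠ {A} {B} b = substFun S
      where
      S : Substitutive A B (λ _ → b)
      ren S i   = inj₂ (lookup (code B b) i)
      agr S a = agree (λ _ → refl)

    infixr 9 _∘ᶠ_
    _∘ᶠ_ : ∀ {A B C f g} → DefFun B C g → DefFun A B f → DefFun A C (g ∘ f)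
    pull (G ∘ᶠ F) D = pull F (pull G D)

    infixr 4 _,ᶠ_
    _,ᶠ_ : ∀ {A B C f g} → DefFun A B f → DefFun A C g → DefFun A (B ⊗ C) (λ a → f a , g a)
    pull (F ,ᶠ G) D =
      -- Only the leftmost component of a product can be pulled back. Hence `a` is copied into the
      -- context before `f` is applied, and is moved back to the front for `g`.
      substDef (subst-pair subst-proj₁ (subst-pair subst-proj₁ subst-proj₂))
        (pull F (substDef (subst-pair (subst-proj₁ ∘ₛ subst-proj₂)
                            (subst-pair subst-proj₁ (subst-proj₂ ∘ₛ subst-proj₂)))
          (pull G (substDef (subst-pair (subst-pair (subst-proj₁ ∘ₛ subst-proj₂) subst-proj₁)
                              (subst-proj₂ ∘ₛ subst-proj₂)) D))))
      where
      infixr 9 _∘ₛ_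
      _∘ₛ_ : ∀ {A B C f g} → Substitutive B C g → Substitutive A B f → Substitutive A C (g ∘ f)
      _∘ₛ_ = subst-∘

    -- de Bruijn variables: a context is a product A ⊗ (B ⊗ …), innermost binder first.
    v0 : ∀ {A Γ} → DefFun (A ⊗ Γ) A proj₁
    v0 = fstᶠ

    S : ∀ {A B Γ f} → DefFun Γ B f → DefFun (A ⊗ Γ) B (f ∘ proj₂)
    S F = F ∘ᶠ sndᶠ

    -- `pull` works over a context; a second copy of `Γ` serves as one, and the diagonal removes it
    -- afterwards.
    at : ∀ {Γ A f P} → IsDef A P → DefFun Γ A f → IsDef Γ (P ∘ f)
    at D F = substDef (subst-pair subst-id subst-id) (pull F (substDef subst-proj₁ D))

    at₂ : ∀ {Γ A B f g P} → IsDef (A ⊗ B) P → DefFun Γ A f → DefFun Γ B g →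
          IsDef Γ (λ γ → P (f γ , g γ))
    at₂ D F G = at D (F ,ᶠ G)

    at₃ : ∀ {Γ A B C f g h P} → IsDef (A ⊗ (B ⊗ C)) P → DefFun Γ A f → DefFun Γ B g →
          DefFun Γ C h → IsDef Γ (λ γ → P (f γ , g γ , h γ))
    at₃ D F G H = at D (F ,ᶠ G ,ᶠ H)

    infixr 6 _∧ᵈ_
    infixr 5 _∨ᵈ_
    infixr 4 _⇒ᵈ_

    _∧ᵈ_ : ∀ {A P Q} → IsDef A P → IsDef A Q → IsDef A (λ x → P x × Q x)
    fm  (D ∧ᵈ E)   = fm D ∧ fm E
    iff (D ∧ᵈ E) x = mk⇔ (λ (p , q) → to (iff D x) p , to (iff E x) q)
                         (λ (p , q) → from (iff D x) p , from (iff E x) q)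

    _∨ᵈ_ : ∀ {A P Q} → IsDef A P → IsDef A Q → IsDef A (λ x → P x ⊎ Q x)
    fm  (D ∨ᵈ E)   = fm D ∨ fm E
    iff (D ∨ᵈ E) x = mk⇔ [ inj₁ ∘ to (iff D x) , inj₂ ∘ to (iff E x) ]′
                         [ inj₁ ∘ from (iff D x) , inj₂ ∘ from (iff E x) ]′

    _⇒ᵈ_ : ∀ {A P Q} → IsDef A P → IsDef A Q → IsDef A (λ x → P x → Q x)
    fm  (D ⇒ᵈ E)   = fm D ⇒ fm E
    iff (D ⇒ᵈ E) x = mk⇔ (λ f → to (iff E x) ∘ f ∘ from (iff D x))
                         (λ f → from (iff E x) ∘ f ∘ to (iff D x))

    ¬ᵈ : ∀ {A P} → IsDef A P → IsDef A (λ x → ¬ P x)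
    fm  (¬ᵈ D)   = fm D ⇒ ⊥'
    iff (¬ᵈ D) x = mk⇔ (λ f p → ⊥-elim (f (from (iff D x) p)))
                       (λ f p → ⊥ₚ.⊥-elim (f (to (iff D x) p)))

    mapDef : ∀ {A P Q} → (∀ x → P x ⇔ Q x) → IsDef A P → IsDef A Q
    fm  (mapDef h D)   = fm D
    iff (mapDef h D) x = mk⇔ (to (iff D x) ∘ from (h x)) (to (h x) ∘ from (iff D x))

    -- Quantifiers of the language range over all tuples. This formula relativises them to the codes
    -- of a sort.
    domain : ∀ A → Σ[ φ ∈ Formula 𝒩 (dim A) ] (∀ v → (∃[ x ] code A x ≡ v) ⇔ (v ⊨ φ))
    domain 𝐍 = ⊥' ⇒ ⊥' , λ { (a ∷ []) → mk⇔ (λ _ → id) (λ _ → a , refl) }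
    domain (𝐕 k) = ⊥' ⇒ ⊥' , λ v → mk⇔ (λ _ → id) (λ _ → v , refl)
    domain (sub T (φ , h)) = φ , λ v →
      mk⇔ (λ { ((v , p) , refl) → to (h v) p }) (λ p → (v , from (h v) p) , refl)
    domain (A ⊗ B) = φ , λ v → mk⇔ (fwd v) (bwd v)
      where
      ρ : Subst (dim A) (dim A ℕ.+ dim B)
      ρ i = inj₁ (i ↑ˡ dim B)
      σ : Subst (dim B) (dim A ℕ.+ dim B)
      σ i = inj₁ (dim A ↑ʳ i)
      φ : Formula 𝒩 (dim A ℕ.+ dim B)
      φ = substF ρ (proj₁ (domain A)) ∧ substF σ (proj₁ (domain B))
      fwd : ∀ v → (∃[ x ] code (A ⊗ B) x ≡ v) → v ⊨ φ
      fwd v ((a , b) , refl) =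
        from (sat-subst (agree-↑ˡ (code A a) (code B b)) (proj₁ (domain A))) (to (proj₂ (domain A) _) (a , refl)) ,
        from (sat-subst (agree-↑ʳ (code A a) (code B b)) (proj₁ (domain B))) (to (proj₂ (domain B) _) (b , refl))
      bwd : ∀ v → v ⊨ φ → ∃[ x ] code (A ⊗ B) x ≡ v
      bwd v (p , q) with Vec.splitAt (dim A) v
      ... | v₁ , v₂ , refl
        with from (proj₂ (domain A) v₁) (to (sat-subst (agree-↑ˡ v₁ v₂) (proj₁ (domain A))) p)
           | from (proj₂ (domain B) v₂) (to (sat-subst (agree-↑ʳ v₁ v₂) (proj₁ (domain B))) q)
      ... | a , refl | b , refl = (a , b) , refl

    private
      domainˡ : ∀ A n → Formula 𝒩 (dim A ℕ.+ n)
      domainˡ A n = substF (λ i → inj₁ (i ↑ˡ n)) (proj₁ (domain A))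

      sat-domainˡ : ∀ A {n} (v : Vec N n) w →
                    (∃[ x ] code A x ≡ w) ⇔ (w ++ v ⊨ domainˡ A n)
      sat-domainˡ A v w = mk⇔
        (from (sat-subst (agree-↑ˡ w v) (proj₁ (domain A))) ∘ to (proj₂ (domain A) w))
        (from (proj₂ (domain A) w) ∘ to (sat-subst (agree-↑ˡ w v) (proj₁ (domain A))))

    ∀ᵈ : ∀ {A Γ P} → IsDef (A ⊗ Γ) P → IsDef Γ (λ γ → ∀ a → P (a , γ))
    fm  (∀ᵈ {A} {Γ} D)       = ∀^ (dim A) (domainˡ A (dim Γ) ⇒ fm D)
    iff (∀ᵈ {A} {Γ} {P} D) γ = mk⇔
      (λ f → from (sat-∀^ (dim A) _) (λ w d → pos f w (from (sat-domainˡ A (code Γ γ) w) d)))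
      (λ f a → from (iff D (a , γ))
        (to (sat-∀^ (dim A) _) f (code A a) (to (sat-domainˡ A (code Γ γ) _) (a , refl))))
      where
      pos : (∀ a → P (a , γ)) → ∀ w → (∃[ x ] code A x ≡ w) → w ++ code Γ γ ⊨ fm D
      pos f _ (a , refl) = to (iff D (a , γ)) (f a)

    ∃ᵈ : ∀ {A Γ P} → IsDef (A ⊗ Γ) P → IsDef Γ (λ γ → ∃[ a ] P (a , γ))
    fm  (∃ᵈ {A} {Γ} D)       = ∃^ (dim A) (domainˡ A (dim Γ) ∧ fm D)
    iff (∃ᵈ {A} {Γ} {P} D) γ = mk⇔
      (λ (a , p) → from (sat-∃^ (dim A) _)
        (code A a , to (sat-domainˡ A (code Γ γ) _) (a , refl) , to (iff D (a , γ)) p))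
      (λ f → let w , d , q = to (sat-∃^ (dim A) (domainˡ A (dim Γ) ∧ fm D)) f
             in neg w (from (sat-domainˡ A (code Γ γ) w) d) q)
      where
      neg : ∀ w → (∃[ x ] code A x ≡ w) → w ++ code Γ γ ⊨ fm D → ∃[ a ] P (a , γ)
      neg _ (a , refl) q = a , from (iff D (a , γ)) q

    <ᵈ : IsDef (𝐍 ⊗ 𝐍) (λ (x , y) → x < y)
    fm  <ᵈ   = var zero ≺ var (suc zero)
    iff <ᵈ _ = mk⇔ id id

    private
      vecEq : ∀ {k n} → Subst k n → Subst k n → Formula 𝒩 n
      vecEq {zero}  f g = ⊥' ⇒ ⊥'
      vecEq {suc k} f g = (asTerm (f zero) ≐ asTerm (g zero)) ∧ vecEq (f ∘ suc) (g ∘ suc)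

      eval-asTerm : ∀ {n} (v : Vec N n) x → eval 𝒩 (asTerm x) v ≡ value v x
      eval-asTerm v (inj₁ _) = refl
      eval-asTerm v (inj₂ _) = refl

      sat-vecEq : ∀ {k n} (f g : Subst k n) (v : Vec N n) (x y : Vec N k) →
                  (∀ i → value v (f i) ≡ lookup x i) → (∀ i → value v (g i) ≡ lookup y i) → (x ≡ y) ⇔ (v ⊨ vecEq f g)
      sat-vecEq f g v [] [] p q = mk⇔ (λ _ → id) (λ _ → refl)
      sat-vecEq f g v (a ∷ x) (b ∷ y) p q = mk⇔ fwd bwd
        where
        rec : (x ≡ y) ⇔ (v ⊨ vecEq (f ∘ suc) (g ∘ suc))
        rec = sat-vecEq (f ∘ suc) (g ∘ suc) v x y (p ∘ suc) (q ∘ suc)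
        ea : eval 𝒩 (asTerm (f zero)) v ≡ a
        ea = trans (eval-asTerm v (f zero)) (p zero)
        eb : eval 𝒩 (asTerm (g zero)) v ≡ b
        eb = trans (eval-asTerm v (g zero)) (q zero)
        fwd : a ∷ x ≡ b ∷ y → v ⊨ vecEq f g
        fwd refl = trans ea (sym eb) , to rec refl
        bwd : v ⊨ vecEq f g → a ∷ x ≡ b ∷ y
        bwd (e , h) = cong₂ _∷_ (trans (sym ea) (trans e eb)) (from rec h)

    Eqᵈ : ∀ A → IsDef (A ⊗ A) (λ (x , y) → Eq A x y)
    fm  (Eqᵈ A)         = vecEq (λ i → inj₁ (i ↑ˡ dim A)) (λ i → inj₁ (dim A ↑ʳ i))
    iff (Eqᵈ A) (x , y) = sat-vecEq _ _ (code A x ++ code A y) (code A x) (code A y)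
      (agrees (agree-↑ˡ (code A x) (code A y))) (agrees (agree-↑ʳ (code A x) (code A y)))

    -- `P (f a , c)` says that some `b` with `R (a , b)` satisfies `P (b , c)`. Uniqueness of `b` up
    -- to codes is enough, since definable properties see only codes.
    describe : ∀ {A B R f} → IsDef (A ⊗ B) R → (∀ a → R (a , f a)) →
               (∀ a b → R (a , b) → Eq B b (f a)) → DefFun A B f
    pull (describe {A} {B} {R} {f} D tot unq) {C} {P} E =
      mapDef (λ (a , c) → mk⇔
          (λ (b , r , p) → IsDef-resp E (cong (_++ code C c) (unq a b r)) p)
          (λ p → f a , tot a , p))
        (∃ᵈ {A = B} (at₂ D (S v0) v0 ∧ᵈ at₂ E v0 (S sndᶠ)))

    graphDef : ∀ {A B f} → DefFun A B f → IsDef (A ⊗ B) (λ (a , b) → Eq B (f a) b)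
    graphDef {B = B} F = pull F (Eqᵈ B)

    -- Having the same value as `x` is a definable condition, and it holds at `x` itself.
    DefFun-resp : ∀ {A B f} → DefFun A B f → ∀ {x y} → Eq A x y → Eq B (f x) (f y)
    DefFun-resp {A} {B} {f} F {x} {y} e =
      sym (IsDef-resp (at₂ (graphDef F) idᶠ (constᶠ (f x))) e refl)

    codeᶠ : ∀ {A} → DefFun A (𝐕 (dim A)) (code A)
    codeᶠ {A} = substFun (record { ren = inj₁ ; agr = λ _ → agree (λ _ → refl) })

    consᶠ : ∀ {k} → DefFun (𝐍 ⊗ 𝐕 k) (𝐕 (suc k)) (λ (x , v) → x ∷ v)
    consᶠ = substFun (record { ren = inj₁ ; agr = λ _ → agree (λ _ → refl) })

    headᶠ : ∀ {k} → DefFun (𝐕 (suc k)) 𝐍 Vec.head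
    headᶠ = substFun (record { ren = λ _ → inj₁ zero ; agr = λ { (_ ∷ _) → agree λ { zero → refl } } })

    tailᶠ : ∀ {k} → DefFun (𝐕 (suc k)) (𝐕 k) Vec.tail
    tailᶠ = substFun (record { ren = inj₁ ∘ suc ; agr = λ { (_ ∷ _) → agree (λ _ → refl) } })

    lookupᶠ : ∀ {k} (i : Fin k) → DefFun (𝐕 k) 𝐍 (λ v → lookup v i)
    lookupᶠ i = substFun (record { ren = λ _ → inj₁ i ; agr = λ _ → agree λ { zero → refl } })

    Definable⇒IsDef : ∀ {k} {T : Pred (Vec N k) ℓ} → Definable 𝒩 T → IsDef (𝐕 k) T
    Definable⇒IsDef (φ , h) = mkDef φ h

    IsDef⇒Definable : ∀ {k} {T : Pred (Vec N k) ℓ} → IsDef (𝐕 k) T → Definable 𝒩 T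
    IsDef⇒Definable (mkDef φ h) = φ , h

-- One-sided germs and infima on an o-minimal line.

module Lines (em : ∀ {a} → ExcludedMiddle a) {ℓ} (𝒩 : OrderedStructure ℓ) where

  open Definability 𝒩
  open OrderedStructure 𝒩 using () renaming (Carrier to N)

  decide : ∀ {a} (P : Set a) → P ⊎ ¬ P
  decide P with em {P = P}
  ... | yes p = inj₁ p
  ... | no ¬p = inj₂ ¬p

  byContra : ∀ {a} {P : Set a} → ¬ ¬ P → P
  byContra {P = P} h with decide P
  ... | inj₁ p  = p
  ... | inj₂ ¬p = ⊥-elim (h ¬p)

  -- As a lower bound `∞` is minus infinity; as an upper bound, that is for the opposite order, it
  -- is plus infinity.
  data Bound : Set ℓ where
    ∞  : Bound
    at⟨_⟩ : N → Bound

  Beyond : Rel N ℓ → Bound → N → Set ℓ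
  Beyond _<_ ∞      x = ⊤ₚ.⊤
  Beyond _<_ at⟨ y ⟩ x = y < x

  Segment : Set ℓ
  Segment = N ⊎ (Bound × Bound)

  op : Rel N ℓ → Rel N ℓ
  op _<_ x y = y < x

  InSegment : Rel N ℓ → N → Segment → Set ℓ
  InSegment _<_ x (inj₁ a)       = x ≡ a
  InSegment _<_ x (inj₂ (b , c)) = Beyond _<_ b x × Beyond (op _<_) c x

  -- The germ of `P` to the right of `a`. Germs to the left are the same notion for the opposite
  -- order.
  record Eventually (_<_ : Rel N ℓ) (a : Bound) (P : Pred N ℓ) : Set ℓ where
    constructor ev
    field
      end    : N
      beyond : Beyond _<_ a end
      holds  : ∀ x → Beyond _<_ a x → x < end → P x

  -- The order is a parameter, so that each one-sided statement can be used for
  -- the opposite order as well.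
  record IsLine (_<_ : Rel N ℓ) : Set (lsuc ℓ) where
    field
      <-def  : IsDef (𝐍 ⊗ 𝐍) (λ (x , y) → x < y)
      pt     : N
      irrefl : ∀ {x} → ¬ x < x
      <-trans : ∀ {x y z} → x < y → y < z → x < z
      cmp    : ∀ x y → x < y ⊎ x ≡ y ⊎ y < x
      dense  : ∀ {x y} → x < y → ∃[ z ] x < z × z < y
      above  : ∀ x → ∃[ y ] x < y
      below  : ∀ x → ∃[ y ] y < x
      segments : ∀ {P} → IsDef 𝐍 P →
                 Σ[ ss ∈ List Segment ] (∀ x → P x ⇔ Any (InSegment _<_ x) ss)

  opLine : ∀ {_<_} → IsLine _<_ → IsLine (op _<_)
  opLine {_<_} L = record
    { <-def  = at₂ <-def sndᶠ fstᶠ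
    ; pt     = pt
    ; irrefl = irrefl
    ; <-trans = λ p q → <-trans q p
    ; cmp    = λ x y → flip-cmp (cmp x y)
    ; dense  = λ p → let z , q , r = dense p in z , r , q
    ; above  = below
    ; below  = above
    ; segments = λ D → let ss , h = segments D in
        List.map swap ss , λ x → mk⇔ (Any.map⁺ ∘ Any-map (fwd x) ∘ to (h x))
                                     (from (h x) ∘ Any-map (bwd x) ∘ Any.map⁻)
    }
    where
    open IsLine L
    flip-cmp : ∀ {x y} → x < y ⊎ x ≡ y ⊎ y < x → y < x ⊎ x ≡ y ⊎ x < y
    flip-cmp (inj₁ p)        = inj₂ (inj₂ p)
    flip-cmp (inj₂ (inj₁ e)) = inj₂ (inj₁ e)
    flip-cmp (inj₂ (inj₂ q)) = inj₁ q
    swap : Segment → Segment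
    swap (inj₁ a)       = inj₁ a
    swap (inj₂ (b , c)) = inj₂ (c , b)
    fwd : ∀ x {s} → InSegment _<_ x s → InSegment (op _<_) x (swap s)
    fwd x {inj₁ a} p = p
    fwd x {inj₂ _} (p , q) = q , p
    bwd : ∀ x {s} → InSegment (op _<_) x (swap s) → InSegment _<_ x s
    bwd x {inj₁ a} p = p
    bwd x {inj₂ _} (p , q) = q , p

  module Germs {_<_ : Rel N ℓ} (L : IsLine _<_) where

    open IsLine L public

    <ᵈ′ : ∀ {Γ f g} → DefFun Γ 𝐍 f → DefFun Γ 𝐍 g → IsDef Γ (λ γ → f γ < g γ)
    <ᵈ′ = at₂ <-def

    asym : ∀ {x y} → x < y → ¬ y < x
    asym p q = irrefl (<-trans p q)

    -- Throughout, x ≤ y is expressed as ¬ y < x.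
    ≤-<-trans : ∀ {x y z} → ¬ y < x → y < z → x < z
    ≤-<-trans {x} {y} p q with cmp x y
    ... | inj₁ r           = <-trans r q
    ... | inj₂ (inj₁ refl) = q
    ... | inj₂ (inj₂ r)    = ⊥-elim (p r)

    <-≤-trans : ∀ {x y z} → x < y → ¬ z < y → x < z
    <-≤-trans {y = y} {z} p q with cmp y z
    ... | inj₁ r           = <-trans p r
    ... | inj₂ (inj₁ refl) = p
    ... | inj₂ (inj₂ r)    = ⊥-elim (q r)

    ≤-split : ∀ {x y} → ¬ y < x → x < y ⊎ x ≡ y
    ≤-split {x} {y} p with cmp x y
    ... | inj₁ r        = inj₁ r
    ... | inj₂ (inj₁ e) = inj₂ e
    ... | inj₂ (inj₂ r) = ⊥-elim (p r)

    infix 4 _◁_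
    _◁_ : Bound → N → Set ℓ
    a ◁ x = Beyond _<_ a x

    ◁-trans : ∀ a {x y} → a ◁ x → x < y → a ◁ y
    ◁-trans ∞      _ _ = ⊤ₚ.tt
    ◁-trans at⟨ _ ⟩ p q = <-trans p q

    ◁-above : ∀ a → ∃[ x ] a ◁ x
    ◁-above ∞      = pt , ⊤ₚ.tt
    ◁-above at⟨ x ⟩ = above x

    ◁-dense : ∀ a {y} → a ◁ y → ∃[ x ] a ◁ x × x < y
    ◁-dense ∞      {y} _ = let x , p = below y in x , ⊤ₚ.tt , p
    ◁-dense at⟨ _ ⟩ p     = dense p

    abstract
      ◁ᵈ : ∀ a {Γ f} → DefFun Γ 𝐍 f → IsDef Γ (λ γ → a ◁ f γ)
      ◁ᵈ ∞      F = mapDef (λ _ → mk⇔ _ (λ _ → irrefl)) (¬ᵈ (<ᵈ′ F F))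
      ◁ᵈ at⟨ x ⟩ F = <ᵈ′ (constᶠ x) F

    Ev : Bound → Pred N ℓ → Set ℓ
    Ev = Eventually _<_

    Ev-map : ∀ {a P Q} → (∀ x → P x → Q x) → Ev a P → Ev a Q
    Ev-map h (ev c p k) = ev c p λ x q r → h x (k x q r)

    Ev-map◁ : ∀ {a P Q} → (∀ x → a ◁ x → P x → Q x) → Ev a P → Ev a Q
    Ev-map◁ h (ev c p k) = ev c p λ x q r → h x q (k x q r)

    Ev-∧ : ∀ {a P Q} → Ev a P → Ev a Q → Ev a (λ x → P x × Q x)
    Ev-∧ (ev c p h) (ev d q k) with cmp c d
    ... | inj₁ r           = ev c p λ x s t → h x s t , k x s (<-trans t r)
    ... | inj₂ (inj₁ refl) = ev c p λ x s t → h x s t , k x s t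
    ... | inj₂ (inj₂ r)    = ev d q λ x s t → h x s (<-trans t r) , k x s t

    Ev-∃ : ∀ {a P} → Ev a P → ∃[ x ] a ◁ x × P x
    Ev-∃ {a} (ev c p h) = let x , q , r = ◁-dense a p in x , q , h x q r

    Ev-< : ∀ {a c} → a ◁ c → Ev a (_< c)
    Ev-< {c = c} p = ev c p λ _ _ r → r

    Ev-⇔ : ∀ {a P} → (∃[ c ] a ◁ c × (∀ x → a ◁ x → x < c → P x)) ⇔ Ev a P
    Ev-⇔ = mk⇔ (λ (c , p , h) → ev c p h) (λ (ev c p h) → c , p , h)

    Evᵈ : ∀ a {Γ P} → IsDef (𝐍 ⊗ Γ) P → IsDef Γ (λ γ → Ev a (λ x → P (x , γ)))
    Evᵈ a D = mapDef (λ _ → Ev-⇔) (∃ᵈ (◁ᵈ a v0 ∧ᵈ ∀ᵈ (◁ᵈ a v0 ⇒ᵈ <ᵈ′ v0 (S v0) ⇒ᵈ at₂ D v0 (S sndᶠ))))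

    Ev-atᵈ : ∀ {Γ f P} → DefFun Γ 𝐍 f → IsDef (𝐍 ⊗ Γ) P →
             IsDef Γ (λ γ → Ev at⟨ f γ ⟩ (λ x → P (x , γ)))
    Ev-atᵈ F D = mapDef (λ _ → Ev-⇔) (∃ᵈ (<ᵈ′ (S F) v0 ∧ᵈ
      ∀ᵈ (<ᵈ′ (S (S F)) v0 ⇒ᵈ <ᵈ′ v0 (S v0) ⇒ᵈ at₂ D v0 (S sndᶠ))))

    private
      trivial : ∀ {a P} → (∀ x → a ◁ x → P x) → Ev a P
      trivial {a} h = let c , p = ◁-above a in ev c p λ x q _ → h x q

      segment-germ : ∀ a s → Ev a (λ x → InSegment _<_ x s) ⊎ Ev a (λ x → ¬ InSegment _<_ x s)
      segment-germ a (inj₁ p) with decide (a ◁ p)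
      ... | inj₁ q = inj₂ (ev p q λ { x r s refl → irrefl s })
      ... | inj₂ q = inj₂ (trivial λ { x r refl → q r })
      segment-germ a (inj₂ (b , c)) with lower b | upper c
        where
        lower : ∀ b → Ev a (λ x → b ◁ x) ⊎ Ev a (λ x → ¬ b ◁ x)
        lower ∞ = inj₁ (trivial _)
        lower at⟨ y ⟩ with decide (a ◁ y)
        ... | inj₁ p = inj₂ (ev y p λ x q r s → irrefl (<-trans r s))
        ... | inj₂ p = inj₁ (trivial λ x q → byContra λ ¬r → p (lem x q ¬r))
          where
          lem : ∀ x → a ◁ x → ¬ y < x → a ◁ y
          lem x q ¬r with ≤-split ¬r
          ... | inj₁ s    = ◁-trans a q s
          ... | inj₂ refl = q
        upper : ∀ c → Ev a (Beyond (op _<_) c) ⊎ Ev a (λ x → ¬ Beyond (op _<_) c x)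
        upper ∞ = inj₁ (trivial _)
        upper at⟨ y ⟩ with decide (a ◁ y)
        ... | inj₁ p = inj₁ (Ev-< p)
        ... | inj₂ p = inj₂ (trivial λ x q r → p (◁-trans a q r))
      ... | inj₁ p | inj₁ q = inj₁ (Ev-∧ p q)
      ... | inj₂ p | _      = inj₂ (Ev-map (λ _ n → n ∘ proj₁) p)
      ... | _      | inj₂ q = inj₂ (Ev-map (λ _ n → n ∘ proj₂) q)

      segments-germ : ∀ a ss → Ev a (λ x → Any (InSegment _<_ x) ss) ⊎
                               Ev a (λ x → ¬ Any (InSegment _<_ x) ss)
      segments-germ a [] = inj₂ (trivial λ _ _ ())
      segments-germ a (s ∷ ss) with segment-germ a s | segments-germ a ss
      ... | inj₁ p | _      = inj₁ (Ev-map (λ _ → here) p)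
      ... | _      | inj₁ q = inj₁ (Ev-map (λ _ → there) q)
      ... | inj₂ p | inj₂ q = inj₂ (Ev-map (λ { _ (n , _) (here r) → n r
                                              ; _ (_ , n) (there r) → n r }) (Ev-∧ p q))

    abstract
      -- A single segment contains either all points just after `a` or none of them, and this passes
      -- to finite unions.
      germ : ∀ {P} → IsDef 𝐍 P → ∀ a → Ev a P ⊎ Ev a (λ x → ¬ P x)
      germ D a with segments D
      ... | ss , h with segments-germ a ss
      ... | inj₁ p = inj₁ (Ev-map (λ x → from (h x)) p)
      ... | inj₂ p = inj₂ (Ev-map (λ x n → n ∘ to (h x)) p)

    GreatestLower : Pred N ℓ → N → Set ℓ
    GreatestLower P s = (∀ x → P x → ¬ x < s) × (∀ y → s < y → ∃[ x ] P x × x < y)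

    private
      -- In an extended sense: the infimum is ∞ for a set unbounded below.
      record Inf∞ (P : Pred N ℓ) (b : Bound) : Set ℓ where
        constructor inf∞
        field
          lower    : ∀ x → P x → ∀ y → ¬ b ◁ y → ¬ x < y
          greatest : ∀ y → b ◁ y → ∃[ x ] P x × x < y

      segment-inf : ∀ s → (∃[ x ] InSegment _<_ x s) →
                    Σ[ b ∈ Bound ] Inf∞ (λ x → InSegment _<_ x s) b
      segment-inf (inj₁ p) _ = at⟨ p ⟩ , inf∞ (λ { x refl y n r → n r }) (λ y r → p , refl , r)
      segment-inf (inj₂ (b , c)) (x₀ , p , q) = b , inf∞
        (λ { x (r , _) y n s → n (◁-trans b r s) })
        (λ y r → let z , t , u = below-both r in z , (t , upper c q (proj₂ u)) , proj₁ u)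
        where
        below-both : ∀ {y} → b ◁ y → ∃[ z ] b ◁ z × z < y × z < x₀
        below-both {y} r = Ev-∃ {b} (Ev-∧ (Ev-< r) (Ev-< p))
        upper : ∀ c {z} → Beyond (op _<_) c x₀ → z < x₀ → Beyond (op _<_) c z
        upper ∞      _ _ = _
        upper at⟨ _ ⟩ s t = <-trans t s

      Inf∞-∪ : ∀ {P Q b c} → Inf∞ P b → Inf∞ Q c → (∀ y → c ◁ y → b ◁ y) →
               Inf∞ (λ x → P x ⊎ Q x) b
      Inf∞-∪ (inf∞ l g) (inf∞ l′ g′) h = inf∞
        (λ { x (inj₁ p) → l x p ; x (inj₂ q) y n → l′ x q y (n ∘ h y) })
        (λ y r → let x , p , s = g y r in x , inj₁ p , s)

      ◁-total : ∀ b c → (∀ y → c ◁ y → b ◁ y) ⊎ (∀ y → b ◁ y → c ◁ y)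
      ◁-total ∞ c = inj₁ _
      ◁-total at⟨ x ⟩ ∞ = inj₂ _
      ◁-total at⟨ x ⟩ at⟨ y ⟩ with cmp x y
      ... | inj₁ p           = inj₁ (λ _ → <-trans p)
      ... | inj₂ (inj₁ refl) = inj₁ (λ _ → id)
      ... | inj₂ (inj₂ p)    = inj₂ (λ _ → <-trans p)

      Inf∞-resp : ∀ {P Q b} → (∀ x → P x ⇔ Q x) → Inf∞ P b → Inf∞ Q b
      Inf∞-resp h (inf∞ l g) = inf∞
        (λ x q → l x (from (h x) q)) (λ y r → let x , p , s = g y r in x , to (h x) p , s)

      segments-inf : ∀ ss → (∃[ x ] Any (InSegment _<_ x) ss) →
                     Σ[ b ∈ Bound ] Inf∞ (λ x → Any (InSegment _<_ x) ss) b
      segments-inf (s ∷ ss) (x₀ , p₀)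
        with decide (∃[ x ] InSegment _<_ x s) | decide (∃[ x ] Any (InSegment _<_ x) ss)
      ... | inj₂ n | inj₂ n′ = ⊥-elim (case p₀ of λ
              { (here q) → n (x₀ , q) ; (there q) → n′ (x₀ , q) })
      ... | inj₁ e | inj₂ n = let b , i = segment-inf s e in b ,
              Inf∞-resp (λ x → mk⇔ here λ { (here q) → q ; (there q) → ⊥-elim (n (x , q)) }) i
      ... | inj₂ n | inj₁ e = let b , i = segments-inf ss e in b ,
              Inf∞-resp (λ x → mk⇔ there λ { (there q) → q ; (here q) → ⊥-elim (n (x , q)) }) i
      ... | inj₁ e | inj₁ e′ with segment-inf s e | segments-inf ss e′
      ... | b , i | c , j with ◁-total b c
      ... | inj₁ h = b , Inf∞-resp (λ x → mk⇔ [ here , there ]′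
              λ { (here q) → inj₁ q ; (there q) → inj₂ q }) (Inf∞-∪ i j h)
      ... | inj₂ h = c , Inf∞-resp (λ x → mk⇔ [ there , here ]′
              λ { (here q) → inj₂ q ; (there q) → inj₁ q }) (Inf∞-∪ j i h)

    abstract
      -- The left end of a finite union of nonempty segments is the least of their left ends; the
      -- bound `b` rules out `∞`.
      infimum : ∀ {P} → IsDef 𝐍 P → ∃ P → ∀ b → (∀ x → P x → ¬ x < b) → ∃ (GreatestLower P)
      infimum D (x₀ , p₀) b lb with segments D
      ... | ss , h with segments-inf ss (x₀ , to (h x₀) p₀)
      ... | ∞ , inf∞ _ g = let x , p , r = g b ⊤ₚ.tt in ⊥-elim (lb x (from (h x) p) r)
      ... | at⟨ s ⟩ , inf∞ l g = s , (λ x p → l x (to (h x) p) s irrefl) ,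
            λ y r → let x , p , t = g y r in x , from (h x) p , t

-- The monotonicity theorem, for strict weak orders in place of functions.

module Monotonicity (em : ∀ {a} → ExcludedMiddle a) {ℓ} (𝒩 : OrderedStructure ℓ) where

  open Definability 𝒩
  open Lines em 𝒩
  open OrderedStructure 𝒩 using () renaming (Carrier to N)

  -- Comparing arguments instead of values covers two cases at once: the values of a function into
  -- the line, and the extents of a definable family of germs, for which no function giving the
  -- extent is chosen.
  record IsStrictWeak (_⊏_ : Rel N ℓ) : Set ℓ where
    field
      ⊏-def     : IsDef (𝐍 ⊗ 𝐍) (λ (x , y) → x ⊏ y)
      ⊏-asym    : ∀ {x y} → x ⊏ y → ¬ y ⊏ x
      ⊏-cotrans : ∀ {x y} z → x ⊏ y → x ⊏ z ⊎ z ⊏ y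

    ⊏-irrefl : ∀ {x} → ¬ x ⊏ x
    ⊏-irrefl p = ⊏-asym p p

    ⊏-trans : ∀ {x y z} → x ⊏ y → y ⊏ z → x ⊏ z
    ⊏-trans {z = z} p q with ⊏-cotrans z p
    ... | inj₁ r = r
    ... | inj₂ r = ⊥-elim (⊏-asym q r)

  opWeak : ∀ {_⊏_} → IsStrictWeak _⊏_ → IsStrictWeak (op _⊏_)
  opWeak W = record
    { ⊏-def     = at₂ ⊏-def sndᶠ fstᶠ
    ; ⊏-asym    = ⊏-asym
    ; ⊏-cotrans = λ z p → [ inj₂ , inj₁ ]′ (⊏-cotrans z p)
    }
    where open IsStrictWeak W

  data Kind : Set where
    inc dec con : Kind

  Ordered : Rel N ℓ → Kind → Rel N ℓ
  Ordered _⊏_ inc x y = x ⊏ y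
  Ordered _⊏_ dec x y = y ⊏ x
  Ordered _⊏_ con x y = ¬ x ⊏ y × ¬ y ⊏ x

  module _ {_⊏_ : Rel N ℓ} (W : IsStrictWeak _⊏_) where
    open IsStrictWeak W

    Ordered-trans : ∀ k {x y z} → Ordered _⊏_ k x y → Ordered _⊏_ k y z → Ordered _⊏_ k x z
    Ordered-trans inc p q = ⊏-trans p q
    Ordered-trans dec p q = ⊏-trans q p
    Ordered-trans con {y = y} (p , p′) (q , q′) =
      (λ r → [ p , q ]′ (⊏-cotrans y r)) , (λ r → [ q′ , p′ ]′ (⊏-cotrans y r))

    con-sym : ∀ {x y} → Ordered _⊏_ con x y → Ordered _⊏_ con y x
    con-sym (p , q) = q , p

    Orderedᵈ : ∀ k {Γ f g} → DefFun Γ 𝐍 f → DefFun Γ 𝐍 g → IsDef Γ (λ γ → Ordered _⊏_ k (f γ) (g γ))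
    Orderedᵈ inc F G = at₂ ⊏-def F G
    Orderedᵈ dec F G = at₂ ⊏-def G F
    Orderedᵈ con F G = ¬ᵈ (at₂ ⊏-def F G) ∧ᵈ ¬ᵈ (at₂ ⊏-def G F)

    con-excludes : ∀ k → k ≢ con → ∀ {x y} → Ordered _⊏_ con x y → ¬ Ordered _⊏_ k x y
    con-excludes inc _ (p , _) = p
    con-excludes dec _ (_ , p) = p
    con-excludes con n _ _     = n refl

  module Sides {_<_ : Rel N ℓ} (L : IsLine _<_) where

    open Germs L public
    module ᵒ = Germs (opLine L)

    -- Induction along the order. Let `s` be the infimum of the points that `x` is not related to. A
    -- point just before `s` is related to `x` and to `s`, so `ρ x s`; the hypothesis on the right
    -- of `s` then clears an interval after `s`.
    propagate : ∀ {ρ : Rel N ℓ} → IsDef (𝐍 ⊗ 𝐍) (λ (x , y) → ρ x y) →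
                (∀ {x y z} → ρ x y → ρ y z → ρ x z) → ∀ {x y} → x < y →
                (∀ z → ¬ z < x → ¬ y < z → Ev at⟨ z ⟩ (ρ z)) →
                (∀ z → x < z → ¬ y < z → ᵒ.Ev at⟨ z ⟩ (λ t → ρ t z)) → ρ x y
    propagate {ρ} D tr {x} {y} x<y right left = byContra λ ¬ρ → main ¬ρ
      (infimum bad-def (y , x<y , irrefl , ¬ρ) x (λ z (p , _) → asym p))
      where
      Bad : Pred N ℓ
      Bad z = x < z × ¬ y < z × ¬ ρ x z
      bad-def : IsDef 𝐍 Bad
      bad-def = <ᵈ′ (constᶠ x) idᶠ ∧ᵈ ¬ᵈ (<ᵈ′ (constᶠ y) idᶠ) ∧ᵈ ¬ᵈ (at₂ D (constᶠ x) idᶠ)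
      main : ¬ ρ x y → ∃ (GreatestLower Bad) → ⊥
      main ¬ρ (s , lb , gl) with cmp s x
      ... | inj₁ s<x = let z , (p , _) , q = gl x s<x in asym p q
      ... | inj₂ (inj₁ refl) =
        let ev r s<r h = right s irrefl (asym x<y)
            z , (p , _ , n) , q = gl r s<r
        in n (h z p q)
      ... | inj₂ (inj₂ x<s) =
        let y≮s = lb y (x<y , irrefl , ¬ρ)
            t , t<s , ρts , x<t = ᵒ.Ev-∃ (ᵒ.Ev-∧ (left s x<s y≮s) (ᵒ.Ev-< x<s))
            ρxt = byContra λ n → lb t (x<t , (λ q → y≮s (<-trans q t<s)) , n) t<s
            ρxs = tr ρxt ρts
            ev r s<r h = right s (asym x<s) y≮s
            z , b , z<r = gl r s<r
        in case ≤-split (lb z b) of λ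
             { (inj₁ s<z)  → proj₂ (proj₂ b) (tr ρxs (h z s<z z<r))
             ; (inj₂ s≡z)  → proj₂ (proj₂ b) (subst (ρ x) s≡z ρxs) }

    -- Connectedness of an interval, in the form needed for intermediate values: the supremum of `P`
    -- between `u` and `v` can belong to neither set, each being open on the side that matters.
    between : ∀ {P Q : Pred N ℓ} → IsDef 𝐍 P → (∀ x → P x → ¬ Q x) →
              ∀ {u v} → u < v → P u → Q v →
              (∀ x → P x → ¬ x < u → x < v → Ev at⟨ x ⟩ P) →
              (∀ x → Q x → u < x → ¬ v < x → ᵒ.Ev at⟨ x ⟩ Q) →
              ∃[ x ] u < x × x < v × ¬ P x × ¬ Q x
    between {P} {Q} D disj {u} {v} u<v Pu Qv right left = s , u<s , s<v , ¬Ps , ¬Qs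
      where
      T : Pred N ℓ
      T x = ¬ x < u × ¬ v < x × P x
      T-def : IsDef 𝐍 T
      T-def = ¬ᵈ (<ᵈ′ idᶠ (constᶠ u)) ∧ᵈ ¬ᵈ (<ᵈ′ (constᶠ v) idᶠ) ∧ᵈ D
      sup : ∃ (ᵒ.GreatestLower T)
      sup = ᵒ.infimum T-def (u , irrefl , asym u<v , Pu) v (λ _ t → proj₁ (proj₂ t))
      s = proj₁ sup
      ub = proj₁ (proj₂ sup)
      lu = proj₂ (proj₂ sup)
      s≮u : ¬ s < u
      s≮u = ub u (irrefl , asym u<v , Pu)
      v≮s : ¬ v < s
      v≮s p = let _ , (_ , n , _) , q = lu v p in n q
      ¬Ps : ¬ P s
      ¬Ps Ps with ≤-split v≮s
      ... | inj₂ s≡v = disj v (subst P s≡v Ps) Qv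
      ... | inj₁ s<v =
        let x , s<x , Px , x<v = Ev-∃ (Ev-∧ (right s Ps s≮u s<v) (Ev-< s<v))
        in ub x ((λ q → s≮u (<-trans s<x q)) , asym x<v , Px) s<x
      u<s : u < s
      u<s with ≤-split s≮u
      ... | inj₁ p    = p
      ... | inj₂ u≡s = ⊥-elim (¬Ps (subst P u≡s Pu))
      ¬Qs : ¬ Q s
      ¬Qs Qs with left s Qs u<s v≮s
      ... | ev l l<s h with lu l l<s
      ... | x , t@(_ , _ , Px) , l<x with ≤-split (ub x t)
      ... | inj₁ x<s = disj x Px (h x x<s l<x)
      ... | inj₂ x≡s = ¬Ps (subst P x≡s Px)
      s<v : s < v
      s<v with ≤-split v≮s
      ... | inj₁ p    = p
      ... | inj₂ s≡v = ⊥-elim (¬Qs (subst Q (sym s≡v) Qv))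

    module _ {_⊏_ : Rel N ℓ} (W : IsStrictWeak _⊏_) where
      open IsStrictWeak W

      LocalMin : Pred N ℓ
      LocalMin x = Ev at⟨ x ⟩ (x ⊏_) × ᵒ.Ev at⟨ x ⟩ (x ⊏_)

      Drop : Pred N ℓ
      Drop e = ∃[ c ] ᵒ.Ev at⟨ e ⟩ (c ⊏_) × Ev at⟨ e ⟩ (_⊏ c)

      Drop-def : IsDef 𝐍 Drop
      Drop-def = ∃ᵈ (ᵒ.Ev-atᵈ sndᶠ (at₂ ⊏-def (S v0) v0) ∧ᵈ Ev-atᵈ sndᶠ (at₂ ⊏-def v0 (S v0)))

      -- Choose `c` close to `v`, among points that are not below everything to their right. Then
      -- the points just before `v` must lie below `c`, and the crossing takes place at the supremum
      -- of the points after `c` that do not.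
      drop : ∀ {u v} → u < v → (∀ x → u < x → x < v → LocalMin x) →
             ∃[ e ] u < e × e < v × Drop e
      drop {u} {v} u<v lm with ᵒ.germ B-def at⟨ v ⟩
        where
        -- The points below everything to their right: near v there are none of
        -- them, since they would form an interval on which ⊏ increases.
        B-def : IsDef 𝐍 (λ x → ∀ y → x < y → y < v → x ⊏ y)
        B-def = ∀ᵈ (<ᵈ′ (S idᶠ) v0 ⇒ᵈ <ᵈ′ v0 (constᶠ v) ⇒ᵈ at₂ ⊏-def (S idᶠ) v0)
      ... | inj₁ all =
        let ev w w<v h = ᵒ.Ev-∧ all (ᵒ.Ev-< u<v)
            x , x<v , w<x , u<x = ᵒ.Ev-∃ (ᵒ.Ev-∧ (ᵒ.Ev-< w<v) (ᵒ.Ev-< u<v))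
            y , y<x , x⊏y , w<y = ᵒ.Ev-∃ (ᵒ.Ev-∧ (proj₂ (lm x u<x x<v)) (ᵒ.Ev-< w<x))
        in ⊥-elim (⊏-asym x⊏y (proj₁ (h y (<-trans y<x x<v) w<y) x y<x x<v))
      ... | inj₂ (ev w w<v ¬B) with ᵒ.Ev-∃ (ᵒ.Ev-∧ (ᵒ.Ev-< w<v) (ᵒ.Ev-< u<v))
      ... | c , c<v , w<c , u<c with ᵒ.germ (at₂ ⊏-def (constᶠ c) idᶠ) at⟨ v ⟩
                                   | ᵒ.germ (at₂ ⊏-def idᶠ (constᶠ c)) at⟨ v ⟩
      -- Were the points before `v` above `c`, the supremum `s` of those that are not would be below
      -- everything after it, against the choice of `w`.
      ... | inj₁ (ev d d<v h) | _ = ⊥-elim (¬B s s<v (<-≤-trans w<c s≮c) s∈B)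
        where
        T : Pred N ℓ
        T y = ¬ y < c × y < v × ¬ c ⊏ y
        c∈T : T c
        c∈T = irrefl , c<v , ⊏-irrefl
        T≤d : ∀ y → T y → ¬ d < y
        T≤d y (_ , y<v , n) d<y = n (h y y<v d<y)
        sup : ∃ (ᵒ.GreatestLower T)
        sup = ᵒ.infimum (¬ᵈ (<ᵈ′ idᶠ (constᶠ c)) ∧ᵈ <ᵈ′ idᶠ (constᶠ v) ∧ᵈ
                         ¬ᵈ (at₂ ⊏-def (constᶠ c) idᶠ)) (c , c∈T) d T≤d
        s = proj₁ sup
        ub = proj₁ (proj₂ sup)
        lu = proj₂ (proj₂ sup)
        s≮c : ¬ s < c
        s≮c = ub c c∈T
        s<v : s < v
        s<v = ≤-<-trans (λ d<s → let y , t , q = lu d d<s in T≤d y t q) d<v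
        c⋢s : ¬ c ⊏ s
        c⋢s c⊏s with proj₂ (lm s (<-≤-trans u<c s≮c) s<v)
        ... | ev l l<s k with lu l l<s
        ... | y , t , l<y with ≤-split (ub y t)
        ... | inj₁ y<s  = proj₂ (proj₂ t) (⊏-trans c⊏s (k y y<s l<y))
        ... | inj₂ y≡s  = proj₂ (proj₂ t) (subst (c ⊏_) (sym y≡s) c⊏s)
        s∈B : ∀ y → s < y → y < v → s ⊏ y
        s∈B y s<y y<v with ⊏-cotrans s (byContra λ n →
                             ub y ((λ y<c → s≮c (<-trans s<y y<c)) , y<v , n) s<y)
        ... | inj₁ c⊏s = ⊥-elim (c⋢s c⊏s)
        ... | inj₂ s⊏y = s⊏y
      -- A stretch of points all equivalent to `c` contains no strict local minimum.
      ... | inj₂ p | inj₂ q =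
        let ev d d<v h = ᵒ.Ev-∧ p q
            y , y<v , d<y , u<y = ᵒ.Ev-∃ (ᵒ.Ev-∧ (ᵒ.Ev-< d<v) (ᵒ.Ev-< u<v))
            z , y<z , y⊏z , z<v = Ev-∃ (Ev-∧ (proj₁ (lm y u<y y<v)) (Ev-< y<v))
        in ⊥-elim ([ proj₂ (h y y<v d<y) , proj₁ (h z z<v (<-trans d<y y<z)) ]′ (⊏-cotrans c y⊏z))
      -- Everything between `e` and `v` is below `c`, and so is the local minimum `e` itself. As
      -- points not below `c` accumulate at `e`, they do so from the left.
      ... | inj₂ _ | inj₁ (ev d d<v h) = e , <-trans u<c c<e , e<v , c , left ,
          ev v e<v (λ y e<y y<v → byContra λ n → ub y (<-trans c<e e<y , y<v , n) e<y)
        where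
        T : Pred N ℓ
        T y = c < y × y < v × ¬ y ⊏ c
        T≤d : ∀ y → T y → ¬ d < y
        T≤d y (_ , y<v , n) d<y = n (h y y<v d<y)
        ∃T : ∃ T
        ∃T = let y , c<y , c⊏y , y<v = Ev-∃ (Ev-∧ (proj₁ (lm c u<c c<v)) (Ev-< c<v))
             in y , c<y , y<v , ⊏-asym c⊏y
        sup : ∃ (ᵒ.GreatestLower T)
        sup = ᵒ.infimum (<ᵈ′ (constᶠ c) idᶠ ∧ᵈ <ᵈ′ idᶠ (constᶠ v) ∧ᵈ
                         ¬ᵈ (at₂ ⊏-def idᶠ (constᶠ c))) ∃T d T≤d
        e = proj₁ sup
        ub = proj₁ (proj₂ sup)
        lu = proj₂ (proj₂ sup)
        c<e : c < e
        c<e = <-≤-trans (proj₁ (proj₂ ∃T)) (ub _ (proj₂ ∃T))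
        e<v : e < v
        e<v = ≤-<-trans (λ d<e → let y , t , q = lu d d<e in T≤d y t q) d<v
        e⊏c : e ⊏ c
        e⊏c = let y , e<y , e⊏y , y<v = Ev-∃ (Ev-∧ (proj₁ (lm e (<-trans u<c c<e) e<v)) (Ev-< e<v))
              in byContra λ n → n (⊏-trans e⊏y (byContra λ m →
                   ub y (<-trans c<e e<y , y<v , m) e<y))
        left : ᵒ.Ev at⟨ e ⟩ (c ⊏_)
        left with ᵒ.germ (at₂ ⊏-def (constᶠ c) idᶠ) at⟨ e ⟩
                | ᵒ.germ (at₂ ⊏-def idᶠ (constᶠ c)) at⟨ e ⟩
        ... | inj₁ p | _ = p
        ... | inj₂ p | inj₂ q = ⊥-elim (level (ᵒ.Ev-∧ p q))
          where
          level : ¬ ᵒ.Ev at⟨ e ⟩ (λ y → ¬ c ⊏ y × ¬ y ⊏ c)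
          level (ev l l<e k) with ᵒ.Ev-∃ (ᵒ.Ev-∧ (ᵒ.Ev-< l<e) (ᵒ.Ev-< c<e))
          ... | y , y<e , l<y , c<y
            with Ev-∃ (Ev-∧ (proj₁ (lm y (<-trans u<c c<y) (<-trans y<e e<v))) (Ev-< y<e))
          ... | z , y<z , y⊏z , z<e =
            [ proj₂ (k y y<e l<y) , proj₁ (k z z<e (<-trans l<y y<z)) ]′ (⊏-cotrans c y⊏z)
        ... | inj₂ _ | inj₁ (ev l l<e k) with lu l l<e
        ... | y , t , l<y with ≤-split (ub y t)
        ... | inj₁ y<e  = ⊥-elim (proj₂ (proj₂ t) (k y y<e l<y))
        ... | inj₂ y≡e  = ⊥-elim (proj₂ (proj₂ t) (subst (_⊏ c) (sym y≡e) e⊏c))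

  module _ {_<_ : Rel N ℓ} (L : IsLine _<_) where

    private
      module R = Sides L
      module Lᵒ = Sides (opLine L)
    open Sides L

    -- Every interval would contain a point crossing some level of ⊏ downwards
    -- and, by symmetry, an interval of such points would contain one crossing a
    -- level upwards.
    no-interval-of-local-minima : ∀ {_⊏_} → (W : IsStrictWeak _⊏_) → ∀ {u v} → u < v →
                                  ¬ (∀ x → u < x → x < v → LocalMin W x)
    no-interval-of-local-minima {_⊏_} W {u} {v} u<v lm with germ (Drop-def W) at⟨ u ⟩
    ... | inj₂ none =
      let ev w u<w h = Ev-∧ none (Ev-< u<v)
          w′ , u<w′ , w′<w , w′<v = Ev-∃ (Ev-∧ (Ev-< u<w) (Ev-< u<v))
          e , u<e , e<w′ , d = drop W u<w′ (λ x p q → lm x p (<-trans q w′<v))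
      in proj₁ (h e u<e (<-trans e<w′ w′<w)) d
    ... | inj₁ all =
      let ev w u<w h = all
          w′ , u<w′ , w′<w , w′<v = Ev-∃ (Ev-∧ (Ev-< u<w) (Ev-< u<v))
          e , e<w′ , u<e , c , up , down = Lᵒ.drop W u<w′
            (λ x q p → let r , l = lm x p (<-trans q w′<v) in l , r)
          c′ , up′ , down′ = h e u<e (<-trans e<w′ w′<w)
          y , _ , c′⊏y , y⊏c = ᵒ.Ev-∃ (ᵒ.Ev-∧ up′ down)
          z , _ , z⊏c′ , c⊏z = Ev-∃ (Ev-∧ down′ up)
      in ⊏-asym (⊏-trans c′⊏y y⊏c) (⊏-trans c⊏z z⊏c′)
      where open IsStrictWeak W

    module _ {_⊏_ : Rel N ℓ} (W : IsStrictWeak _⊏_) where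
      open IsStrictWeak W

      private
        RightKind LeftKind : Kind → Pred N ℓ
        RightKind k x = Ev at⟨ x ⟩ (λ y → Ordered _⊏_ k x y)
        LeftKind k x  = ᵒ.Ev at⟨ x ⟩ (λ y → Ordered _⊏_ k y x)

        rightKind : ∀ a → ∃[ k ] Ev a (RightKind k)
        rightKind a with germ (Ev-atᵈ idᶠ (Orderedᵈ W inc (S idᶠ) v0)) a
                       | germ (Ev-atᵈ idᶠ (Orderedᵈ W dec (S idᶠ) v0)) a
        ... | inj₁ p | _      = inc , p
        ... | inj₂ _ | inj₁ q = dec , q
        ... | inj₂ p | inj₂ q = con , Ev-map third (Ev-∧ p q)
          where
          third : ∀ x → ¬ RightKind inc x × ¬ RightKind dec x → RightKind con x
          third x (n , m) with germ (at₂ ⊏-def (constᶠ x) idᶠ) at⟨ x ⟩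
                             | germ (at₂ ⊏-def idᶠ (constᶠ x)) at⟨ x ⟩
          ... | inj₁ p | _      = ⊥-elim (n p)
          ... | inj₂ _ | inj₁ q = ⊥-elim (m q)
          ... | inj₂ p | inj₂ q = Ev-∧ p q

        leftKind : ∀ a → ∃[ k ] Ev a (LeftKind k)
        leftKind a with germ (ᵒ.Ev-atᵈ idᶠ (Orderedᵈ W inc v0 (S idᶠ))) a
                      | germ (ᵒ.Ev-atᵈ idᶠ (Orderedᵈ W dec v0 (S idᶠ))) a
        ... | inj₁ p | _      = inc , p
        ... | inj₂ _ | inj₁ q = dec , q
        ... | inj₂ p | inj₂ q = con , Ev-map third (Ev-∧ p q)
          where
          third : ∀ x → ¬ LeftKind inc x × ¬ LeftKind dec x → LeftKind con x
          third x (n , m) with ᵒ.germ (at₂ ⊏-def idᶠ (constᶠ x)) at⟨ x ⟩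
                             | ᵒ.germ (at₂ ⊏-def (constᶠ x) idᶠ) at⟨ x ⟩
          ... | inj₁ p | _      = ⊥-elim (n p)
          ... | inj₂ _ | inj₁ q = ⊥-elim (m q)
          ... | inj₂ p | inj₂ q = ᵒ.Ev-∧ p q

      OrderedBelow : Bound → Kind → Pred N ℓ
      OrderedBelow a k c = ∀ x y → a ◁ x → x < y → y < c → Ordered _⊏_ k x y

      abstract
        -- Near `a` the behaviour to the right of a point has a constant kind, and so has the
        -- behaviour to the left. Equal kinds propagate along the interval. Opposite strict kinds
        -- would give an interval of local minima, or of local maxima, and a constant side is
        -- incompatible with a strict one.
        eventually-ordered : ∀ a → ∃[ k ] Ev a (OrderedBelow a k)
        eventually-ordered a with rightKind a | leftKind a
        ... | kR , evR | kL , evL with Ev-∧ evR evL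
        ... | ev c a◁c h = compare kR kL (λ x p q → proj₁ (h x p q)) (λ x p q → proj₂ (h x p q))
          where
          In : Pred N ℓ → Set ℓ
          In P = ∀ x → a ◁ x → x < c → P x

          same : ∀ k → In (RightKind k) → In (LeftKind k) → ∃[ k ] Ev a (OrderedBelow a k)
          same k r l = k , ev c a◁c λ d _ d<c x y p x<y y<d →
            propagate (Orderedᵈ W k fstᶠ sndᶠ) (Ordered-trans W k) x<y
              (λ z z≮x y≮z → r z (inside p z≮x) (≤-<-trans y≮z (<-trans y<d d<c)))
              (λ z x<z y≮z → l z (◁-trans a p x<z) (≤-<-trans y≮z (<-trans y<d d<c)))
            where
            inside : ∀ {x z} → a ◁ x → ¬ z < x → a ◁ z
            inside p z≮x with ≤-split z≮x
            ... | inj₁ q    = ◁-trans a p q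
            ... | inj₂ refl = p

          con-right : ∀ k → k ≢ con → In (RightKind con) → ¬ In (LeftKind k)
          con-right k k≢con r l =
            let x , p , x<c = ◁-dense a a◁c
                ev d x<d e = r x p x<c
                y , x<y , y<d , y<c = Ev-∃ (Ev-∧ (Ev-< x<d) (Ev-< x<c))
                z , z<y , o , x<z = ᵒ.Ev-∃ (ᵒ.Ev-∧ (l y (◁-trans a p x<y) y<c) (ᵒ.Ev-< x<y))
            in con-excludes W k k≢con (Ordered-trans W con
                 (con-sym W (e z x<z (<-trans z<y y<d))) (e y x<y y<d)) o

          con-left : ∀ k → k ≢ con → In (LeftKind con) → ¬ In (RightKind k)
          con-left k k≢con l r =
            let x , p , x<c = ◁-dense a a◁c
                x₀ , p₀ , x₀<x = ◁-dense a p
                ev d d<x e = l x p x<c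
                y , y<x , d<y , x₀<y = ᵒ.Ev-∃ (ᵒ.Ev-∧ (ᵒ.Ev-< d<x) (ᵒ.Ev-< x₀<x))
                z , y<z , o , z<x = Ev-∃ (Ev-∧ (r y (◁-trans a p₀ x₀<y) (<-trans y<x x<c)) (Ev-< y<x))
            in con-excludes W k k≢con (Ordered-trans W con
                 (e y y<x d<y) (con-sym W (e z z<x (<-trans d<y y<z)))) o

          compare : ∀ kR kL → In (RightKind kR) → In (LeftKind kL) → ∃[ k ] Ev a (OrderedBelow a k)
          compare inc inc r l = same inc r l
          compare dec dec r l = same dec r l
          compare con con r l = same con r l
          compare inc dec r l = let u , p , u<c = ◁-dense a a◁c in
            ⊥-elim (no-interval-of-local-minima W u<c
              λ x q t → r x (◁-trans a p q) t , l x (◁-trans a p q) t)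
          compare dec inc r l = let u , p , u<c = ◁-dense a a◁c in
            ⊥-elim (no-interval-of-local-minima (opWeak W) u<c
              λ x q t → r x (◁-trans a p q) t , l x (◁-trans a p q) t)
          compare con inc r l = ⊥-elim (con-right inc (λ ()) r l)
          compare con dec r l = ⊥-elim (con-right dec (λ ()) r l)
          compare inc con r l = ⊥-elim (con-left inc (λ ()) l r)
          compare dec con r l = ⊥-elim (con-left dec (λ ()) l r)

      Inequivalent : Rel N ℓ → Set ℓ
      Inequivalent ρ = ∃[ u ] ∃[ v ] u < v × (∀ x y → u < x → x < y → y < v → ¬ ρ x y)

      Equivalent : Rel N ℓ → Bound → Pred N ℓ
      Equivalent ρ a c = ∀ x y → a ◁ x → x < y → y < c → ρ x y

      abstract
        -- If the points near `a` are inequivalent to those just after them, no class contains an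
        -- interval there, so every class has a least element after `a`. The least elements of
        -- classes then fill an interval, on which no two points are equivalent.
        transversal-or-constant : ∀ {ρ : Rel N ℓ} → IsDef (𝐍 ⊗ 𝐍) (λ (x , y) → ρ x y) →
          (∀ {x} → ρ x x) → (∀ {x y} → ρ x y → ρ y x) → (∀ {x y z} → ρ x y → ρ y z → ρ x z) →
          ∀ a → Inequivalent ρ ⊎ Ev a (Equivalent ρ a)
        transversal-or-constant {ρ} D ρ-refl ρ-sym ρ-trans a with germ A-def a
          where
          A : Pred N ℓ
          A x = Ev at⟨ x ⟩ (ρ x)
          A-def : IsDef 𝐍 A
          A-def = Ev-atᵈ idᶠ (at₂ D (S idᶠ) v0)
        ... | inj₁ right with germ (ᵒ.Ev-atᵈ idᶠ (at₂ D v0 (S idᶠ))) a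
        ... | inj₁ left = inj₂ (constant (Ev-∧ right left))
          where
          constant : Ev a (λ x → Ev at⟨ x ⟩ (ρ x) × ᵒ.Ev at⟨ x ⟩ (λ y → ρ y x)) →
                     Ev a (Equivalent ρ a)
          constant (ev c a◁c h) = ev c a◁c λ d _ d<c x y p x<y y<d →
            let below z y≮z = ≤-<-trans y≮z (<-trans y<d d<c)
            in propagate D ρ-trans x<y
                 (λ z z≮x y≮z → proj₁ (h z (inside p z≮x) (below z y≮z)))
                 (λ z x<z y≮z → proj₂ (h z (◁-trans a p x<z) (below z y≮z)))
            where
            inside : ∀ {x z} → a ◁ x → ¬ z < x → a ◁ z
            inside p z≮x with ≤-split z≮x
            ... | inj₁ q    = ◁-trans a p q
            ... | inj₂ refl = p
        -- All points just after `x` are equivalent to `x`, hence to one another, so none of them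
        -- can fail on its left.
        ... | inj₂ ¬left with Ev-∧ right ¬left
        ... | ev c a◁c h with ◁-dense a a◁c
        ... | x , p , x<c with proj₁ (h x p x<c)
        ... | ev d x<d e with Ev-∃ (Ev-∧ (Ev-< x<d) (Ev-< x<c))
        ... | y , x<y , y<d , y<c = ⊥-elim (proj₂ (h y (◁-trans a p x<y) y<c)
                (ev x x<y λ z z<y x<z → ρ-trans (ρ-sym (e z x<z (<-trans z<y y<d))) (e y x<y y<d)))
        transversal-or-constant {ρ} D ρ-refl ρ-sym ρ-trans a | inj₂ (ev c a◁c ¬A)
          with germ M-def a
          where
          M-def : IsDef 𝐍 (λ x → ∀ y → a ◁ y → y < x → ¬ ρ y x)
          M-def = ∀ᵈ (◁ᵈ a v0 ⇒ᵈ <ᵈ′ v0 (S idᶠ) ⇒ᵈ ¬ᵈ (at₂ D v0 (S idᶠ)))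
        ... | inj₁ (ev d a◁d m) =
          let u , p , u<d = ◁-dense a a◁d
          in inj₁ (u , d , u<d , λ x y u<x x<y y<d →
               m y (◁-trans a p (<-trans u<x x<y)) y<d x (◁-trans a p u<x) x<y)
        ... | inj₂ ¬m with Ev-∧ ¬m (Ev-< a◁c)
        ... | ev d a◁d m with ◁-dense a a◁d
        ... | x , a◁x , x<d = ⊥-elim (no-least (germ C-def a))
          where
          C : Pred N ℓ
          C y = a ◁ y × y < d × ρ y x
          C-def : IsDef 𝐍 C
          C-def = ◁ᵈ a idᶠ ∧ᵈ <ᵈ′ idᶠ (constᶠ d) ∧ᵈ at₂ D idᶠ (constᶠ x)
          no-germ : ∀ b → ¬ Ev b C
          no-germ b (ev e b◁e h) with ◁-dense b b◁e
          ... | y , b◁y , y<e with h y b◁y y<e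
          ... | a◁y , y<d , ρyx = ¬A y a◁y (proj₂ (m y a◁y y<d))
                  (ev e y<e λ z y<z z<e →
                    ρ-trans ρyx (ρ-sym (proj₂ (proj₂ (h z (◁-trans b b◁y y<z) z<e)))))
          least : ∀ s → GreatestLower C s → C s → ⊥
          least s (lb , _) (a◁s , s<d , ρsx) = proj₁ (m s a◁s s<d) λ y a◁y y<s ρys →
            lb y (a◁y , <-trans y<s s<d , ρ-trans ρys ρsx) y<s
          no-least : Ev a C ⊎ Ev a (λ y → ¬ C y) → ⊥
          no-least (inj₁ p) = no-germ a p
          no-least (inj₂ (ev e a◁e h))
            with infimum C-def (x , a◁x , x<d , ρ-refl) e (λ y Cy y<e → h y (proj₁ Cy) y<e Cy)
          ... | s , inf@(lb , gl) with germ C-def at⟨ s ⟩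
          ... | inj₁ p = no-germ at⟨ s ⟩ p
          ... | inj₂ (ev r s<r n) with gl r s<r
          ... | z , Cz , z<r with ≤-split (lb z Cz)
          ... | inj₁ s<z = n z s<z z<r Cz
          ... | inj₂ s≡z = least s inf (subst C (sym s≡z) Cz)

  -- Continuity of monotone functions.

  module Continuity {_<₁_ : Rel N ℓ} (L₁ : IsLine _<₁_) where

    private module D = Sides L₁

    Near : N → Pred N ℓ → Set ℓ
    Near x P = D.Ev at⟨ x ⟩ P × P x × D.ᵒ.Ev at⟨ x ⟩ P

    -- The order on the values is a separate argument, so that a decreasing function becomes an
    -- increasing one into the opposite line.
    ContAt : Rel N ℓ → (N → N) → Pred N ℓ
    ContAt _<₂_ f x = ∀ y z → y <₂ f x → f x <₂ z → Near x (λ t → y <₂ f t × f t <₂ z)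

    ContAt-def : ∀ {_<₂_} → IsLine _<₂_ → ∀ {f} → DefFun 𝐍 𝐍 f → IsDef 𝐍 (ContAt _<₂_ f)
    ContAt-def L₂ F = ∀ᵈ (∀ᵈ (at₂ lt (S v0) (F ∘ᶠ S (S idᶠ)) ⇒ᵈ at₂ lt (F ∘ᶠ S (S idᶠ)) v0 ⇒ᵈ
      D.Ev-atᵈ (S (S idᶠ)) (at₂ lt (S (S v0)) (F ∘ᶠ v0) ∧ᵈ at₂ lt (F ∘ᶠ v0) (S v0)) ∧ᵈ
      (at₂ lt (S v0) (F ∘ᶠ S (S idᶠ)) ∧ᵈ at₂ lt (F ∘ᶠ S (S idᶠ)) v0) ∧ᵈ
      D.ᵒ.Ev-atᵈ (S (S idᶠ)) (at₂ lt (S (S v0)) (F ∘ᶠ v0) ∧ᵈ at₂ lt (F ∘ᶠ v0) (S v0))))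
      where lt = IsLine.<-def L₂

    module _ {_<₂_ : Rel N ℓ} (L₂ : IsLine _<₂_) where

      private module T = Sides L₂

      -- On an interval, an increasing function with nowhere dense image would
      -- have an image without supremum; where the image contains an interval,
      -- the function is an order isomorphism.
      increasing⇒continuous : ∀ {f} → DefFun 𝐍 𝐍 f → ∀ a {c} → a D.◁ c →
        (∀ x y → a D.◁ x → x <₁ y → y <₁ c → f x <₂ f y) → D.Ev a (ContAt _<₂_ f)
      increasing⇒continuous {f} F a {c} a◁c mono with D.germ (ContAt-def L₂ F) a
      ... | inj₁ p = p
      ... | inj₂ n with D.Ev-∧ n (D.Ev-< a◁c)
      ... | ev d a◁d h with D.◁-dense a a◁d
      ... | x₂ , a◁x₂ , x₂<d with D.◁-dense a a◁x₂
      ... | x₁ , a◁x₁ , x₁<x₂ = ⊥-elim (no-sup (T.ᵒ.infimum Im-def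
              (let x , p , q = D.dense x₁<x₂ in f x , x , p , q , refl) (f x₂) bounded))
        where
        x₂<c : x₂ <₁ c
        x₂<c = proj₂ (h x₂ a◁x₂ x₂<d)
        Im : Pred N ℓ
        Im y = ∃[ x ] x₁ <₁ x × x <₁ x₂ × f x ≡ y
        Im-def : IsDef 𝐍 Im
        Im-def = ∃ᵈ (D.<ᵈ′ (constᶠ x₁) v0 ∧ᵈ D.<ᵈ′ v0 (constᶠ x₂) ∧ᵈ
                     mapDef (λ _ → mk⇔ (cong Vec.head) (cong (_∷ [])))
                            (at₂ (Eqᵈ 𝐍) (F ∘ᶠ v0) (S idᶠ)))
        bounded : ∀ y → Im y → ¬ f x₂ <₂ y
        bounded _ (x , x₁<x , x<x₂ , refl) =
          T.asym (mono x x₂ (D.◁-trans a a◁x₁ x₁<x) x<x₂ x₂<c)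
        mono′ : ∀ {x y} → x₁ <₁ x → x <₁ y → y <₁ x₂ → f x <₂ f y
        mono′ p q r = mono _ _ (D.◁-trans a a◁x₁ p) q (D.<-trans r x₂<c)
        reflect : ∀ {x y} → x₁ <₁ y → x <₁ x₂ → f x <₂ f y → x <₁ y
        reflect {x} {y} p q r with D.cmp x y
        ... | inj₁ t           = t
        ... | inj₂ (inj₁ refl) = ⊥-elim (T.irrefl r)
        ... | inj₂ (inj₂ t)    = ⊥-elim (T.asym r (mono′ p t q))
        continuous : ∀ {l r} → l <₂ r → (∀ y → l <₂ y → y <₂ r → Im y) →
                     ∃[ z ] x₁ <₁ z × z <₁ x₂ × ContAt _<₂_ f z
        continuous {l} {r} l<r im with T.dense l<r
        ... | y , l<y , y<r with im y l<y y<r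
        ... | z , x₁<z , z<x₂ , refl = z , x₁<z , z<x₂ , λ p q p<fz fz<q →
              right p q p<fz fz<q , (p<fz , fz<q) , left p q p<fz fz<q
          where
          right : ∀ p q → p <₂ f z → f z <₂ q → D.Ev at⟨ z ⟩ (λ t → p <₂ f t × f t <₂ q)
          right p q p<fz fz<q with T.Ev-∃ (T.Ev-∧ (T.Ev-< fz<q) (T.Ev-< y<r))
          ... | q′ , fz<q′ , q′<q , q′<r with im q′ (T.<-trans l<y fz<q′) q′<r
          ... | w , x₁<w , w<x₂ , refl = ev w (reflect x₁<w z<x₂ fz<q′) λ t z<t t<w →
                T.<-trans p<fz (mono′ x₁<z z<t (D.<-trans t<w w<x₂)) ,
                T.<-trans (mono′ (D.<-trans x₁<z z<t) t<w w<x₂) q′<q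
          left : ∀ p q → p <₂ f z → f z <₂ q → D.ᵒ.Ev at⟨ z ⟩ (λ t → p <₂ f t × f t <₂ q)
          left p q p<fz fz<q with T.ᵒ.Ev-∃ (T.ᵒ.Ev-∧ (T.ᵒ.Ev-< p<fz) (T.ᵒ.Ev-< l<y))
          ... | p′ , p′<fz , p<p′ , l<p′ with im p′ l<p′ (T.<-trans p′<fz y<r)
          ... | w , x₁<w , w<x₂ , refl = ev w (reflect x₁<z w<x₂ p′<fz) λ t t<z w<t →
                T.<-trans p<p′ (mono′ x₁<w w<t (D.<-trans t<z z<x₂)) ,
                T.<-trans (mono′ (D.<-trans x₁<w w<t) t<z z<x₂) fz<q
        no-max : ∀ {s} x → x₁ <₁ x → x <₁ x₂ → f x ≡ s → ¬ T.ᵒ.GreatestLower Im s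
        no-max x p q refl (ub , _) with D.dense q
        ... | x′ , r , t = ub (f x′) (x′ , D.<-trans p r , t , refl) (mono′ p r t)
        no-sup : ¬ ∃ (T.ᵒ.GreatestLower Im)
        no-sup (s , lub@(ub , lu)) with T.ᵒ.germ Im-def at⟨ s ⟩
        ... | inj₁ (ev l l<s k) = let z , x₁<z , z<x₂ , C = continuous l<s (λ y p q → k y q p)
              in proj₁ (h z (D.◁-trans a a◁x₁ x₁<z) (D.<-trans z<x₂ x₂<d)) C
        ... | inj₂ (ev l l<s k) with lu l l<s
        ... | y , im@(x , p , q , e) , l<y with T.≤-split (ub y im)
        ... | inj₁ y<s = k y y<s l<y im
        ... | inj₂ y≡s = no-max x p q (trans e y≡s) lub

  module _ {_<_ : Rel N ℓ} (L : IsLine _<_) where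

    open Sides L
    open Continuity L

    valueOrder : ∀ {f} → DefFun 𝐍 𝐍 f → IsStrictWeak (λ x y → f x < f y)
    valueOrder {f} F = record
      { ⊏-def = <ᵈ′ (F ∘ᶠ fstᶠ) (F ∘ᶠ sndᶠ)
      ; ⊏-asym = asym
      ; ⊏-cotrans = cotrans
      }
      where
      cotrans : ∀ {x y} z → f x < f y → f x < f z ⊎ f z < f y
      cotrans {x} {y} z p with cmp (f x) (f z)
      ... | inj₁ q        = inj₁ q
      ... | inj₂ (inj₁ e) = inj₂ (subst (_< f y) e p)
      ... | inj₂ (inj₂ q) = inj₂ (<-trans q p)

    eventually-continuous : ∀ {f} (F : DefFun 𝐍 𝐍 f) a k {c} → a ◁ c →
                            OrderedBelow L (valueOrder F) a k c → Ev a (ContAt _<_ f)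
    eventually-continuous F a inc p h = increasing⇒continuous L F a p h
    eventually-continuous {f} F a dec p h =
      Ev-map swapped (increasing⇒continuous (opLine L) F a p h)
      where
      swapped : ∀ x → ContAt (op _<_) f x → ContAt _<_ f x
      swapped x C y z p q with C z y q p
      ... | r , (s , t) , l = Ev-map (λ _ (u , v) → v , u) r , (t , s) ,
                              ᵒ.Ev-map (λ _ (u , v) → v , u) l
    eventually-continuous {f} F a con {c} a◁c h = ev c a◁c λ x a◁x x<c y z p q →
      ev c x<c (λ t x<t t<c → moved (h x t a◁x x<t t<c) p q) , (p , q) , left x a◁x x<c p q
      where
      moved : ∀ {u v y z} → Ordered (λ x y → f x < f y) con u v → y < f u → f u < z →
              y < f v × f v < z
      moved {u} {v} (n , m) p q with cmp (f u) (f v)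
      ... | inj₁ r        = ⊥-elim (n r)
      ... | inj₂ (inj₁ e) = subst (_ <_) e p , subst (_< _) e q
      ... | inj₂ (inj₂ r) = ⊥-elim (m r)
      left : ∀ x → a ◁ x → x < c → ∀ {y z} → y < f x → f x < z →
             ᵒ.Ev at⟨ x ⟩ (λ t → y < f t × f t < z)
      left x a◁x x<c p q with ◁-dense a a◁x
      ... | x₀ , a◁x₀ , x₀<x = ev x₀ x₀<x λ t t<x x₀<t →
        moved (con-sym (valueOrder F) {t} {x} (h t x (◁-trans a a◁x₀ x₀<t) t<x x<c)) p q

    abstract
      monotonicity : ∀ {f} (F : DefFun 𝐍 𝐍 f) a →
                     ∃[ k ] Ev a (λ c → OrderedBelow L (valueOrder F) a k c × ContAt _<_ f c)
      monotonicity F a with eventually-ordered L (valueOrder F) a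
      ... | k , e@(ev c a◁c h) with ◁-dense a a◁c
      ... | d , a◁d , d<c = k , Ev-∧ e (eventually-continuous F a k a◁d (h d a◁d d<c))

-- Boxes, and uniformity on smaller boxes.

module Boxes (em : ∀ {a} → ExcludedMiddle a) {ℓ} (𝒩 : OrderedStructure ℓ)
             {_<_ : Rel (OrderedStructure.Carrier 𝒩) ℓ} (L : Lines.IsLine em 𝒩 _<_) where

  open Definability 𝒩
  open Lines em 𝒩
  open Monotonicity em 𝒩
  open Sides L
  open Continuity L
  open OrderedStructure 𝒩 using () renaming (Carrier to N)

  In : ∀ {n} → Vec N n → Vec N n → Vec N n → Set ℓ
  In lo hi p = Pointwise _<_ lo p × Pointwise _<_ p hi

  Pointwiseᵈ : ∀ n → IsDef (𝐕 n ⊗ 𝐕 n) (λ (x , y) → Pointwise _<_ x y)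
  Pointwiseᵈ zero = mapDef (λ { ([] , []) → mk⇔ (λ _ → []) (λ _ → refl) }) (Eqᵈ (𝐕 zero))
  Pointwiseᵈ (suc n) =
    mapDef (λ { (x ∷ xs , y ∷ ys) → mk⇔ (λ (p , q) → p ∷ q) (λ { (p ∷ q) → p , q }) })
      (<ᵈ′ (headᶠ ∘ᶠ fstᶠ) (headᶠ ∘ᶠ sndᶠ) ∧ᵈ
       at₂ (Pointwiseᵈ n) (tailᶠ ∘ᶠ fstᶠ) (tailᶠ ∘ᶠ sndᶠ))

  Inᵈ : ∀ {n Γ f g h} → DefFun Γ (𝐕 n) f → DefFun Γ (𝐕 n) g → DefFun Γ (𝐕 n) h →
        IsDef Γ (λ γ → In (f γ) (g γ) (h γ))
  Inᵈ F G H = at₂ (Pointwiseᵈ _) F H ∧ᵈ at₂ (Pointwiseᵈ _) H G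

  In-∩ : ∀ {n} {lo hi lo′ hi′ p : Vec N n} → In lo hi p → In lo′ hi′ p →
         ∃[ l ] ∃[ h ] In l h p × (∀ q → In l h q → In lo hi q × In lo′ hi′ q)
  In-∩ ([] , []) ([] , []) = [] , [] , ([] , []) , λ { [] i → i , i }
  In-∩ (l<p ∷ ls , p<h ∷ hs) (l′<p ∷ ls′ , p<h′ ∷ hs′)
    with ᵒ.Ev-∃ (ᵒ.Ev-∧ (ᵒ.Ev-< l<p) (ᵒ.Ev-< l′<p)) | Ev-∃ (Ev-∧ (Ev-< p<h) (Ev-< p<h′))
       | In-∩ (ls , hs) (ls′ , hs′)
  ... | l , l<p , r , r′ | h , p<h , t , t′ | lo , hi , (a , b) , k =
    l ∷ lo , h ∷ hi , (l<p ∷ a , p<h ∷ b) , λ { (q ∷ qs) (c ∷ cs , d ∷ ds) →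
      let (e , f) , (e′ , f′) = k qs (cs , ds)
      in (<-trans r c ∷ e , <-trans d t ∷ f) , (<-trans r′ c ∷ e′ , <-trans d t′ ∷ f′) }

  record Box (n : ℕ) : Set ℓ where
    constructor box
    field
      {lo} {hi} : Vec N n
      lo<hi     : Pointwise _<_ lo hi
  open Box public

  infix 4 _∈_ _⊑_
  _∈_ : ∀ {n} → Vec N n → Box n → Set ℓ
  p ∈ B = In (lo B) (hi B) p

  _⊑_ : ∀ {n} → Box n → Box n → Set ℓ
  B ⊑ B′ = ∀ p → p ∈ B → p ∈ B′

  infixr 5 _⨯_
  _⨯_ : ∀ {u v n} → u < v → Box n → Box (suc n)
  u<v ⨯ B = box (u<v ∷ lo<hi B)

  ⨯-⊑ : ∀ {u v n l h} {lo hi : Vec N n} (u<v : u < v) (B : Box n) (l<h : l < h)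
        (b : Pointwise _<_ lo hi) → ¬ u < l → ¬ h < v → B ⊑ box b →
        (u<v ⨯ B) ⊑ box (l<h ∷ b)
  ⨯-⊑ _ _ _ _ u≮l h≮v s (x ∷ q) (u<x ∷ a , x<v ∷ b) =
    let c , d = s q (a , b) in ≤-<-trans u≮l u<x ∷ c , <-≤-trans x<v h≮v ∷ d

  ∈-box : ∀ {n} {l h p : Vec N n} → In l h p → Σ[ B ∈ Box n ] p ∈ B × (∀ q → q ∈ B → In l h q)
  ∈-box (a , b) = box (Pw.trans <-trans a b) , (a , b) , λ _ → id

  centre : ∀ {n} (B : Box n) → ∃[ p ] p ∈ B
  centre (box [])          = [] , [] , []
  centre (box (u<v ∷ lo<hi)) with dense u<v | centre (box lo<hi)
  ... | x , u<x , x<v | p , a , b = x ∷ p , u<x ∷ a , x<v ∷ b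

  -- The substitute for cell decomposition: on a smaller box a definable condition is constant, and
  -- germs that exist for every point have a common length. The two properties are proved by a joint
  -- induction on the dimension.
  record Uniform (n : ℕ) : Set (lsuc ℓ) where
    field
      decideOn : ∀ (B : Box n) {P} → IsDef (𝐕 n) P →
                 Σ[ B′ ∈ Box n ] B′ ⊑ B × ((∀ q → q ∈ B′ → P q) ⊎ (∀ q → q ∈ B′ → ¬ P q))
      uniformly : ∀ (B : Box n) a {K} → IsDef (𝐍 ⊗ 𝐕 n) K →
                  (∀ q → q ∈ B → Ev a (λ w → K (w , q))) →
                  Σ[ B′ ∈ Box n ] B′ ⊑ B × Ev a (λ w → ∀ q → q ∈ B′ → K (w , q))

    -- The kind may depend on `q`. Two applications of `decideOn` either fix a strict kind on a
    -- smaller box or leave only `con`.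
    uniformKind : ∀ (B : Box n) u {_⊏[_]_ : N → Vec N n → N → Set ℓ} →
                  IsDef (𝐍 ⊗ (𝐍 ⊗ 𝐕 n)) (λ (x , y , q) → x ⊏[ q ] y) →
                  (W : ∀ q → IsStrictWeak (λ x y → x ⊏[ q ] y)) →
                  ∃[ k ] Σ[ B′ ∈ Box n ] B′ ⊑ B ×
                  Ev at⟨ u ⟩ (λ c → ∀ q → q ∈ B′ → OrderedBelow L (W q) at⟨ u ⟩ k c)
    uniformKind B u {_⊏[_]_} D W = choose
      where
      K : Kind → N × Vec N n → Set ℓ
      K k (c , q) = OrderedBelow L (W q) at⟨ u ⟩ k c
      Ord : ∀ k → IsDef (𝐍 ⊗ (𝐍 ⊗ 𝐕 n)) (λ (x , y , q) → Ordered (λ x y → x ⊏[ q ] y) k x y)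
      Ord inc = D
      Ord dec = at₃ D (S v0) v0 (S (S idᶠ))
      Ord con = ¬ᵈ (Ord inc) ∧ᵈ ¬ᵈ (Ord dec)
      K-def : ∀ k → IsDef (𝐍 ⊗ 𝐕 n) (K k)
      K-def k = ∀ᵈ (∀ᵈ (<ᵈ′ (constᶠ u) (S v0) ⇒ᵈ <ᵈ′ (S v0) v0 ⇒ᵈ <ᵈ′ v0 (S (S v0)) ⇒ᵈ
                        at₃ (Ord k) (S v0) v0 (S (S (S idᶠ)))))
      P-def : ∀ k → IsDef (𝐕 n) (λ q → Ev at⟨ u ⟩ (λ c → K k (c , q)))
      P-def k = Evᵈ at⟨ u ⟩ (K-def k)
      finish : ∀ k (B′ : Box n) → B′ ⊑ B → (∀ q → q ∈ B′ → Ev at⟨ u ⟩ (λ c → K k (c , q))) →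
               ∃[ k ] Σ[ B′ ∈ Box n ] B′ ⊑ B ×
               Ev at⟨ u ⟩ (λ c → ∀ q → q ∈ B′ → OrderedBelow L (W q) at⟨ u ⟩ k c)
      finish k B′ s h with uniformly B′ at⟨ u ⟩ (K-def k) h
      ... | B″ , s′ , e = k , B″ , (λ q → s q ∘ s′ q) , e
      choose : ∃[ k ] Σ[ B′ ∈ Box n ] B′ ⊑ B ×
               Ev at⟨ u ⟩ (λ c → ∀ q → q ∈ B′ → OrderedBelow L (W q) at⟨ u ⟩ k c)
      choose with decideOn B (P-def inc)
      ... | B₁ , s₁ , inj₁ h = finish inc B₁ s₁ h
      ... | B₁ , s₁ , inj₂ n₁ with decideOn B₁ (P-def dec)
      ... | B₂ , s₂ , inj₁ h  = finish dec B₂ (λ q → s₁ q ∘ s₂ q) h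
      ... | B₂ , s₂ , inj₂ n₂ = finish con B₂ (λ q → s₁ q ∘ s₂ q) λ q i →
        third q i (eventually-ordered L (W q) at⟨ u ⟩)
        where
        third : ∀ q → q ∈ B₂ → ∃[ k ] Ev at⟨ u ⟩ (λ c → K k (c , q)) →
                Ev at⟨ u ⟩ (λ c → K con (c , q))
        third q i (inc , e) = ⊥-elim (n₁ q (s₂ q i) e)
        third q i (dec , e) = ⊥-elim (n₂ q i e)
        third q i (con , e) = e

  open Uniform

  uniform-zero : Uniform zero
  decideOn uniform-zero B {P} D with decide (P [])
  ... | inj₁ p  = B , (λ _ → id) , inj₁ λ { [] _ → p }
  ... | inj₂ ¬p = B , (λ _ → id) , inj₂ λ { [] _ → ¬p }
  uniformly uniform-zero B a D h with centre B
  ... | [] , i = B , (λ _ → id) , Ev-map (λ { w k [] _ → k }) (h [] i)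

  module _ {n} (U : Uniform n) where

    private
      -- The germ in the first coordinate at the lower side `u` satisfies `P` or its negation, for
      -- each `q`. In dimension `n` first this alternative and then the length of the germ are made
      -- independent of `q`.
      decideOn-suc : ∀ (B : Box (suc n)) {P} → IsDef (𝐕 (suc n)) P →
        Σ[ B′ ∈ Box (suc n) ] B′ ⊑ B × ((∀ q → q ∈ B′ → P q) ⊎ (∀ q → q ∈ B′ → ¬ P q))
      decideOn-suc (box {u ∷ lo} {v ∷ hi} (u<v ∷ b)) {P} D
        with decideOn U (box b) (Evᵈ at⟨ u ⟩ (at D consᶠ))
      ... | B₁ , s₁ , inj₁ h with uniformly U B₁ at⟨ u ⟩ (at D consᶠ) h
      ... | B₂ , s₂ , e with Ev-∧ e (Ev-< u<v)
      ... | ev c u<c k with Ev-∃ (Ev-< u<c)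
      ... | c′ , u<c′ , c′<c =
        u<c′ ⨯ B₂ , ⨯-⊑ u<c′ B₂ u<v b irrefl (asym (proj₂ (k c′ u<c′ c′<c))) (λ q → s₁ q ∘ s₂ q) ,
        inj₁ λ { (x ∷ q) (u<x ∷ i , x<c′ ∷ j) → proj₁ (k x u<x (<-trans x<c′ c′<c)) q (i , j) }
      decideOn-suc (box {u ∷ lo} {v ∷ hi} (u<v ∷ b)) {P} D
          | B₁ , s₁ , inj₂ h with uniformly U B₁ at⟨ u ⟩ (¬ᵈ (at D consᶠ)) neg
        where
        neg : ∀ q → q ∈ B₁ → Ev at⟨ u ⟩ (λ x → ¬ P (x ∷ q))
        neg q i with germ (at D (consᶠ ∘ᶠ (idᶠ ,ᶠ constᶠ q))) at⟨ u ⟩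
        ... | inj₁ e = ⊥-elim (h q i e)
        ... | inj₂ e = e
      ... | B₂ , s₂ , e with Ev-∧ e (Ev-< u<v)
      ... | ev c u<c k with Ev-∃ (Ev-< u<c)
      ... | c′ , u<c′ , c′<c =
        u<c′ ⨯ B₂ , ⨯-⊑ u<c′ B₂ u<v b irrefl (asym (proj₂ (k c′ u<c′ c′<c))) (λ q → s₁ q ∘ s₂ q) ,
        inj₂ λ { (x ∷ q) (u<x ∷ i , x<c′ ∷ j) → proj₁ (k x u<x (<-trans x<c′ c′<c)) q (i , j) }

      uniformly-suc : ∀ (B : Box (suc n)) a {K} → IsDef (𝐍 ⊗ 𝐕 (suc n)) K →
        (∀ q → q ∈ B → Ev a (λ w → K (w , q))) →
        Σ[ B′ ∈ Box (suc n) ] B′ ⊑ B × Ev a (λ w → ∀ q → q ∈ B′ → K (w , q))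
      uniformly-suc (box {u ∷ lo} {v ∷ hi} (u<v ∷ b)) a {K} D h =
        finish (uniformKind U (box b) u ⊏-def W)
        where
        M : N → N → Vec N n → Set ℓ
        M s w q = ∀ t → a ◁ t → t < w → K (t , s ∷ q)
        M-def : IsDef (𝐍 ⊗ (𝐍 ⊗ 𝐕 n)) (λ (s , w , q) → M s w q)
        M-def = ∀ᵈ (◁ᵈ a v0 ⇒ᵈ <ᵈ′ v0 (S (S v0)) ⇒ᵈ
                    at₂ D v0 (consᶠ ∘ᶠ (S v0 ,ᶠ S (S (S idᶠ)))))
        -- Compares the extents of K near a; their eventual monotonicity in the first
        -- variable is what makes them uniform.
        _⊏[_]_ : N → Vec N n → N → Set ℓ
        x ⊏[ q ] y = ∃[ w ] M y w q × ¬ M x w q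
        ⊏-def : IsDef (𝐍 ⊗ (𝐍 ⊗ 𝐕 n)) (λ (x , y , q) → x ⊏[ q ] y)
        ⊏-def = ∃ᵈ (at₃ M-def (S (S v0)) v0 (S (S (S idᶠ))) ∧ᵈ
                    ¬ᵈ (at₃ M-def (S v0) v0 (S (S (S idᶠ)))))
        M-down : ∀ {x w w′} q → ¬ w < w′ → M x w q → M x w′ q
        M-down q n m t p r = m t p (<-≤-trans r n)
        W : ∀ q → IsStrictWeak (λ x y → x ⊏[ q ] y)
        W q = record
          { ⊏-def     = at₃ ⊏-def fstᶠ sndᶠ (constᶠ q)
          ; ⊏-asym    = λ (w , m , n) (w′ , m′ , n′) → n (M-down q
              (λ r → n′ (M-down q (asym r) m)) m′)
          ; ⊏-cotrans = λ z (w , m , n) → case decide (M z w q) of λ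
              { (inj₁ p) → inj₁ (w , p , n) ; (inj₂ p) → inj₂ (w , m , p) }
          }
        finish : ∃[ k ] Σ[ B′ ∈ Box n ] B′ ⊑ box b ×
                 Ev at⟨ u ⟩ (λ c → ∀ q → q ∈ B′ → OrderedBelow L (W q) at⟨ u ⟩ k c) →
                 Σ[ B′ ∈ Box (suc n) ] B′ ⊑ box (u<v ∷ b) ×
                 Ev a (λ w → ∀ q → q ∈ B′ → K (w , q))
        finish (k , B₁ , s₁ , e) with Ev-∃ (Ev-∧ e (Ev-< u<v))
        ... | c , u<c , ord , c<v with dense u<c
        ... | s , u<s , s<c
          with uniformly U B₁ a (at₂ D v0 (consᶠ ∘ᶠ (constᶠ s ,ᶠ sndᶠ)))
                 (λ q i → h (s ∷ q) (u<s ∷ proj₁ (s₁ q i) , <-trans s<c c<v ∷ proj₂ (s₁ q i)))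
        -- On the slice at `s` the induction gives a common extent. The slices on one side of `s`
        -- have extents at least as large and inherit it; `k` tells on which side.
        ... | B₂ , s₂ , ev w a◁w K-s = choose k ord
          where
          transfer : ∀ x q → q ∈ B₂ → ¬ x ⊏[ q ] s → ∀ t → a ◁ t → t < w → K (t , x ∷ q)
          transfer x q i n = byContra λ m → n (w , (λ t p r → K-s t p r q i) , m)
          sub-B : ∀ q → q ∈ B₂ → q ∈ box b
          sub-B q = s₁ q ∘ s₂ q
          right : (∀ x q → q ∈ B₁ → s < x → x < c → ¬ x ⊏[ q ] s) →
                  Σ[ B′ ∈ Box (suc n) ] B′ ⊑ box (u<v ∷ b) ×
                  Ev a (λ w → ∀ q → q ∈ B′ → K (w , q))
          right ¬⊏ = s<c ⨯ B₂ , ⨯-⊑ s<c B₂ u<v b (asym u<s) (asym c<v) sub-B ,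
            ev w a◁w λ { t p r (x ∷ q) (s<x ∷ i , x<c ∷ j) →
              transfer x q (i , j) (¬⊏ x q (s₂ q (i , j)) s<x x<c) t p r }
          choose : ∀ k → (∀ q → q ∈ B₁ → OrderedBelow L (W q) at⟨ u ⟩ k c) →
                   Σ[ B′ ∈ Box (suc n) ] B′ ⊑ box (u<v ∷ b) ×
                   Ev a (λ w → ∀ q → q ∈ B′ → K (w , q))
          choose inc o = right λ x q i s<x x<c →
            IsStrictWeak.⊏-asym (W q) (o q i s x u<s s<x x<c)
          choose con o = right λ x q i s<x x<c → proj₂ (o q i s x u<s s<x x<c)
          choose dec o = u<s ⨯ B₂ , ⨯-⊑ u<s B₂ u<v b irrefl (asym (<-trans s<c c<v)) sub-B ,
            ev w a◁w λ { t p r (x ∷ q) (u<x ∷ i , x<s ∷ j) →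
              transfer x q (i , j) (IsStrictWeak.⊏-asym (W q)
                (o q (s₂ q (i , j)) x s u<x x<s s<c)) t p r }

    uniform-suc : Uniform (suc n)
    decideOn  uniform-suc = decideOn-suc
    uniformly uniform-suc = uniformly-suc

  abstract
    uniform : ∀ n → Uniform n
    uniform zero    = uniform-zero
    uniform (suc n) = uniform-suc (uniform n)

  -- Generic continuity in several variables.

  slice : ∀ {n f} → DefFun (𝐕 (suc n)) 𝐍 f → ∀ q → DefFun 𝐍 𝐍 (λ x → f (x ∷ q))
  slice F q = F ∘ᶠ consᶠ ∘ᶠ (idᶠ ,ᶠ constᶠ q)

  coslice : ∀ {n A f} → DefFun (𝐕 (suc n)) A f → ∀ x → DefFun (𝐕 n) A (λ q → f (x ∷ q))
  coslice F x = F ∘ᶠ consᶠ ∘ᶠ (constᶠ x ,ᶠ idᶠ)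

  Neighbourhood : ∀ {n} → Vec N n → Pred (Vec N n) ℓ → Set ℓ
  Neighbourhood p P = ∃[ lo ] ∃[ hi ] In lo hi p × (∀ q → In lo hi q → P q)

  Neighbourhood-∩ : ∀ {n} {p : Vec N n} {P Q} → Neighbourhood p P → Neighbourhood p Q →
                    Neighbourhood p (λ q → P q × Q q)
  Neighbourhood-∩ (_ , _ , i , h) (_ , _ , j , k) with In-∩ i j
  ... | l , r , m , s = l , r , m , λ q t → h q (proj₁ (s q t)) , k q (proj₂ (s q t))

  Continuousᵛ : ∀ {n} → (Vec N n → N) → Pred (Vec N n) ℓ
  Continuousᵛ f p = ∀ y z → y < f p → f p < z → Neighbourhood p (λ q → y < f q × f q < z)

  SliceContinuous : ∀ {n} → (Vec N (suc n) → N) → Pred (Vec N (suc n)) ℓ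
  SliceContinuous f p = Continuousᵛ (λ q → f (Vec.head p ∷ q)) (Vec.tail p)

  SliceContinuous-def : ∀ {n f} → DefFun (𝐕 (suc n)) 𝐍 f → IsDef (𝐕 (suc n)) (SliceContinuous f)
  SliceContinuous-def {n} {f} F = ∀ᵈ (∀ᵈ (
      <ᵈ′ (S v0) (val (S (S idᶠ)) (tailᶠ ∘ᶠ S (S idᶠ))) ⇒ᵈ
      <ᵈ′ (val (S (S idᶠ)) (tailᶠ ∘ᶠ S (S idᶠ))) v0 ⇒ᵈ
      ∃ᵈ (∃ᵈ (Inᵈ (S v0) v0 (tailᶠ ∘ᶠ S (S (S (S idᶠ)))) ∧ᵈ
        ∀ᵈ (Inᵈ (S (S v0)) (S v0) v0 ⇒ᵈ
          <ᵈ′ (S (S (S (S v0)))) (val (S (S (S (S (S idᶠ))))) v0) ∧ᵈ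
          <ᵈ′ (val (S (S (S (S (S idᶠ))))) v0) (S (S (S v0))))))))
    where
    val : ∀ {Γ g h} → DefFun Γ (𝐕 (suc n)) g → DefFun Γ (𝐕 n) h →
          DefFun Γ 𝐍 (λ γ → f (Vec.head (g γ) ∷ h γ))
    val G H = F ∘ᶠ consᶠ ∘ᶠ (headᶠ ∘ᶠ G ,ᶠ H)

  between-ordered : ∀ {f} {F : DefFun 𝐍 𝐍 f} k {x t y l h} →
    Ordered (λ x y → f x < f y) k x t → Ordered (λ x y → f x < f y) k t y →
    l < f x → f x < h → l < f y → f y < h → l < f t × f t < h
  between-ordered inc p q l<x _ _ y<h = <-trans l<x p , <-trans q y<h
  between-ordered dec p q _ x<h l<y _ = <-trans l<y q , <-trans p x<h
  between-ordered {f} con {x} {t} (n , m) _ l<x x<h _ _ with cmp (f x) (f t)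
  ... | inj₁ r        = ⊥-elim (n r)
  ... | inj₂ (inj₁ e) = subst (_ <_) e l<x , subst (_< _) e x<h
  ... | inj₂ (inj₂ r) = ⊥-elim (m r)

  -- Continuity is recorded separately in the first variable and in the others; monotonicity in the
  -- first variable, of one kind for all slices, makes it joint continuity.
  record Tame {n f} (F : DefFun (𝐕 (suc n)) 𝐍 f) (B : Box (suc n)) : Set ℓ where
    field
      {u} {v}  : N
      u<v      : u < v
      base     : Box n
      inside   : (u<v ⨯ base) ⊑ B
      kind     : Kind
      ordered  : ∀ q → q ∈ base → OrderedBelow L (valueOrder L (slice F q)) at⟨ u ⟩ kind v
      contˢ    : ∀ q → q ∈ base → ∀ x → u < x → x < v → ContAt _<_ (λ x → f (x ∷ q)) x
      contᵛ    : ∀ q → q ∈ base → ∀ x → u < x → x < v → Continuousᵛ (λ q → f (x ∷ q)) q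

  GenericContinuity : ℕ → Set (lsuc ℓ)
  GenericContinuity n = ∀ {f} (F : DefFun (𝐕 n) 𝐍 f) (B : Box n) →
                        Σ[ B′ ∈ Box n ] B′ ⊑ B × (∀ p → p ∈ B′ → Continuousᵛ f p)

  -- On a smaller box the property holds at every point or at none. The latter is refuted on a
  -- single slice by the case of dimension `n`.
  slices-continuous : ∀ {n} → GenericContinuity n → ∀ {f} (F : DefFun (𝐕 (suc n)) 𝐍 f) B →
                      Σ[ B′ ∈ Box (suc n) ] B′ ⊑ B × (∀ p → p ∈ B′ → SliceContinuous f p)
  slices-continuous {n} C {f} F B = choose (decideOn (uniform (suc n)) B (SliceContinuous-def F))
    where
    nowhere : ∀ (B′ : Box (suc n)) → ¬ (∀ p → p ∈ B′ → ¬ SliceContinuous f p)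
    nowhere (box (u<v ∷ b)) h with dense u<v
    ... | x , u<x , x<v with C (coslice F x) (box b)
    ... | B₂ , s₂ , k with centre B₂
    ... | q , i = h (x ∷ q) (u<x ∷ proj₁ (s₂ q i) , x<v ∷ proj₂ (s₂ q i)) (k q i)
    choose : (Σ[ B′ ∈ Box (suc n) ] B′ ⊑ B ×
               ((∀ p → p ∈ B′ → SliceContinuous f p) ⊎ (∀ p → p ∈ B′ → ¬ SliceContinuous f p))) →
             Σ[ B′ ∈ Box (suc n) ] B′ ⊑ B × (∀ p → p ∈ B′ → SliceContinuous f p)
    choose (B′ , s , inj₁ h) = B′ , s , h
    choose (B′ , s , inj₂ h) = ⊥-elim (nowhere B′ h)

  ContAtᵈ : ∀ {n f} → DefFun (𝐕 (suc n)) 𝐍 f →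
            IsDef (𝐍 ⊗ 𝐕 n) (λ (x , q) → ContAt _<_ (λ x → f (x ∷ q)) x)
  ContAtᵈ {n} {f} F = ∀ᵈ (∀ᵈ (
      <ᵈ′ (S v0) (val (S (S fstᶠ)) (S (S sndᶠ))) ⇒ᵈ
      <ᵈ′ (val (S (S fstᶠ)) (S (S sndᶠ))) v0 ⇒ᵈ
      Ev-atᵈ (S (S fstᶠ)) (<ᵈ′ (S (S v0)) (val v0 (S (S (S sndᶠ)))) ∧ᵈ
                           <ᵈ′ (val v0 (S (S (S sndᶠ)))) (S v0)) ∧ᵈ
      (<ᵈ′ (S v0) (val (S (S fstᶠ)) (S (S sndᶠ))) ∧ᵈ
       <ᵈ′ (val (S (S fstᶠ)) (S (S sndᶠ))) v0) ∧ᵈ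
      ᵒ.Ev-atᵈ (S (S fstᶠ)) (<ᵈ′ (S (S v0)) (val v0 (S (S (S sndᶠ)))) ∧ᵈ
                             <ᵈ′ (val v0 (S (S (S sndᶠ)))) (S v0))))
    where
    val : ∀ {Γ g h} → DefFun Γ 𝐍 g → DefFun Γ (𝐕 n) h → DefFun Γ 𝐍 (λ γ → f (g γ ∷ h γ))
    val G H = F ∘ᶠ consᶠ ∘ᶠ (G ,ᶠ H)

  tame : ∀ {n} → GenericContinuity n → ∀ {f} (F : DefFun (𝐕 (suc n)) 𝐍 f) B → Tame F B
  tame {n} C {f} F B = step₁ (slices-continuous C F B)
    where
    W : ∀ q → IsStrictWeak (λ x y → f (x ∷ q) < f (y ∷ q))
    W q = valueOrder L (slice F q)

    step₃ : ∀ {u v} {lo hi : Vec N n} (u<v : u < v) (b : Pointwise _<_ lo hi) → box (u<v ∷ b) ⊑ B →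
            (∀ p → p ∈ box (u<v ∷ b) → SliceContinuous f p) →
            ∀ k B₂ → B₂ ⊑ box b →
            Ev at⟨ u ⟩ (λ c → ∀ q → q ∈ B₂ → OrderedBelow L (W q) at⟨ u ⟩ k c) →
            Σ[ B₃ ∈ Box n ] B₃ ⊑ B₂ ×
              Ev at⟨ u ⟩ (λ x → ∀ q → q ∈ B₃ → ContAt _<_ (λ x → f (x ∷ q)) x) →
            Tame F B
    step₃ u<v b s₁ h k B₂ s₂ e₂ (B₃ , s₃ , ev c u<c k₃)
      with Ev-∃ (Ev-∧ e₂ (Ev-∧ (Ev-< u<v) (Ev-< u<c)))
    ... | d , u<d , ord , d<v , d<c = record
      { u<v     = u<d
      ; base    = B₃
      ; inside  = λ p i → s₁ p (⨯-⊑ u<d B₃ u<v b irrefl (asym d<v) (λ q → s₂ q ∘ s₃ q) p i)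
      ; kind    = k
      ; ordered = λ q i → ord q (s₃ q i)
      ; contˢ   = λ q i x u<x x<d → k₃ x u<x (<-trans x<d d<c) q i
      ; contᵛ   = λ q i x u<x x<d → let i′ = s₂ q (s₃ q i) in
                  h (x ∷ q) (u<x ∷ proj₁ i′ , <-trans x<d d<v ∷ proj₂ i′)
      }

    step₂ : ∀ {u v} {lo hi : Vec N n} (u<v : u < v) (b : Pointwise _<_ lo hi) → box (u<v ∷ b) ⊑ B →
            (∀ p → p ∈ box (u<v ∷ b) → SliceContinuous f p) →
            ∃[ k ] Σ[ B₂ ∈ Box n ] B₂ ⊑ box b ×
              Ev at⟨ u ⟩ (λ c → ∀ q → q ∈ B₂ → OrderedBelow L (W q) at⟨ u ⟩ k c) →
            Tame F B
    step₂ {u} u<v b s₁ h (k , B₂ , s₂ , e₂) = step₃ u<v b s₁ h k B₂ s₂ e₂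
      (uniformly (uniform n) B₂ at⟨ u ⟩ (ContAtᵈ F)
        (λ q i → Ev-map (λ _ → proj₂) (proj₂ (monotonicity L (slice F q) at⟨ u ⟩))))

    step₁ : Σ[ B′ ∈ Box (suc n) ] B′ ⊑ B × (∀ p → p ∈ B′ → SliceContinuous f p) → Tame F B
    step₁ (box {u ∷ _} (u<v ∷ b) , s₁ , h) = step₂ u<v b s₁ h
      (uniformKind (uniform n) (box b) u
        (<ᵈ′ (F ∘ᶠ consᶠ ∘ᶠ (v0 ,ᶠ S sndᶠ)) (F ∘ᶠ consᶠ ∘ᶠ (S v0 ,ᶠ S sndᶠ))) W)

  module _ {n f} {F : DefFun (𝐕 (suc n)) 𝐍 f} {B} (T : Tame F B) where
    open Tame T

    -- For `q′` near `q` the values at the two abscissae `l` and `h` stay within the prescribed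
    -- range; by monotonicity so do the values in between.
    tame-continuous : ∀ x q → u < x → x < v → q ∈ base → Continuousᵛ f (x ∷ q)
    tame-continuous x q u<x x<v i y z p r with contˢ q i x u<x x<v y z p r
    ... | right , _ , left with Ev-∃ (Ev-∧ right (Ev-< x<v)) | ᵒ.Ev-∃ (ᵒ.Ev-∧ left (ᵒ.Ev-< u<x))
    ... | h , x<h , (y<h , h<z) , h<v | l , l<x , (y<l , l<z) , u<l =
      extend (Neighbourhood-∩ (Neighbourhood-∩ (contᵛ q i h (<-trans u<x x<h) h<v y z y<h h<z)
                                               (contᵛ q i l u<l (<-trans l<x x<v) y z y<l l<z))
                              (lo base , hi base , i , λ _ → id))
      where
      extend : Neighbourhood q (λ q′ → ((y < f (h ∷ q′) × f (h ∷ q′) < z) ×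
                                        (y < f (l ∷ q′) × f (l ∷ q′) < z)) × q′ ∈ base) →
               Neighbourhood (x ∷ q) (λ p → y < f p × f p < z)
      extend (lo′ , hi′ , (a , b) , k) = l ∷ lo′ , h ∷ hi′ , (l<x ∷ a , x<h ∷ b) , within
        where
        within : ∀ p → In (l ∷ lo′) (h ∷ hi′) p → y < f p × f p < z
        within (t ∷ q′) (l<t ∷ a′ , t<h ∷ b′) with k q′ (a′ , b′)
        ... | ((y<h′ , h<z′) , (y<l′ , l<z′)) , i′ =
          between-ordered {F = slice F q′} kind
            (ordered q′ i′ l t u<l l<t (<-trans t<h h<v))
            (ordered q′ i′ t h (<-trans u<l l<t) t<h h<v) y<l′ l<z′ y<h′ h<z′

  abstract
    generic-continuity : ∀ n → GenericContinuity n
    generic-continuity zero F B = B , (λ _ → id) , λ { [] _ y z p q →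
      [] , [] , ([] , []) , λ { [] _ → p , q } }
    generic-continuity (suc n) F B = u<v ⨯ base , inside , λ { (x ∷ q) (u<x ∷ i , x<v ∷ j) →
      tame-continuous T x q u<x x<v (i , j) }
      where
      T : Tame F B
      T = tame (generic-continuity n) F B
      open Tame T

  -- Level sets and invariance of dimension.

  InjectiveOn : ∀ {n} {A : Set ℓ} → Box n → (Vec N n → A) → (A → A → Set ℓ) → Set ℓ
  InjectiveOn B f _≈_ = ∀ p q → p ∈ B → q ∈ B → f p ≈ f q → p ≡ q

  -- Expresses that some level set of `f` in `B` has dimension at least `k`: a box of that dimension
  -- is injected into it.
  record LevelBox {k} (f : Vec N (suc k) → N) (B : Box (suc k)) : Set (lsuc ℓ) where
    field
      {ι}    : Vec N k → Vec N (suc k)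
      ι-def  : DefFun (𝐕 k) (𝐕 (suc k)) ι
      source : Box k
      into   : ∀ q → q ∈ source → ι q ∈ B
      inj    : InjectiveOn source ι _≡_
      level  : N
      ι-level : ∀ q → q ∈ source → f (ι q) ≡ level

  con⇒≡ : ∀ {f : N → N} {x y} → Ordered (λ x y → f x < f y) con x y → f x ≡ f y
  con⇒≡ {f} {x} {y} (n , m) with cmp (f x) (f y)
  ... | inj₁ r        = ⊥-elim (n r)
  ... | inj₂ (inj₁ e) = e
  ... | inj₂ (inj₂ r) = ⊥-elim (m r)

  -- By the intermediate value theorem a level set is a graph over a box, if f is
  -- strictly monotone in its first variable.
  module _ {k f} {F : DefFun (𝐕 (suc (suc k))) 𝐍 f} {B} (T : Tame F B)
           {q₀} (i₀ : q₀ ∈ Tame.base T) {x₁ x₀ x₂} (u<x₁ : Tame.u T < x₁) (x₁<x₀ : x₁ < x₀)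
           (x₀<x₂ : x₀ < x₂) (x₂<v : x₂ < Tame.v T)
           (slab : LevelBox (λ q → f (x₀ ∷ q)) (Tame.base T)) where
    open Tame T

    private
      u<x₀ : u < x₀
      u<x₀ = <-trans u<x₁ x₁<x₀
      x₀<v : x₀ < v
      x₀<v = <-trans x₀<x₂ x₂<v
      w : N
      w = f (x₀ ∷ q₀)
      Crossing : Vec N (suc k) → N → Set ℓ
      Crossing q x = x₁ < x × x < x₂ × f (x ∷ q) ≡ w

      fromCrossings : (∀ x → x₁ < x → x < x₂ → ∀ y → x₁ < y → y < x₂ → ∀ q → q ∈ base →
                         f (x ∷ q) ≡ f (y ∷ q) → x ≡ y) →
                      Neighbourhood q₀ (λ q → q ∈ base × ∃ (Crossing q)) → LevelBox f B
      fromCrossings unique (lo , hi , i , h) = record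
        { ι-def = consᶠ ∘ᶠ (root-def ,ᶠ idᶠ)
        ; source = β
        ; into = λ q j → let i , _ = h q (β⊂ q j)
                             a , b , _ = root-crossing q (β⊂ q j)
                         in inside (root q ∷ q) (<-trans u<x₁ a ∷ proj₁ i , <-trans b x₂<v ∷ proj₂ i)
        ; inj = λ p q _ _ → cong Vec.tail
        ; level = w
        ; ι-level = λ q j → proj₂ (proj₂ (root-crossing q (β⊂ q j)))
        }
        where
        β = proj₁ (∈-box i)
        β⊂ = proj₂ (proj₂ (∈-box i))
        pick : ∀ q → In lo hi q ⊎ ¬ In lo hi q → N
        pick q (inj₁ j) = proj₁ (proj₂ (h q j))
        -- A default value off the neighbourhood, recorded in `R`, makes `root` a total definable
        -- map.
        pick q (inj₂ _) = x₁
        root : Vec N (suc k) → N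
        root q = pick q (decide (In lo hi q))
        R : Vec N (suc k) × N → Set ℓ
        R (q , x) = (In lo hi q × Crossing q x) ⊎ ((¬ In lo hi q) × Eq 𝐍 x x₁)
        R-def : IsDef (𝐕 (suc k) ⊗ 𝐍) R
        R-def = (in-def ∧ᵈ <ᵈ′ (constᶠ x₁) sndᶠ ∧ᵈ <ᵈ′ sndᶠ (constᶠ x₂) ∧ᵈ
                 mapDef (λ _ → mk⇔ (cong Vec.head) (cong (_∷ [])))
                        (at₂ (Eqᵈ 𝐍) (F ∘ᶠ consᶠ ∘ᶠ (sndᶠ ,ᶠ fstᶠ)) (constᶠ w))) ∨ᵈ
                (¬ᵈ in-def ∧ᵈ at₂ (Eqᵈ 𝐍) sndᶠ (constᶠ x₁))
          where
          in-def : IsDef (𝐕 (suc k) ⊗ 𝐍) (λ (q , x) → In lo hi q)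
          in-def = Inᵈ (constᶠ lo) (constᶠ hi) fstᶠ
        R-pick : ∀ q d → R (q , pick q d)
        R-pick q (inj₁ j) = inj₁ (j , proj₂ (proj₂ (h q j)))
        R-pick q (inj₂ n) = inj₂ (n , refl)
        R-unique : ∀ q x y → R (q , x) → R (q , y) → Eq 𝐍 x y
        R-unique q x y (inj₁ (j , a , b , e)) (inj₁ (_ , a′ , b′ , e′)) =
          cong (_∷ []) (unique x a b y a′ b′ q (proj₁ (h q j)) (trans e (sym e′)))
        R-unique q x y (inj₁ (j , _)) (inj₂ (n , _)) = ⊥-elim (n j)
        R-unique q x y (inj₂ (n , _)) (inj₁ (j , _)) = ⊥-elim (n j)
        R-unique q x y (inj₂ (_ , e)) (inj₂ (_ , e′)) = trans e (sym e′)
        root-def : DefFun (𝐕 (suc k)) 𝐍 root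
        root-def = describe R-def (λ q → R-pick q (decide _))
                     (λ q x r → R-unique q x (root q) r (R-pick q (decide _)))
        root-crossing : ∀ q → In lo hi q → Crossing q (root q)
        root-crossing q j with R-pick q (decide (In lo hi q))
        ... | inj₁ (_ , c) = c
        ... | inj₂ (n , _) = ⊥-elim (n j)

      near : ∀ x → u < x → x < v → ∀ {y z} → y < f (x ∷ q₀) → f (x ∷ q₀) < z →
             Neighbourhood q₀ (λ q → (y < f (x ∷ q) × f (x ∷ q) < z) × q ∈ base)
      near x a b p r = Neighbourhood-∩ (contᵛ q₀ i₀ x a b _ _ p r) (lo base , hi base , i₀ , λ _ → id)

      x₁<v : x₁ < v
      x₁<v = <-trans x₁<x₀ x₀<v

      u<x₂ : u < x₂
      u<x₂ = <-trans u<x₀ x₀<x₂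

      strict-unique : ∀ κ → κ ≢ con →
        (∀ q → q ∈ base → OrderedBelow L (valueOrder L (slice F q)) at⟨ u ⟩ κ v) →
        ∀ x → x₁ < x → x < x₂ → ∀ y → x₁ < y → y < x₂ → ∀ q → q ∈ base →
        f (x ∷ q) ≡ f (y ∷ q) → x ≡ y
      strict-unique κ κ≢con o x a b y a′ b′ q i e with cmp x y
      ... | inj₂ (inj₁ x≡y) = x≡y
      ... | inj₁ x<y = ⊥-elim (con-excludes (valueOrder L (slice F q)) κ κ≢con {x} {y}
              (irrefl ∘ subst (_< f (y ∷ q)) e , irrefl ∘ subst (f (y ∷ q) <_) e)
              (o q i x y (<-trans u<x₁ a) x<y (<-trans b′ x₂<v)))
      ... | inj₂ (inj₂ y<x) = ⊥-elim (con-excludes (valueOrder L (slice F q)) κ κ≢con {y} {x}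
              (irrefl ∘ subst (f (y ∷ q) <_) e , irrefl ∘ subst (_< f (y ∷ q)) e)
              (o q i y x (<-trans u<x₁ a′) y<x (<-trans b x₂<v)))

      -- The intermediate value theorem on the slice over `q`: by continuity the conditions of lying
      -- below and above `w` are open, so `between` yields a point where neither holds.
      crossing : ∀ q → q ∈ base →
        (f (x₁ ∷ q) < w × w < f (x₂ ∷ q)) ⊎ (w < f (x₁ ∷ q) × f (x₂ ∷ q) < w) → ∃ (Crossing q)
      crossing q i signs = go signs
        where
        lower upper : Pred N ℓ
        lower x = f (x ∷ q) < w
        upper x = w < f (x ∷ q)
        cont : ∀ x → ¬ x < x₁ → ¬ x₂ < x → ContAt _<_ (λ x → f (x ∷ q)) x
        cont x p r = contˢ q i x (<-≤-trans u<x₁ p) (≤-<-trans r x₂<v)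
        lowerNear : ∀ x → lower x → ¬ x < x₁ → ¬ x₂ < x → Near x lower
        lowerNear x p a b with below (f (x ∷ q))
        ... | y , y<f with cont x a b y w y<f p
        ... | r , m , l = Ev-map (λ _ → proj₂) r , proj₂ m , ᵒ.Ev-map (λ _ → proj₂) l
        upperNear : ∀ x → upper x → ¬ x < x₁ → ¬ x₂ < x → Near x upper
        upperNear x p a b with above (f (x ∷ q))
        ... | z , f<z with cont x a b w z p f<z
        ... | r , m , l = Ev-map (λ _ → proj₁) r , proj₁ m , ᵒ.Ev-map (λ _ → proj₁) l
        x₁<x₂ : x₁ < x₂
        x₁<x₂ = <-trans x₁<x₀ x₀<x₂
        equal : ∀ {x} → ¬ lower x → ¬ upper x → f (x ∷ q) ≡ w
        equal {x} n m with cmp (f (x ∷ q)) w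
        ... | inj₁ r        = ⊥-elim (n r)
        ... | inj₂ (inj₁ e) = e
        ... | inj₂ (inj₂ r) = ⊥-elim (m r)
        go : _ → ∃ (Crossing q)
        go (inj₁ (p , r)) with between (<ᵈ′ (slice F q) (constᶠ w)) (λ _ → asym) x₁<x₂ p r
          (λ x P a b → proj₁ (lowerNear x P a (asym b)))
          (λ x Q a b → proj₂ (proj₂ (upperNear x Q (asym a) b)))
        ... | x , a , b , n , m = x , a , b , equal n m
        go (inj₂ (p , r)) with between (<ᵈ′ (constᶠ w) (slice F q)) (λ _ → asym) x₁<x₂ p r
          (λ x P a b → proj₁ (upperNear x P a (asym b)))
          (λ x Q a b → proj₂ (proj₂ (lowerNear x Q (asym a) b)))
        ... | x , a , b , n , m = x , a , b , equal m n

    levelBox-byKind : ∀ κ → (∀ q → q ∈ base → OrderedBelow L (valueOrder L (slice F q)) at⟨ u ⟩ κ v) →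
             LevelBox f B
    -- Here `f` does not depend on the first variable within the box, so the level box of the slice
    -- at `x₀` is multiplied by an interval.
    levelBox-byKind con o = record
      { ι-def = consᶠ ∘ᶠ (headᶠ ,ᶠ LevelBox.ι-def slab ∘ᶠ tailᶠ)
      ; source = u<v ⨯ LevelBox.source slab
      ; into = λ { (x ∷ q) (u<x ∷ a , x<v ∷ b) → let c , d = LevelBox.into slab q (a , b) in
                   inside _ (u<x ∷ c , x<v ∷ d) }
      ; inj = λ { (x ∷ p) (y ∷ q) (_ ∷ a , _ ∷ b) (_ ∷ a′ , _ ∷ b′) e →
                  cong₂ _∷_ (cong Vec.head e) (LevelBox.inj slab p q (a , b) (a′ , b′) (cong Vec.tail e)) }
      ; level = LevelBox.level slab
      ; ι-level = λ { (x ∷ q) (u<x ∷ a , x<v ∷ b) →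
          trans (flat x u<x x<v _ (LevelBox.into slab q (a , b))) (LevelBox.ι-level slab q (a , b)) }
      }
      where
      flat : ∀ x → u < x → x < v → ∀ q → q ∈ base → f (x ∷ q) ≡ f (x₀ ∷ q)
      flat x u<x x<v q i with cmp x x₀
      ... | inj₁ r           = con⇒≡ {λ x → f (x ∷ q)} (o q i x x₀ u<x r x₀<v)
      ... | inj₂ (inj₁ refl) = refl
      ... | inj₂ (inj₂ r)    = sym (con⇒≡ {λ x → f (x ∷ q)} (o q i x₀ x u<x₀ r x<v))
    -- Over `q₀` the values at `x₁` and `x₂` lie strictly on opposite sides of `w`, and this
    -- persists for nearby `q`. The outer bounds `y` and `z` are arbitrary; continuity is stated
    -- with bounds on both sides.
    levelBox-byKind inc o with below (f (x₁ ∷ q₀)) | above (f (x₂ ∷ q₀))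
    ... | y , y< | z , <z = fromCrossings (strict-unique inc (λ ()) o) (ascending
             (Neighbourhood-∩ (near x₁ u<x₁ x₁<v y< (o q₀ i₀ x₁ x₀ u<x₁ x₁<x₀ x₀<v))
                              (near x₂ u<x₂ x₂<v (o q₀ i₀ x₀ x₂ u<x₀ x₀<x₂ x₂<v) <z)))
      where
      ascending : Neighbourhood q₀ (λ q → ((y < f (x₁ ∷ q) × f (x₁ ∷ q) < w) × q ∈ base) ×
                                          ((w < f (x₂ ∷ q) × f (x₂ ∷ q) < z) × q ∈ base)) →
                  Neighbourhood q₀ (λ q → q ∈ base × ∃ (Crossing q))
      ascending (lo , hi , i , h) = lo , hi , i , λ q j → case h q j of λ
        { (((_ , p) , b) , ((r , _) , _)) → b , crossing q b (inj₁ (p , r)) }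
    levelBox-byKind dec o with above (f (x₁ ∷ q₀)) | below (f (x₂ ∷ q₀))
    ... | z , <z | y , y< = fromCrossings (strict-unique dec (λ ()) o) (descending
             (Neighbourhood-∩ (near x₁ u<x₁ x₁<v (o q₀ i₀ x₁ x₀ u<x₁ x₁<x₀ x₀<v) <z)
                              (near x₂ u<x₂ x₂<v y< (o q₀ i₀ x₀ x₂ u<x₀ x₀<x₂ x₂<v))))
      where
      descending : Neighbourhood q₀ (λ q → ((w < f (x₁ ∷ q) × f (x₁ ∷ q) < z) × q ∈ base) ×
                                           ((y < f (x₂ ∷ q) × f (x₂ ∷ q) < w) × q ∈ base)) →
                   Neighbourhood q₀ (λ q → q ∈ base × ∃ (Crossing q))
      descending (lo , hi , i , h) = lo , hi , i , λ q j → case h q j of λ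
        { (((p , _) , b) , ((_ , r) , _)) → b , crossing q b (inj₂ (p , r)) }

  levelBox : ∀ k {f} (F : DefFun (𝐕 (suc k)) 𝐍 f) B → LevelBox f B
  levelBox zero {f} F B with centre B
  ... | p , i = record
    { ι-def = constᶠ p ; source = box [] ; into = λ _ _ → i
    ; inj = λ { [] [] _ _ _ → refl } ; level = f p ; ι-level = λ _ _ → refl }
  levelBox (suc k) {f} F B = fromTame (tame (generic-continuity (suc k)) F B)
    where
    fromTame : Tame F B → LevelBox f B
    fromTame T with dense (Tame.u<v T)
    ... | x₀ , u<x₀ , x₀<v with dense u<x₀ | dense x₀<v
    ... | x₁ , u<x₁ , x₁<x₀ | x₂ , x₀<x₂ , x₂<v =
      levelBox-byKind T (proj₂ (centre (Tame.base T))) u<x₁ x₁<x₀ x₀<x₂ x₂<v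
        (levelBox k (coslice F x₀) (Tame.base T)) (Tame.kind T) (Tame.ordered T)

  -- On a level box of the first coordinate of `f` the remaining coordinates are still injective,
  -- which lowers both dimensions by one. In the end two points of an interval would have the same
  -- empty tuple as value.
  no-injection : ∀ m {f} → DefFun (𝐕 (suc m)) (𝐕 m) f → (B : Box (suc m)) → ¬ InjectiveOn B f _≡_
  no-injection zero F (box (u<v ∷ [])) inj with dense u<v
  ... | x , u<x , x<v with dense u<x
  ... | y , u<y , y<x with inj (x ∷ []) (y ∷ []) (u<x ∷ [] , x<v ∷ [])
                             (u<y ∷ [] , <-trans y<x x<v ∷ []) (empty _ _)
    where
    empty : ∀ (p q : Vec N zero) → p ≡ q
    empty [] [] = refl
  ... | refl = irrefl y<x
  no-injection (suc m) {f} F B inj = no-injection m (tailᶠ ∘ᶠ F ∘ᶠ ι-def) source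
    λ p q i j e → LevelBox.inj l p q i j (inj _ _ (into p i) (into q j)
      (head-tail (trans (ι-level p i) (sym (ι-level q j))) e))
    where
    l : LevelBox (Vec.head ∘ f) B
    l = levelBox (suc m) (headᶠ ∘ᶠ F) B
    open LevelBox l hiding (inj)
    head-tail : ∀ {x y : Vec N (suc m)} → Vec.head x ≡ Vec.head y → Vec.tail x ≡ Vec.tail y → x ≡ y
    head-tail {_ ∷ _} {_ ∷ _} refl refl = refl

-- The order of an o-minimal structure as a line.

module OrderLine (em : ∀ {a} → ExcludedMiddle a) {ℓ} (𝒩 : OrderedStructure ℓ)
                 (om : IsOMinimal 𝒩) where

  open Definability 𝒩
  open Lines em 𝒩
  open OrderedStructure 𝒩 renaming (Carrier to N)
  open IsOMinimal om
  open ExtremaStrict _<_ using (_<±_; [<]-injective)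

  extend : Bound → N ±
  extend ∞       = ⊥±
  extend at⟨ x ⟩ = ⟨ x ⟩

  toExtended : ∀ a {x} → Beyond _<_ a x → extend a <± ⟨ x ⟩
  toExtended ∞       _ = ⊥±<[ _ ]
  toExtended at⟨ _ ⟩ p = [ p ]

  fromExtended : ∀ a {x} → extend a <± ⟨ x ⟩ → Beyond _<_ a x
  fromExtended ∞       _ = ⊤ₚ.tt
  fromExtended at⟨ _ ⟩ p = [<]-injective p

  private
    toSegments : Piece 𝒩 → List Segment
    toSegments (point x)              = inj₁ x ∷ []
    toSegments (interval ⊤± _)        = []
    toSegments (interval _ ⊥±)        = []
    toSegments (interval ⊥± ⊤±)       = inj₂ (∞ , ∞) ∷ []
    toSegments (interval ⊥± ⟨ y ⟩)    = inj₂ (∞ , at⟨ y ⟩) ∷ []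
    toSegments (interval ⟨ x ⟩ ⊤±)    = inj₂ (at⟨ x ⟩ , ∞) ∷ []
    toSegments (interval ⟨ x ⟩ ⟨ y ⟩) = inj₂ (at⟨ x ⟩ , at⟨ y ⟩) ∷ []

    piece⇒ : ∀ t p → _∈ᴾ_ 𝒩 t p → Any (InSegment _<_ t) (toSegments p)
    piece⇒ t (point x)              e                = here e
    piece⇒ t (interval ⊤± _)        (() , _)
    piece⇒ t (interval ⊥± ⊥±)       (_ , SupremumStrict.[ () ])
    piece⇒ t (interval ⟨ _ ⟩ ⊥±)    (_ , SupremumStrict.[ () ])
    piece⇒ t (interval ⊥± ⊤±)       _                = here (_ , _)
    piece⇒ t (interval ⊥± ⟨ y ⟩)    (_ , p)          = here (_ , [<]-injective p)
    piece⇒ t (interval ⟨ x ⟩ ⊤±)    (p , _)          = here ([<]-injective p , _)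
    piece⇒ t (interval ⟨ x ⟩ ⟨ y ⟩) (p , q)          = here ([<]-injective p , [<]-injective q)

    ⇒piece : ∀ t p → Any (InSegment _<_ t) (toSegments p) → _∈ᴾ_ 𝒩 t p
    ⇒piece t (point x)              (here e)       = e
    ⇒piece t (interval ⊥± ⊤±)       _              = ⊥±<[ t ] , [ t ]<⊤±
    ⇒piece t (interval ⊥± ⟨ y ⟩)    (here (_ , p)) = ⊥±<[ t ] , [ p ]
    ⇒piece t (interval ⟨ x ⟩ ⊤±)    (here (p , _)) = [ p ] , [ t ]<⊤±
    ⇒piece t (interval ⟨ x ⟩ ⟨ y ⟩) (here (p , q)) = [ p ] , [ q ]

    pieces⇒ : ∀ t ps → Any (λ p → _∈ᴾ_ 𝒩 t p) ps → Any (InSegment _<_ t) (List.concatMap toSegments ps)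
    pieces⇒ t (p ∷ ps) (here q)  = Any.++⁺ˡ (piece⇒ t p q)
    pieces⇒ t (p ∷ ps) (there q) = Any.++⁺ʳ (toSegments p) (pieces⇒ t ps q)

    ⇒pieces : ∀ t ps → Any (InSegment _<_ t) (List.concatMap toSegments ps) → Any (λ p → _∈ᴾ_ 𝒩 t p) ps
    ⇒pieces t (p ∷ ps) q with Any.++⁻ (toSegments p) q
    ... | inj₁ r = here (⇒piece t p r)
    ... | inj₂ r = there (⇒pieces t ps r)

  abstract
    line : IsLine _<_
    line = record
      { <-def    = <ᵈ
      ; pt       = nonempty
      ; irrefl   = λ {x} → DLO.irrefl refl
      ; <-trans  = DLO.trans
      ; cmp      = cmp
      ; dense    = DLO.dense
      ; above    = no-greatest
      ; below    = no-least
      ; segments = λ {P} D →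
          let ps , h = tame (P ∘ Vec.head) (IsDef⇒Definable (at D headᶠ))
          in List.concatMap toSegments ps ,
             λ x → mk⇔ (pieces⇒ x ps ∘ to (h x)) (from (h x) ∘ ⇒pieces x ps)
      }
      where
      module DLO = IsDenseLinearOrder isDenseLinearOrder
      cmp : ∀ x y → x < y ⊎ x ≡ y ⊎ y < x
      cmp x y with DLO.compare x y
      ... | tri< p _ _ = inj₁ p
      ... | tri≈ _ p _ = inj₂ (inj₁ p)
      ... | tri> _ _ p = inj₂ (inj₂ p)

-- The additive group, and the ring operations and charts as definable maps.

module RingTopology (em : ∀ {a} → ExcludedMiddle a) {ℓ} (𝒩 : OrderedStructure ℓ)
                    (om : IsOMinimal 𝒩) (R : DefinableRing 𝒩) (τ : GroupTopology 𝒩 R) where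

  open Definability 𝒩
  open Lines em 𝒩
  open Monotonicity em 𝒩
  open OrderedStructure 𝒩 using (_<_) renaming (Carrier to N)
  open OrderLine em 𝒩 om
  open Sides line
  open Boxes em 𝒩 line
  open DefinableRing R renaming (m to arity)
  open GroupTopology τ

  additiveGroup : AbelianGroup ℓ ℓ
  additiveGroup = record { isAbelianGroup = isAbelianGroup }

  open AbelianGroup additiveGroup public using (_-_)
    renaming ( sym to ≈-sym; trans to ≈-trans; ∙-cong to +-cong; ∙-congˡ to +-congˡ
             ; ∙-congʳ to +-congʳ; ⁻¹-cong to neg-cong; assoc to +-assoc; comm to +-comm
             ; identityˡ to +-identityˡ; identityʳ to +-identityʳ
             ; inverseˡ to +-inverseˡ; inverseʳ to +-inverseʳ )
  private module G = AbelianGroupProperties additiveGroup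

  module ≈-Reasoning = SetoidReasoning (AbelianGroup.setoid additiveGroup)
  open ≈-Reasoning

  minus-cong : ∀ {x x′ y y′} → x ≈ x′ → y ≈ y′ → (x - y) ≈ (x′ - y′)
  minus-cong {x} {x′} {y} {y′} p q = +-cong {x} {x′} {(- y)} {(- y′)} p (neg-cong {y} {y′} q)

  x-x≈0 : ∀ x → (x - x) ≈ 0#
  x-x≈0 = +-inverseʳ

  minus≈0 : ∀ x y → x ≈ y → (x - y) ≈ 0#
  minus≈0 x y e = ≈-trans {x - y} {y - y} {0#} (minus-cong {x} {y} {y} {y} e refl) (x-x≈0 y)

  minus≈0⇒≈ : ∀ x y → (x - y) ≈ 0# → x ≈ y
  minus≈0⇒≈ = G.x∙y⁻¹≈ε⇒x≈y

  minus-0 : ∀ x → (x - 0#) ≈ x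
  minus-0 x = begin
    x - 0#  ≈⟨ +-congˡ {x} G.ε⁻¹≈ε ⟩
    x + 0#  ≈⟨ +-identityʳ x ⟩
    x       ∎

  neg-minus : ∀ x y → (- (x - y)) ≈ (y - x)
  neg-minus = G.⁻¹-anti-homo‿-

  add-minus : ∀ x y → (x + (y - x)) ≈ y
  add-minus x y = begin
    x + (y - x)      ≈⟨ +-comm x (y - x) ⟩
    (y - x) + x      ≈⟨ +-assoc y (- x) x ⟩
    y + ((- x) + x)  ≈⟨ +-congˡ {y} (+-inverseˡ x) ⟩
    y + 0#           ≈⟨ +-identityʳ y ⟩
    y                ∎

  minus-add : ∀ x y → ((x - y) + y) ≈ x
  minus-add x y = ≈-trans {(x - y) + y} {y + (x - y)} {x} (+-comm (x - y) y) (add-minus y x)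

  add-cancel : ∀ x y → ((x + y) - x) ≈ y
  add-cancel = G.xyx⁻¹≈y

  minus-split : ∀ x y z → (x - z) ≈ ((x - y) + (y - z))
  minus-split x y z = begin
    x - z                ≈⟨ +-congʳ {(- z)} {x} {(x - y) + y} (≈-sym {(x - y) + y} {x} (minus-add x y)) ⟩
    ((x - y) + y) - z    ≈⟨ +-assoc (x - y) y (- z) ⟩
    (x - y) + (y - z)    ∎

  interchange : ∀ a b c d → ((a + b) + (c + d)) ≈ ((a + c) + (b + d))
  interchange a b c d = begin
    (a + b) + (c + d)  ≈⟨ +-assoc a b (c + d) ⟩
    a + (b + (c + d))  ≈⟨ +-congˡ {a} (+-assoc b c d) ⟨
    a + ((b + c) + d)  ≈⟨ +-congˡ {a} (+-congʳ {d} (+-comm b c)) ⟩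
    a + ((c + b) + d)  ≈⟨ +-congˡ {a} (+-assoc c b d) ⟩
    a + (c + (b + d))  ≈⟨ +-assoc a c (b + d) ⟨
    (a + c) + (b + d)  ∎

  minus-interchange : ∀ a b c d → ((a + b) - (c + d)) ≈ ((a - c) + (b - d))
  minus-interchange a b c d = begin
    (a + b) - (c + d)          ≈⟨ +-congˡ {a + b} (G.⁻¹-∙-comm c d) ⟨
    (a + b) + ((- c) + (- d))  ≈⟨ interchange a b (- c) (- d) ⟩
    (a - c) + (b - d)          ∎

  neg-+ : ∀ x y → ((- x) + (- y)) ≈ (- (x + y))
  neg-+ = G.⁻¹-∙-comm

  module Additive (h : Elem → Elem) (h-cong : ∀ {x y} → x ≈ y → h x ≈ h y)
                  (h-+ : ∀ x y → h (x + y) ≈ (h x + h y)) where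

    h-0 : h 0# ≈ 0#
    h-0 = begin
      h 0#                    ≈⟨ add-cancel (h 0#) (h 0#) ⟨
      (h 0# + h 0#) - h 0#    ≈⟨ +-congʳ {(- h 0#)} (h-+ 0# 0#) ⟨
      h (0# + 0#) - h 0#      ≈⟨ +-congʳ {(- h 0#)} (h-cong {0# + 0#} {0#} (+-identityˡ 0#)) ⟩
      h 0# - h 0#             ≈⟨ x-x≈0 (h 0#) ⟩
      0#                      ∎

    h-minus : ∀ x y → h (x - y) ≈ (h x - h y)
    h-minus x y = begin
      h (x - y)                  ≈⟨ add-cancel (h y) (h (x - y)) ⟨
      (h y + h (x - y)) - h y    ≈⟨ +-congʳ {(- h y)} (h-+ y (x - y)) ⟨
      h (y + (x - y)) - h y      ≈⟨ +-congʳ {(- h y)} (h-cong {y + (x - y)} {x} (add-minus y x)) ⟩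
      h x - h y                  ∎

    h-neg : ∀ x → h (- x) ≈ (- h x)
    h-neg x = begin
      h (- x)         ≈⟨ h-cong {(- x)} {0# - x} (≈-sym {0# - x} {(- x)} (+-identityˡ (- x))) ⟩
      h (0# - x)      ≈⟨ h-minus 0# x ⟩
      h 0# - h x      ≈⟨ +-congʳ {(- h x)} h-0 ⟩
      0# - h x        ≈⟨ +-identityˡ (- h x) ⟩
      - h x           ∎

  mulˡ-+ : ∀ x y z → (x * (y + z)) ≈ ((x * y) + (x * z))
  mulˡ-+ = proj₁ distrib

  mulʳ-+ : ∀ x y z → ((y + z) * x) ≈ ((y * x) + (z * x))
  mulʳ-+ = proj₂ distrib

  module Left (x : Elem) = Additive (x *_) (λ {y} {z} → *-cong {x} {x} {y} {z} refl) (mulˡ-+ x)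
  module Right (y : Elem) = Additive (_* y) (λ {x} {z} p → *-cong {x} {z} {y} {y} p refl) (mulʳ-+ y)

  𝐔 : Sort
  𝐔 = sub U definable

  private
    opᶠ : ∀ {_·_ : Elem → Elem → Elem} → Congruent₂ _≈_ _·_ → Definable 𝒩 (Graph₂ 𝒩 _·_) →
          DefFun (𝐔 ⊗ 𝐔) 𝐔 (λ (x , y) → x · y)
    opᶠ {_·_} ·-cong D = describe
      (at (Definable⇒IsDef D)
          (codeᶠ {𝐔 ⊗ (𝐔 ⊗ 𝐔)} ∘ᶠ (fstᶠ ∘ᶠ fstᶠ ,ᶠ sndᶠ ∘ᶠ fstᶠ ,ᶠ sndᶠ)))
      (λ (x , y) → x , y , refl)
      λ { (x , y) z (x′ , y′ , e) →
        let p , e′ = Vec.++-injective (proj₁ x′) (proj₁ x) e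
            q , r  = Vec.++-injective (proj₁ y′) (proj₁ y) e′
        in trans (sym r) (·-cong {x′} {x} {y′} {y} p q) }

  +ᶠ : DefFun (𝐔 ⊗ 𝐔) 𝐔 (λ (x , y) → x + y)
  +ᶠ = opᶠ (λ {x} {x′} {y} {y′} → +-cong {x} {x′} {y} {y′}) +-definable

  *ᶠ : DefFun (𝐔 ⊗ 𝐔) 𝐔 (λ (x , y) → x * y)
  *ᶠ = opᶠ (λ {x} {x′} {y} {y′} → *-cong {x} {x′} {y} {y′}) *-definable

  ≈ᵈ : ∀ {Γ f g} → DefFun Γ 𝐔 f → DefFun Γ 𝐔 g → IsDef Γ (λ γ → f γ ≈ g γ)
  ≈ᵈ = at₂ (Eqᵈ 𝐔)

  -- Definability of addition suffices: the negative of `x` is the only solution `y` of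
  -- `x + y ≈ 0#`.
  negᶠ : DefFun 𝐔 𝐔 (λ x → - x)
  negᶠ = describe (≈ᵈ +ᶠ (constᶠ 0#)) +-inverseʳ (λ x y → G.inverseʳ-unique x y)

  infixl 6 _-ᶠ_ _+ᶠᶠ_
  _-ᶠ_ : ∀ {Γ f g} → DefFun Γ 𝐔 f → DefFun Γ 𝐔 g → DefFun Γ 𝐔 (λ γ → f γ - g γ)
  F -ᶠ G = +ᶠ ∘ᶠ (F ,ᶠ negᶠ ∘ᶠ G)

  _+ᶠᶠ_ : ∀ {Γ f g} → DefFun Γ 𝐔 f → DefFun Γ 𝐔 g → DefFun Γ 𝐔 (λ γ → f γ + g γ)
  F +ᶠᶠ G = +ᶠ ∘ᶠ (F ,ᶠ G)

  infixl 7 _*ᶠᶠ_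
  _*ᶠᶠ_ : ∀ {Γ f g} → DefFun Γ 𝐔 f → DefFun Γ 𝐔 g → DefFun Γ 𝐔 (λ γ → f γ * g γ)
  F *ᶠᶠ G = *ᶠ ∘ᶠ (F ,ᶠ G)

  module ChartMaps {n} (C : Chart 𝒩 U n) where
    open Chart C

    Dom : Elem → Set ℓ
    Dom u = V (proj₁ u)

    Dom-def : IsDef 𝐔 Dom
    Dom-def = at (Definable⇒IsDef V-definable) codeᶠ

    private
      origin : Vec N n
      origin = Vec.replicate n pt

      coord′ : ∀ u → Dom u ⊎ ¬ Dom u → Vec N n
      coord′ u (inj₁ p) = proj₁ (Inverse.to φ (proj₁ u , p))
      coord′ u (inj₂ _) = origin

      point′ : ∀ y → O y ⊎ ¬ O y → Elem
      point′ y (inj₁ o) = proj₁ (Inverse.from φ (y , o)) , V⊆U (proj₂ (Inverse.from φ (y , o)))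
      point′ y (inj₂ _) = 0#

    abstract

      -- Off the domain of the chart and off its range these maps are constant.
      coord : Elem → Vec N n
      coord u = coord′ u (decide (Dom u))

      point⁻ : Vec N n → Elem
      point⁻ y = point′ y (decide (O y))

      coord-to : ∀ u (p : Dom u) → coord u ≡ proj₁ (Inverse.to φ (proj₁ u , p))
      coord-to u p with decide (Dom u)
      ... | inj₁ q = Inverse.to-cong φ {proj₁ u , q} {proj₁ u , p} refl
      ... | inj₂ n = ⊥-elim (n p)

      point-from : ∀ y (o : O y) → proj₁ (point⁻ y) ≡ proj₁ (Inverse.from φ (y , o))
      point-from y o with decide (O y)
      ... | inj₁ q = Inverse.from-cong φ {y , q} {y , o} refl
      ... | inj₂ n = ⊥-elim (n o)

      coord∈O : ∀ u → Dom u → O (coord u)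
      coord∈O u p = subst O (sym (coord-to u p)) (proj₂ (Inverse.to φ (proj₁ u , p)))

      point∈Dom : ∀ y → O y → Dom (point⁻ y)
      point∈Dom y o = subst V (sym (point-from y o)) (proj₂ (Inverse.from φ (y , o)))

      coord-point : ∀ y → O y → coord (point⁻ y) ≡ y
      coord-point y o =
        trans (coord-to (point⁻ y) (point∈Dom y o))
          (trans (Inverse.to-cong φ {_ , point∈Dom y o} {Inverse.from φ (y , o)} (point-from y o))
                 (Inverse.strictlyInverseˡ φ (y , o)))

      point-coord : ∀ u → Dom u → point⁻ (coord u) ≈ u
      point-coord u p =
        trans (point-from (coord u) (coord∈O u p))
          (trans (Inverse.from-cong φ {_ , coord∈O u p} {Inverse.to φ (proj₁ u , p)} (coord-to u p))
                 (Inverse.strictlyInverseʳ φ (proj₁ u , p)))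

      coord-def : DefFun 𝐔 (𝐕 n) coord
      coord-def = describe
        (at (Definable⇒IsDef φ-definable) (codeᶠ {𝐔 ⊗ 𝐕 n}) ∨ᵈ
         (¬ᵈ (at Dom-def fstᶠ) ∧ᵈ at₂ (Eqᵈ (𝐕 n)) sndᶠ (constᶠ origin)))
        total unique
        where
        total : ∀ u → Graph 𝒩 (Inverse.to φ) (proj₁ u ++ coord u) ⊎ (¬ Dom u × coord u ≡ origin)
        total u with decide (Dom u)
        ... | inj₁ p = inj₁ ((proj₁ u , p) , refl)
        ... | inj₂ n = inj₂ (n , refl)
        unique : ∀ u y → Graph 𝒩 (Inverse.to φ) (proj₁ u ++ y) ⊎ (¬ Dom u × y ≡ origin) → y ≡ coord u
        unique u y (inj₁ ((x , p) , e)) with Vec.++-injective x (proj₁ u) e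
        ... | refl , r = trans (sym r) (sym (coord-to u p))
        unique u y (inj₂ (n , e)) with decide (Dom u)
        ... | inj₁ p = ⊥-elim (n p)
        ... | inj₂ _ = e

      -- Described as the inverse of `coord`, since a chart comes with a definable graph in that
      -- direction.
      point-def : DefFun (𝐕 n) 𝐔 point⁻
      point-def = describe
        ((at Dom-def sndᶠ ∧ᵈ at₂ (Eqᵈ (𝐕 n)) (coord-def ∘ᶠ sndᶠ) fstᶠ) ∨ᵈ
         (¬ᵈ (∃ᵈ (at Dom-def v0 ∧ᵈ at₂ (Eqᵈ (𝐕 n)) (coord-def ∘ᶠ v0) (S fstᶠ))) ∧ᵈ
          ≈ᵈ sndᶠ (constᶠ 0#)))
        total unique
        where
        Rel′ : Vec N n × Elem → Set ℓ
        Rel′ (y , u) = (Dom u × coord u ≡ y) ⊎ ((¬ (∃[ x ] Dom x × coord x ≡ y)) × u ≈ 0#)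
        total : ∀ y → Rel′ (y , point⁻ y)
        total y with decide (O y) in eq
        ... | inj₁ o = inj₁ (subst (λ s → Dom (point′ y s) × coord (point′ y s) ≡ y) eq
                               (point∈Dom y o , coord-point y o))
        ... | inj₂ n = inj₂ ((λ { (x , p , refl) → n (coord∈O x p) }) , refl)
        unique : ∀ y u → Rel′ (y , u) → u ≈ point⁻ y
        unique y u (inj₁ (p , refl)) = sym (point-coord u p)
        unique y u (inj₂ (n , e)) with decide (O y) in eq
        ... | inj₁ o = ⊥-elim (n (point⁻ y , point∈Dom y o , coord-point y o))
        ... | inj₂ _ = e

    image⇒ : ∀ {W y} → image W y → O y × W (proj₁ (point⁻ y))
    image⇒ {W} (o , w) = o , subst W (sym (point-from _ o)) w

    ⇒image : ∀ {W y} → O y → W (proj₁ (point⁻ y)) → image W y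
    ⇒image {W} o w = o , subst W (point-from _ o) w

-- Finite families of germs and of conditions on boxes.

module FiniteFamilies (em : ∀ {a} → ExcludedMiddle a) {ℓ} (𝒩 : OrderedStructure ℓ)
                      {_<_ : Rel (OrderedStructure.Carrier 𝒩) ℓ} (L : Lines.IsLine em 𝒩 _<_) where

  open Definability 𝒩
  open Lines em 𝒩
  open Monotonicity em 𝒩
  open Sides L
  open Boxes em 𝒩 L
  open OrderedStructure 𝒩 using () renaming (Carrier to N)

  Ev-true : ∀ {a P} → (∀ x → P x) → Ev a P
  Ev-true {a} h = let c , p = ◁-above a in ev c p λ x _ _ → h x

  Ev-∀ : ∀ {r a} {P : Fin r → Pred N ℓ} → (∀ i → Ev a (P i)) → Ev a (λ x → ∀ i → P i x)
  Ev-∀ {zero}  h = Ev-true λ _ ()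
  Ev-∀ {suc r} h = Ev-map (λ { x (p , q) zero → p ; x (p , q) (suc i) → q i })
                          (Ev-∧ (h zero) (Ev-∀ (h ∘ suc)))

  -- By the dichotomy of germs a member that does not hold eventually fails eventually, and can be
  -- removed from the cover.
  Ev-cover : ∀ {r a} {P : Fin r → Pred N ℓ} → (∀ i → IsDef 𝐍 (P i)) →
             Ev a (λ x → ∃[ i ] P i x) → ∃[ i ] Ev a (P i)
  Ev-cover {zero}  D e with Ev-∃ e
  ... | _ , _ , () , _
  Ev-cover {suc r} {a} {P} D e with germ (D zero) a
  ... | inj₁ p = zero , p
  ... | inj₂ n = let i , q = Ev-cover (D ∘ suc) (Ev-map drop-zero (Ev-∧ n e)) in suc i , q
    where
    drop-zero : ∀ x → ¬ P zero x × (∃[ i ] P i x) → ∃[ i ] P (suc i) x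
    drop-zero x (n , zero  , p) = ⊥-elim (n p)
    drop-zero x (n , suc i , p) = i , p

  box-around : ∀ {n} (p : Vec N n) → ∃[ lo ] ∃[ hi ] In lo hi p
  box-around []      = [] , [] , [] , []
  box-around (x ∷ p) with below x | above x | box-around p
  ... | y , y<x | z , x<z | lo , hi , a , b = y ∷ lo , z ∷ hi , y<x ∷ a , x<z ∷ b

  box-separating : ∀ {n} (p q : Vec N n) → p ≢ q → ∃[ lo ] ∃[ hi ] In lo hi p × ¬ In lo hi q
  box-separating [] [] n = ⊥-elim (n refl)
  box-separating (x ∷ p) (y ∷ q) n with cmp x y
  ... | inj₁ x<y with box-around (x ∷ p)
  ... | l ∷ lo , h ∷ hi , l<x ∷ a , _ ∷ b =
    l ∷ lo , y ∷ hi , (l<x ∷ a , x<y ∷ b) , λ { (_ , y<y ∷ _) → irrefl y<y }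
  box-separating (x ∷ p) (y ∷ q) n | inj₂ (inj₂ y<x) with box-around (x ∷ p)
  ... | l ∷ lo , h ∷ hi , _ ∷ a , x<h ∷ b =
    y ∷ lo , h ∷ hi , (y<x ∷ a , x<h ∷ b) , λ { (y<y ∷ _ , _) → irrefl y<y }
  box-separating (x ∷ p) (.x ∷ q) n | inj₂ (inj₁ refl)
    with box-separating p q (n ∘ cong (x ∷_)) | below x | above x
  ... | lo , hi , (a , b) , m | l , l<x | h , x<h =
    l ∷ lo , h ∷ hi , (l<x ∷ a , x<h ∷ b) , λ { (_ ∷ c , _ ∷ d) → m (c , d) }

  Neighbourhood-map : ∀ {n} {p : Vec N n} {P Q} → (∀ q → P q → Q q) →
                      Neighbourhood p P → Neighbourhood p Q
  Neighbourhood-map h (l , r , i , k) = l , r , i , λ q j → h q (k q j)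

  Neighbourhood-∀ : ∀ {r n} {p : Vec N n} {P : Fin r → Pred (Vec N n) ℓ} →
                    (∀ i → Neighbourhood p (P i)) → Neighbourhood p (λ q → ∀ i → P i q)
  Neighbourhood-∀ {zero} {p = p} h = let l , r , i = box-around p in l , r , i , λ _ _ ()
  Neighbourhood-∀ {suc r} {P = P} h = Neighbourhood-map join
    (Neighbourhood-∩ {P = P zero} {Q = λ q → ∀ i → P (suc i) q}
                     (h zero) (Neighbourhood-∀ (h ∘ suc)))
    where
    join : ∀ q → P zero q × (∀ i → P (suc i) q) → ∀ i → P i q
    join q (p , k) zero    = p
    join q (p , k) (suc i) = k i

  everywhere : ∀ {r k} {Q : Fin r → Pred (Vec N k) ℓ} →
               (∀ i (B : Box k) → Σ[ B′ ∈ Box k ] B′ ⊑ B × (∀ p → p ∈ B′ → Q i p)) →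
               ∀ B → Σ[ B′ ∈ Box k ] B′ ⊑ B × (∀ p → p ∈ B′ → ∀ i → Q i p)
  everywhere {zero}  h B = B , (λ _ → id) , λ _ _ ()
  everywhere {suc r} h B with h zero B
  ... | B₁ , s₁ , p with everywhere (h ∘ suc) B₁
  ... | B₂ , s₂ , q = B₂ , (λ x → s₁ x ∘ s₂ x) ,
    λ { x i zero → p x (s₂ x i) ; x i (suc j) → q x i j }

  coverBox : ∀ {r k} {P : Fin r → Pred (Vec N k) ℓ} → (∀ i → IsDef (𝐕 k) (P i)) →
             ∀ B → (∀ p → p ∈ B → ∃[ i ] P i p) →
             Σ[ B′ ∈ Box k ] B′ ⊑ B × ∃[ i ] (∀ p → p ∈ B′ → P i p)
  coverBox {zero} D B h with centre B
  ... | p , i with h p i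
  ... | () , _
  coverBox {suc r} {k} {P} D B h with Uniform.decideOn (uniform k) B (D zero)
  ... | B₁ , s₁ , inj₁ p = B₁ , s₁ , zero , p
  ... | B₁ , s₁ , inj₂ n with coverBox (D ∘ suc) B₁ (λ p i → drop-zero p i (h p (s₁ p i)))
    where
    drop-zero : ∀ p → p ∈ B₁ → (∃[ i ] P i p) → ∃[ i ] P (suc i) p
    drop-zero p j (zero  , q) = ⊥-elim (n p j q)
    drop-zero p j (suc i , q) = i , q
  ... | B₂ , s₂ , i , p = B₂ , (λ x → s₁ x ∘ s₂ x) , suc i , p

  In-lookup : ∀ {n} {lo hi p : Vec N n} →
              (∀ i → lookup lo i < lookup p i × lookup p i < lookup hi i) → In lo hi p
  In-lookup {lo = []} {[]} {[]} h = [] , []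
  In-lookup {lo = _ ∷ _} {_ ∷ _} {_ ∷ _} h with h zero | In-lookup (h ∘ suc)
  ... | p , q | a , b = p ∷ a , q ∷ b

  lookup-ext : ∀ {n} {p q : Vec N n} → (∀ i → lookup p i ≡ lookup q i) → p ≡ q
  lookup-ext {p = []} {[]} h = refl
  lookup-ext {p = _ ∷ _} {_ ∷ _} h = cong₂ _∷_ (h zero) (lookup-ext (h ∘ suc))

  lookup-In : ∀ {n} {lo hi p : Vec N n} → In lo hi p →
              ∀ i → lookup lo i < lookup p i × lookup p i < lookup hi i
  lookup-In (a , b) i = Pw.lookup a i , Pw.lookup b i

-- Neighbourhoods of `0#`, and generic continuity of maps into the ring.

module SmallSets (em : ∀ {a} → ExcludedMiddle a) {ℓ} (𝒩 : OrderedStructure ℓ)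
                 (om : IsOMinimal 𝒩) (R : DefinableRing 𝒩) (τ : GroupTopology 𝒩 R) where

  open Definability 𝒩
  open Lines em 𝒩
  open Monotonicity em 𝒩
  open OrderedStructure 𝒩 using (_<_) renaming (Carrier to N)
  open OrderLine em 𝒩 om
  open Sides line
  open Continuity line
  open Boxes em 𝒩 line
  open FiniteFamilies em 𝒩 line
  open DefinableRing R renaming (m to arity)
  open GroupTopology τ
  open RingTopology em 𝒩 om R τ
  open ≈-Reasoning

  n : ℕ
  n = dimension

  i₀ : Fin size
  i₀ = proj₁ (cover (proj₁ 0#) (proj₂ 0#))

  module At (i : Fin size) = ChartMaps (chart i)
  open At i₀ public

  0∈Dom : Dom 0#
  0∈Dom = proj₂ (cover (proj₁ 0#) (proj₂ 0#))

  𝐏 : Sort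
  𝐏 = 𝐕 n ⊗ 𝐕 n

  -- The box with corners π in the chart at 0#; those with Valid π are a
  -- definable basis of neighbourhoods of 0#.
  B : Car 𝐏 → Elem → Set ℓ
  B (l , h) u = Dom u × In l h (coord u)

  Valid : Car 𝐏 → Set ℓ
  Valid (l , h) = In l h (coord 0#)

  Bᵈ : ∀ {Γ f g} → DefFun Γ 𝐏 f → DefFun Γ 𝐔 g → IsDef Γ (λ γ → B (f γ) (g γ))
  Bᵈ F G = at Dom-def G ∧ᵈ Inᵈ (fstᶠ ∘ᶠ F) (sndᶠ ∘ᶠ F) (coord-def ∘ᶠ G)

  Validᵈ : IsDef 𝐏 Valid
  Validᵈ = Inᵈ fstᶠ sndᶠ (constᶠ (coord 0#))

  B-resp : ∀ π {u v} → u ≈ v → B π u → B π v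
  B-resp π {u} {v} e = IsDef-resp (Bᵈ (constᶠ π) idᶠ) {u} {v} e

  0∈B : ∀ {π} → Valid π → B π 0#
  0∈B i = 0∈Dom , i

  record Small (P : Elem → Set ℓ) : Set ℓ where
    constructor small
    field
      radius : Car 𝐏
      valid  : Valid radius
      within : ∀ u → B radius u → P u
  open Small public

  Small-∩ : ∀ {P Q} → Small P → Small Q → Small (λ u → P u × Q u)
  Small-∩ (small _ i h) (small _ j k) with In-∩ i j
  ... | l , r , m , s = small (l , r) m λ u (d , t) → let a , b = s (coord u) t in h u (d , a) , k u (d , b)

  Small-map : ∀ {P Q} → (∀ u → P u → Q u) → Small P → Small Q
  Small-map h (small π i k) = small π i λ u → h u ∘ k u

  -- `B` as a set of tuples, in the form of a preimage under a chart, whose openness is what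
  -- `transition` states.
  B̂ : Car 𝐏 → Pred (Vec N arity) ℓ
  B̂ (l , h) = Chart.preimage (chart i₀) (In l h)

  B̂-open : ∀ π → Open (B̂ π)
  B̂-open (l , h) i = transition i i₀ (In l h) λ x (a , b) → l , h , a , b , λ _ → _,_

  B⇒B̂ : ∀ π u → B π u → B̂ π (proj₁ u)
  B⇒B̂ (l , h) u (p , i) = p , subst (In l h) (coord-to u p) i

  B̂⇒B : ∀ π u → B̂ π (proj₁ u) → B π u
  B̂⇒B (l , h) u (p , i) = p , subst (In l h) (sym (coord-to u p)) i

  open⇒small : ∀ W → Open W → W (proj₁ 0#) → Small (W ∘ proj₁)
  open⇒small W OW w
    with OW i₀ (coord 0#) (⇒image {W} (coord∈O 0# 0∈Dom) (subst W (sym (point-coord 0# 0∈Dom)) w))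
  ... | l , h , a , b , k = small (l , h) (a , b) λ u (p , c , d) →
        subst W (point-coord u p) (proj₂ (image⇒ {W} (k (coord u) c d)))

  Shift : Elem → Pred (Vec N arity) ℓ → Pred (Vec N arity) ℓ
  Shift x W v = Σ[ v∈U ∈ U v ] W (proj₁ (x + (v , v∈U)))

  Shift-open : ∀ x W → Open W → Open (Shift x W)
  Shift-open x W OW i y (o , v∈U , w) with +-continuous x (_ , v∈U) W OW w
  ... | A , A′ , _ , OA′ , x∈A , y∈A′ , k with OA′ i y (o , y∈A′)
  ... | l , h , a , b , m = l , h , a , b , λ y′ c d → let o′ , q = m y′ c d in
        o′ , Chart.V⊆U (chart i) (proj₂ (Inverse.from (Chart.φ (chart i)) (y′ , o′))) , k x _ x∈A q

  ⇒Shift : ∀ x {W} u → W (proj₁ (x + u)) → Shift x W (proj₁ u)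
  ⇒Shift x u w = proj₂ u , w

  Shift⇒ : ∀ x {W} u → Shift x W (proj₁ u) → W (proj₁ (x + u))
  Shift⇒ x {W} u (p , w) = subst W (+-congˡ {x} {proj₁ u , p} {u} refl) w

  shift-small : ∀ x W → Open W → W (proj₁ x) → Small (λ u → W (proj₁ (x + u)))
  shift-small x W OW w = Small-map (Shift⇒ x {W})
    (open⇒small (Shift x W) (Shift-open x W OW) (⇒Shift x {W} 0# (subst W (sym (+-identityʳ x)) w)))

  -- The translate x + B π.
  Translate : Elem → Car 𝐏 → Pred (Vec N arity) ℓ
  Translate x π = Shift (- x) (B̂ π)

  Translate-open : ∀ x π → Open (Translate x π)
  Translate-open x π = Shift-open (- x) (B̂ π) (B̂-open π)

  ⇒Translate : ∀ x π u → B π (u - x) → Translate x π (proj₁ u)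
  ⇒Translate x π u b = ⇒Shift (- x) {B̂ π} u (B⇒B̂ π ((- x) + u) (B-resp π (+-comm u (- x)) b))

  Translate⇒ : ∀ x π u → Translate x π (proj₁ u) → B π (u - x)
  Translate⇒ x π u w = B-resp π (+-comm (- x) u) (B̂⇒B π ((- x) + u) (Shift⇒ (- x) {B̂ π} u w))

  -- Takes the place of halving a radius in estimates: two errors within `half` combine to one
  -- within `π`.
  record Half (π : Car 𝐏) : Set ℓ where
    field
      half  : Car 𝐏
      ok    : Valid half
      plus  : ∀ u v → B half u → B half v → B π (u + v)
      minus : ∀ u v → B half u → B half v → B π (u - v)
      incl  : ∀ u → B half u → B π u

  plus-small : ∀ π → Valid π →
               Σ[ π′ ∈ Car 𝐏 ] Valid π′ × (∀ u v → B π′ u → B π′ v → B π (u + v))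
  plus-small π i = combine (+-continuous 0# 0# (B̂ π) (B̂-open π)
                     (B⇒B̂ π (0# + 0#) (B-resp π (sym (+-identityˡ 0#)) (0∈B i))))
    where
    combine : (Σ[ A ∈ Pred (Vec N arity) ℓ ] Σ[ A′ ∈ Pred (Vec N arity) ℓ ]
                 Open A × Open A′ × A (proj₁ 0#) × A′ (proj₁ 0#) ×
                 (∀ x y → A (proj₁ x) → A′ (proj₁ y) → B̂ π (proj₁ (x + y)))) →
              Σ[ π′ ∈ Car 𝐏 ] Valid π′ × (∀ u v → B π′ u → B π′ v → B π (u + v))
    combine (A , A′ , OA , OA′ , a , a′ , k) = radius H , valid H , λ u v p q →
      B̂⇒B π (u + v) (k u v (proj₁ (within H u p)) (proj₂ (within H v q)))
      where
      H : Small (λ u → A (proj₁ u) × A′ (proj₁ u))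
      H = Small-∩ (open⇒small A OA a) (open⇒small A′ OA′ a′)

  neg-small : ∀ π → Valid π → Small (λ u → B π (- u))
  neg-small π i = Small-map
    (λ u (p , w) → B-resp π (neg-cong {proj₁ u , p} {u} refl) (B̂⇒B π (- (proj₁ u , p)) w))
    (open⇒small NegB (neg-continuous (B̂ π) (B̂-open π))
      (proj₂ 0# , B⇒B̂ π (- 0#) (B-resp π (sym neg-0) (0∈B i))))
    where
    NegB : Pred (Vec N arity) ℓ
    NegB v = Σ[ v∈U ∈ U v ] B̂ π (proj₁ (- (v , v∈U)))
    neg-0 : (- 0#) ≈ 0#
    neg-0 = ≈-trans {(- 0#)} {0# - 0#} {0#} (sym (+-identityˡ (- 0#))) (minus-0 0#)

  abstract
    halve : ∀ π → Valid π → Half π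
    halve π i = combine (plus-small π i)
      where
      combine : (Σ[ π′ ∈ Car 𝐏 ] Valid π′ × (∀ u v → B π′ u → B π′ v → B π (u + v))) → Half π
      combine (π₁ , i₁ , sum) = record
        { half  = radius H
        ; ok    = valid H
        ; plus  = λ u v p q → sum u v (proj₁ (within H u p)) (proj₁ (within H v q))
        ; minus = λ u v p q → sum u (- v) (proj₁ (within H u p)) (proj₂ (within H v q))
        ; incl  = λ u p → B-resp π (+-identityʳ u) (sum u 0# (proj₁ (within H u p)) (0∈B i₁))
        }
        where
        H : Small (λ u → B π₁ u × B π₁ (- u))
        H = Small-∩ (small π₁ i₁ (λ _ → id)) (neg-small π₁ i₁)

  -- The Hausdorff property at `0#`. A point outside the chart lies in no `B π`; one inside differs
  -- from `0#` in some coordinate.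
  separate : ∀ u → ¬ u ≈ 0# → ∃[ π ] Valid π × ¬ B π u
  separate u u≉0 with decide (Dom u)
  ... | inj₂ n = let l , h , i = box-around (coord 0#) in (l , h) , i , n ∘ proj₁
  ... | inj₁ p with box-separating (coord 0#) (coord u) (λ e → u≉0 (begin
          u                  ≈⟨ point-coord u p ⟨
          point⁻ (coord u)   ≈⟨ cong (proj₁ ∘ point⁻) e ⟨
          point⁻ (coord 0#)  ≈⟨ point-coord 0# 0∈Dom ⟩
          0#                 ∎))
  ... | l , h , i , m = (l , h) , i , m ∘ proj₂

  some-radius : ∃ Valid
  some-radius = let l , h , i = box-around (coord 0#) in (l , h) , i

  coordᶠ : ∀ i (c : Fin n) {Γ f} → DefFun Γ 𝐔 f → DefFun Γ 𝐍 (λ γ → lookup (At.coord i (f γ)) c)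
  coordᶠ i c F = lookupᶠ c ∘ᶠ At.coord-def i ∘ᶠ F

  abstract
    -- On a smaller box `f` has values in a single chart and all its coordinates there are
    -- continuous. A translate of `B π` is open, which turns closeness in that chart into smallness
    -- of the difference.
    generic-point : ∀ {k f} → DefFun (𝐕 k) 𝐔 f → ∀ (β : Box k) →
      ∃[ p ] p ∈ β × (∀ π → Valid π → Neighbourhood p (λ q → B π (f q - f p)))
    generic-point {k} {f} F β
      with coverBox (λ i → at (At.Dom-def i) F) β (λ p _ → cover (proj₁ (f p)) (proj₂ (f p)))
    ... | β₁ , s₁ , i , dom
      with everywhere (λ c → generic-continuity k (coordᶠ i c F)) β₁
    ... | β₂ , s₂ , cont with centre β₂
    ... | p , p∈β₂ = p , s₁ p (s₂ p p∈β₂) , continuous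
      where
      module C = At i
      p∈β₁ : p ∈ β₁
      p∈β₁ = s₂ p p∈β₂
      continuous : ∀ π → Valid π → Neighbourhood p (λ q → B π (f q - f p))
      continuous π v = conclude (Translate-open (f p) π i (C.coord (f p)) (C.⇒image {W} (C.coord∈O (f p) (dom p p∈β₁))
          (subst W (sym (C.point-coord (f p) (dom p p∈β₁)))
            (⇒Translate (f p) π (f p) (B-resp π (sym (x-x≈0 (f p))) (0∈B v))))))
        where
        W : Pred (Vec N arity) ℓ
        W = Translate (f p) π
        conclude : (Σ[ l ∈ Vec N n ] Σ[ h ∈ Vec N n ] Pointwise _<_ l (C.coord (f p)) × Pointwise _<_ (C.coord (f p)) h ×
                     (∀ y → Pointwise _<_ l y → Pointwise _<_ y h → Chart.image (chart i) W y)) →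
                   Neighbourhood p (λ q → B π (f q - f p))
        conclude (l , h , a , b , m) = Neighbourhood-map close
          (Neighbourhood-∩ {P = λ q → ∀ c → lookup l c < lookup (C.coord (f q)) c ×
                                            lookup (C.coord (f q)) c < lookup h c}
            (Neighbourhood-∀ λ c → let r , s = lookup-In (a , b) c in
              cont p p∈β₂ c (lookup l c) (lookup h c) r s)
            (lo β₁ , hi β₁ , p∈β₁ , λ _ → id))
          where
          close : ∀ q → (∀ c → lookup l c < lookup (C.coord (f q)) c ×
                              lookup (C.coord (f q)) c < lookup h c) × q ∈ β₁ → B π (f q - f p)
          close q (r , j) = let c , d = In-lookup r in Translate⇒ (f p) π (f q)
            (subst W (C.point-coord (f q) (dom q j)) (proj₂ (C.image⇒ {W} (m (C.coord (f q)) c d))))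

  chartBox : Σ[ β ∈ Box n ] (∀ y → y ∈ β → Chart.O (chart i₀) y)
  chartBox = fromOpen (Chart.O-open (chart i₀) (coord 0#) (coord∈O 0# 0∈Dom))
    where
    fromOpen : (∃[ l ] ∃[ h ] Pointwise _<_ l (coord 0#) × Pointwise _<_ (coord 0#) h ×
                 (∀ y → Pointwise _<_ l y → Pointwise _<_ y h → Chart.O (chart i₀) y)) →
               Σ[ β ∈ Box n ] (∀ y → y ∈ β → Chart.O (chart i₀) y)
    fromOpen (l , h , a , b , k) = proj₁ (∈-box (a , b)) , λ y i →
      let c , d = proj₂ (proj₂ (∈-box (a , b))) y i in k y c d

  -- Translations are continuous, so what is known near any point of the chart can be carried to
  -- `0#`.
  neighbourhood⇒small : ∀ {p l h} → Chart.O (chart i₀) p → In l h p →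
    Small (λ u → Dom (point⁻ p + u) × In l h (coord (point⁻ p + u)))
  neighbourhood⇒small {p} {l} {h} o i = Small-map (λ u → B̂⇒B (l , h) (point⁻ p + u))
    (shift-small (point⁻ p) (B̂ (l , h)) (B̂-open (l , h))
      (B⇒B̂ (l , h) (point⁻ p) (point∈Dom p o , subst (In l h) (sym (coord-point p o)) i)))

  private module Fᵒ = FiniteFamilies em 𝒩 (opLine line)

  OpenAround : Vec N 1 → Pred (Vec N 1) ℓ → Set ℓ
  OpenAround x P = Σ[ l ∈ Vec N 1 ] Σ[ h ∈ Vec N 1 ] Pointwise _<_ l x × Pointwise _<_ x h ×
    (∀ y → Pointwise _<_ l y → Pointwise _<_ y h → P y)

  -- Limits of definable curves.

  module Limits (compact : DefinablyCompact 𝒩 manifold) where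

    Converges : (N → Elem) → Bound → Elem → Set ℓ
    Converges z a u = ∀ π → Valid π → Ev a (λ t → B π (z t - u))

    module _ {z} (Z : DefFun 𝐍 𝐔 z) (a : Bound) {d} (a◁d : a ◁ d) where

      curve : Curve 𝒩 manifold (extend a) ⟨ d ⟩
      curve = record { to = λ (t , _) → z (Vec.head t) ; cong = cong (λ t → proj₁ (z (Vec.head t))) }

      curve-definable : Definable 𝒩 (Graph 𝒩 (Func.to curve))
      curve-definable = IsDef⇒Definable (mapDef ok
        (◁ᵈ a headᶠ ∧ᵈ <ᵈ′ headᶠ (constᶠ d) ∧ᵈ
         at₂ (Eqᵈ (𝐕 arity)) (codeᶠ ∘ᶠ Z ∘ᶠ headᶠ) tailᶠ))
        where
        ok : ∀ v → (a ◁ Vec.head v × Vec.head v < d × proj₁ (z (Vec.head v)) ≡ Vec.tail v) ⇔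
                   Graph 𝒩 (Func.to curve) v
        ok (t ∷ v) = mk⇔
          (λ { (p , q , refl) → (t ∷ [] , toExtended a p , toExtended at⟨ _ ⟩ q) , refl })
          (λ { ((_ ∷ [] , p , q) , refl) → fromExtended a p , fromExtended at⟨ _ ⟩ q , refl })

      module _ (i : Fin size)
               (dom : ∀ t → a ◁ t → t < d → At.Dom i (z t))
               (cont : ∀ t → a ◁ t → t < d → ∀ c → ContAt _<_ (λ t → lookup (At.coord i (z t)) c) t)
               where

        private module C = At i

        curve-continuous : IsContinuous 𝒩 manifold curve
        curve-continuous W OW (t ∷ []) ((p , q) , w) =
          conclude (OW i (C.coord (z t)) (C.⇒image {W} (C.coord∈O (z t) (dom t a◁t t<d))
            (subst W (sym (C.point-coord (z t) (dom t a◁t t<d))) w)))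
          where
          a◁t : a ◁ t
          a◁t = fromExtended a p
          t<d : t < d
          t<d = fromExtended at⟨ _ ⟩ q
          Close : Vec N n → Vec N n → N → Set ℓ
          Close l h s = ∀ c → lookup l c < lookup (C.coord (z s)) c × lookup (C.coord (z s)) c < lookup h c
          Interval′ : Pred (Vec N 1) ℓ
          Interval′ s = Σ[ s∈I ∈ Interval 𝒩 (extend a) ⟨ d ⟩ s ] W (proj₁ (Func.to curve (s , s∈I)))
          conclude : (∃[ l ] ∃[ h ] Pointwise _<_ l (C.coord (z t)) × Pointwise _<_ (C.coord (z t)) h ×
                       (∀ y → Pointwise _<_ l y → Pointwise _<_ y h → Chart.image (chart i) W y)) →
                     OpenAround (t ∷ []) Interval′
          conclude (l , h , b , b′ , m)
            with Ev-∧ (Ev-∀ (λ c → proj₁ (near c))) (Ev-< t<d)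
               | ᵒ.Ev-∧ (Fᵒ.Ev-∀ (λ c → proj₂ (proj₂ (near c)))) (ᵒ.Ev-< (proj₂ (proj₂ (◁-dense a a◁t))))
            where
            near : ∀ c → Near t (λ s → lookup l c < lookup (C.coord (z s)) c ×
                                       lookup (C.coord (z s)) c < lookup h c)
            near c = let r , s = lookup-In (b , b′) c in cont t a◁t t<d c _ _ r s
          ... | ev r t<r k | ev x x<t k′ = x ∷ [] , r ∷ [] , x<t ∷ [] , t<r ∷ [] ,
            λ { (s ∷ []) (x<s ∷ []) (s<r ∷ []) → interior s (side s x<s s<r) }
            where
            side : ∀ s → x < s → s < r → Close l h s × a ◁ s × s < d
            side s x<s s<r with cmp s t
            ... | inj₁ s<t = let e , f = k′ s s<t x<s in
                  e , ◁-trans a (proj₁ (proj₂ (◁-dense a a◁t))) f , <-trans s<t t<d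
            ... | inj₂ (inj₁ refl) = lookup-In (b , b′) , a◁t , t<d
            ... | inj₂ (inj₂ t<s) = let e , f = k s t<s s<r in e , ◁-trans a a◁t t<s , f
            interior : ∀ s → Close l h s × a ◁ s × s < d → Interval′ (s ∷ [])
            interior s (e , a◁s , s<d) = (toExtended a a◁s , toExtended at⟨ _ ⟩ s<d) ,
              let e₁ , e₂ = In-lookup e in
              subst W (C.point-coord (z s) (dom s a◁s s<d)) (proj₂ (C.image⇒ {W} (m _ e₁ e₂)))

        injective-limit : (∀ s t → a ◁ s → s < d → a ◁ t → t < d → z s ≈ z t → s ≡ t) →
                          ∃ (Converges z a)
        injective-limit inj =
          limit (proj₁ (compact (extend a) ⟨ d ⟩ (toExtended a a◁d) curve curve-definable
                                curve-continuous (λ {x} {y} → injective {x} {y})))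
          where
          injective : ∀ {x y : ∃ (Interval 𝒩 (extend a) ⟨ d ⟩)} →
                      proj₁ (Func.to curve x) ≡ proj₁ (Func.to curve y) → proj₁ x ≡ proj₁ y
          injective {s ∷ [] , p , q} {t ∷ [] , p′ , q′} e =
            cong (_∷ []) (inj s t (fromExtended a p) (fromExtended at⟨ _ ⟩ q)
                                  (fromExtended a p′) (fromExtended at⟨ _ ⟩ q′) e)
          fromLimit : ∀ u π → (Σ[ c ∈ N ] Interval 𝒩 (extend a) ⟨ d ⟩ (c ∷ []) ×
                        (∀ t (t∈I : Interval 𝒩 (extend a) ⟨ d ⟩ (t ∷ [])) → t < c →
                           Translate u π (proj₁ (Func.to curve (t ∷ [] , t∈I))))) →
                      Ev a (λ t → B π (z t - u))
          fromLimit u π (c , (p , q) , h) = ev c (fromExtended a p) λ t a◁t t<c →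
            Translate⇒ u π (z t) (h t (toExtended a a◁t , toExtended at⟨ _ ⟩ (<-trans t<c (fromExtended at⟨ _ ⟩ q))) t<c)
          limit : ∃ (LeftEndpointLimit 𝒩 manifold curve) → ∃ (Converges z a)
          limit (u , lim) = u , λ π v → fromLimit u π (lim (Translate u π) (Translate-open u π)
                              (⇒Translate u π u (B-resp π (sym (x-x≈0 u)) (0∈B v))))

    -- Compactness speaks of continuous injective curves. Near `a` each coordinate is continuous and
    -- either strictly monotone or constant. One strictly monotone coordinate makes the curve
    -- injective; without any, the curve is constant and its value is the limit.
    curve-limit-in-chart : ∀ {z} → DefFun 𝐍 𝐔 z → ∀ a i → Ev a (λ t → At.Dom i (z t)) →
                           ∃ (Converges z a)
    curve-limit-in-chart {z} Z a i e = finish (Ev-∧ e (Ev-∀ λ c → proj₂ (mono c)))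
      where
      module C = At i
      coordinate : Fin n → N → N
      coordinate c t = lookup (C.coord (z t)) c
      mono : ∀ c → ∃[ k ] Ev a (λ t → OrderedBelow line (valueOrder line (coordᶠ i c Z)) a k t ×
                                      ContAt _<_ (coordinate c) t)
      mono c = monotonicity line (coordᶠ i c Z) a
      finish : Ev a (λ t → C.Dom (z t) × (∀ c →
                 OrderedBelow line (valueOrder line (coordᶠ i c Z)) a (proj₁ (mono c)) t ×
                 ContAt _<_ (coordinate c) t)) → ∃ (Converges z a)
      finish (ev d′ a◁d′ h) with ◁-dense a a◁d′
      ... | d , a◁d , d<d′ = choose (decide (∃[ c ] proj₁ (mono c) ≢ con))
        where
        dom : ∀ t → a ◁ t → t < d → C.Dom (z t)
        dom t p q = proj₁ (h t p (<-trans q d<d′))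
        ordered : ∀ c → OrderedBelow line (valueOrder line (coordᶠ i c Z)) a (proj₁ (mono c)) d
        ordered c = proj₁ (proj₂ (h d a◁d d<d′) c)
        choose : (∃[ c ] proj₁ (mono c) ≢ con) ⊎ ¬ (∃[ c ] proj₁ (mono c) ≢ con) → ∃ (Converges z a)
        choose (inj₁ (c , strict)) = injective-limit Z a a◁d i dom
          (λ t p q → λ c → proj₂ (proj₂ (h t p (<-trans q d<d′)) c)) inj
          where
          differ : ∀ s t → a ◁ s → s < t → t < d → ¬ coordinate c s ≡ coordinate c t
          differ s t p q r e = con-excludes (valueOrder line (coordᶠ i c Z)) (proj₁ (mono c)) strict
            ((λ l → irrefl (subst (_< coordinate c t) e l)) ,
             (λ l → irrefl (subst (coordinate c t <_) e l))) (ordered c s t p q r)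
          same : ∀ s t → z s ≈ z t → coordinate c s ≡ coordinate c t
          same s t e = cong (λ v → lookup v c) (DefFun-resp C.coord-def {z s} {z t} e)
          inj : ∀ s t → a ◁ s → s < d → a ◁ t → t < d → z s ≈ z t → s ≡ t
          inj s t p q p′ q′ e with cmp s t
          ... | inj₁ r        = ⊥-elim (differ s t p r q′ (same s t e))
          ... | inj₂ (inj₁ r) = r
          ... | inj₂ (inj₂ r) = ⊥-elim (differ t s p′ r q (sym (same s t e)))
        choose (inj₂ flat) with ◁-dense a a◁d
        ... | t₀ , a◁t₀ , t₀<d = z t₀ , λ π v → ev d a◁d λ t a◁t t<d →
              B-resp π (sym (minus≈0 (z t) (z t₀) (begin
                z t                    ≈⟨ C.point-coord (z t) (dom t a◁t t<d) ⟨
                C.point⁻ (C.coord (z t))   ≈⟨ cong (proj₁ ∘ C.point⁻) (lookup-ext (λ c → equal c t a◁t t<d)) ⟩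
                C.point⁻ (C.coord (z t₀))  ≈⟨ C.point-coord (z t₀) (dom t₀ a◁t₀ t₀<d) ⟩
                z t₀                   ∎))) (0∈B v)
          where
          flat′ : ∀ c → proj₁ (mono c) ≡ con
          flat′ c = byContra λ m → flat (c , m)
          level : ∀ c s t → a ◁ s → s < t → t < d → coordinate c s ≡ coordinate c t
          level c s t p q r = con⇒≡ {coordinate c}
            (subst (λ k → Ordered (λ x y → coordinate c x < coordinate c y) k s t)
                   (flat′ c) (ordered c s t p q r))
          equal : ∀ c t → a ◁ t → t < d → coordinate c t ≡ coordinate c t₀
          equal c t p q with cmp t t₀
          ... | inj₁ r           = level c t t₀ p r t₀<d
          ... | inj₂ (inj₁ refl) = refl
          ... | inj₂ (inj₂ r)    = sym (level c t₀ t a◁t₀ r q)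

    abstract
      curve-limit : ∀ {z} → DefFun 𝐍 𝐔 z → ∀ a → ∃ (Converges z a)
      curve-limit {z} Z a = inChart (Ev-cover (λ i → at (At.Dom-def i) Z)
                              (Ev-true {a} λ t → cover (proj₁ (z t)) (proj₂ (z t))))
        where
        inChart : (∃[ i ] Ev a (λ t → At.Dom i (z t))) → ∃ (Converges z a)
        inChart (i , e) = curve-limit-in-chart Z a i e

-- Definable choice of points in closures.

module Choice (em : ∀ {a} → ExcludedMiddle a) {ℓ} (𝒩 : OrderedStructure ℓ)
              (om : IsOMinimal 𝒩) (R : DefinableRing 𝒩) (τ : GroupTopology 𝒩 R)
              (compact : DefinablyCompact 𝒩 (GroupTopology.manifold τ)) where

  open Definability 𝒩
  open Lines em 𝒩
  open Monotonicity em 𝒩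
  open OrderedStructure 𝒩 using (_<_) renaming (Carrier to N)
  open OrderLine em 𝒩 om
  open Sides line
  open Boxes em 𝒩 line
  open FiniteFamilies em 𝒩 line
  open DefinableRing R renaming (m to arity)
  open GroupTopology τ
  open RingTopology em 𝒩 om R τ
  open SmallSets em 𝒩 om R τ
  open Limits compact
  open ≈-Reasoning

  module _ {T : Pred N ℓ} (T-def : IsDef 𝐍 T) {z : N → Elem} (Z : DefFun 𝐍 𝐔 z) where

    -- An interval of a general o-minimal structure has no definable midpoint. The limit of `z` at
    -- the left end of `T`, which compactness provides, is a canonical choice instead.
    InitialLimit : Elem → Set ℓ
    InitialLimit u = ∀ π → Valid π → ∃[ c ] T c × (∀ s → T s → ¬ c < s → B π (z s - u))

    private
      LeftEnd : Bound → Set ℓ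
      LeftEnd b = (∀ s → T s → b ◁ s) × (∀ y → b ◁ y → ∃[ x ] T x × x < y)

      Least : Set ℓ
      Least = ∃[ c ] T c × (∀ s → T s → ¬ s < c)

      leftEnd : ∃ T → ¬ Least → ∃ LeftEnd
      leftEnd ∃T no-least with decide (∃[ y ] (∀ s → T s → ¬ s < y))
      ... | inj₂ unbounded = ∞ , _ , λ y _ → byContra λ n →
              unbounded (y , λ s p q → n (s , p , q))
      ... | inj₁ (y , lb) with infimum T-def ∃T y lb
      ... | b , lower , greatest = at⟨ b ⟩ , above-b , greatest
        where
        above-b : ∀ s → T s → b < s
        above-b s p with ≤-split (lower s p)
        ... | inj₁ q    = q
        ... | inj₂ refl = ⊥-elim (no-least (b , p , lower))

      fromEnd : ∀ b → LeftEnd b → Ev b T → ∃ (Converges z b) → ∃ InitialLimit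
      fromEnd b (beyond , _) e (u , lim) = u , λ π v → choose π (Ev-∧ e (lim π v))
        where
        choose : ∀ π → Ev b (λ t → T t × B π (z t - u)) →
                 ∃[ c ] T c × (∀ s → T s → ¬ c < s → B π (z s - u))
        choose π (ev d b◁d h) with ◁-dense b b◁d
        ... | c , b◁c , c<d = c , proj₁ (h c b◁c c<d) ,
              λ s p c≮s → proj₂ (h s (beyond s p) (≤-<-trans c≮s c<d))

    initialLimit : ∃ T → ∃ InitialLimit
    initialLimit ∃T with decide Least
    -- The only point of `T` up to its least element `c` is `c` itself.
    ... | inj₁ (c , Tc , least) = z c , λ π v → c , Tc , λ s Ts c≮s →
            B-resp π (sym (minus≈0 (z s) (z c) (cong (proj₁ ∘ z) (equal s Ts c≮s)))) (0∈B v)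
      where
      equal : ∀ s → T s → ¬ c < s → s ≡ c
      equal s Ts c≮s with ≤-split c≮s
      ... | inj₁ s<c = ⊥-elim (least s Ts s<c)
      ... | inj₂ e   = e
    -- Points of `T` accumulate at its left end `b`, so the germ there belongs to `T` and not to its
    -- complement.
    ... | inj₂ no-least with leftEnd ∃T no-least
    ... | b , end@(_ , greatest) with germ T-def b
    ... | inj₁ e = fromEnd b end e (curve-limit Z b)
    ... | inj₂ (ev d b◁d n) with greatest d b◁d
    ... | x , Tx , x<d = ⊥-elim (n x (proj₁ end x Tx) x<d Tx)

    -- Of two initial parts of `T` one contains the other, so some `z s` is close to both limits;
    -- then the Hausdorff property applies.
    initialLimit-unique : ∀ u v → InitialLimit u → InitialLimit v → u ≈ v
    initialLimit-unique u v lu lv = minus≈0⇒≈ u v (byContra λ n →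
      let π , i , u-v∉B = separate (u - v) n in u-v∉B (close π i))
      where
      close : ∀ π → Valid π → B π (u - v)
      close π i = meet (lu half ok) (lv half ok)
        where
        open Half (halve π i)
        at-point : ∀ s → B half (z s - u) → B half (z s - v) → B π (u - v)
        at-point s p q = B-resp π (begin
          (z s - v) - (z s - u)    ≈⟨ +-congˡ {z s - v} (neg-minus (z s) u) ⟩
          (z s - v) + (u - z s)    ≈⟨ +-comm (z s - v) (u - z s) ⟩
          (u - z s) + (z s - v)    ≈⟨ minus-split u (z s) v ⟨
          u - v                    ∎) (minus _ _ q p)
        meet : (∃[ c ] T c × (∀ s → T s → ¬ c < s → B half (z s - u))) →
               (∃[ d ] T d × (∀ s → T s → ¬ d < s → B half (z s - v))) → B π (u - v)
        meet (c , Tc , h) (d , Td , k) with decide (c < d)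
        ... | inj₁ c<d = at-point c (h c Tc irrefl) (k c Tc (asym c<d))
        ... | inj₂ c≮d = at-point d (h d Td c≮d) (k d Td irrefl)

  sliceᵈ : ∀ {A C P} a → IsDef (A ⊗ C) P → IsDef C (λ c → P (a , c))
  sliceᵈ a D = at D (constᶠ a ,ᶠ idᶠ)

  sliceᶠ : ∀ {A C D f} a → DefFun (A ⊗ C) D f → DefFun C D (λ c → f (a , c))
  sliceᶠ a F = F ∘ᶠ (constᶠ a ,ᶠ idᶠ)

  module _ {A} {T : Car (A ⊗ 𝐍) → Set ℓ} (T-def : IsDef (A ⊗ 𝐍) T)
           {z : Car (A ⊗ 𝐍) → Elem} (Z : DefFun (A ⊗ 𝐍) 𝐔 z) where

    private
      Lim : Car A → Elem → Set ℓ
      Lim a = InitialLimit (sliceᵈ a T-def) (sliceᶠ a Z)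

      limit′ : ∀ a → (∃[ s ] T (a , s)) ⊎ ¬ (∃[ s ] T (a , s)) → Elem
      limit′ a (inj₁ e) = proj₁ (initialLimit (sliceᵈ a T-def) (sliceᶠ a Z) e)
      limit′ a (inj₂ _) = 0#

      limit : Car A → Elem
      limit a = limit′ a (decide _)

      Rel′ : Car (A ⊗ 𝐔) → Set ℓ
      Rel′ (a , u) = ((∃[ s ] T (a , s)) × Lim a u) ⊎ ((¬ (∃[ s ] T (a , s))) × u ≈ 0#)

      total′ : ∀ a d → Rel′ (a , limit′ a d)
      total′ a (inj₁ e) = inj₁ (e , proj₂ (initialLimit (sliceᵈ a T-def) (sliceᶠ a Z) e))
      total′ a (inj₂ n) = inj₂ (n , refl)

      unique : ∀ a u v → Rel′ (a , u) → Rel′ (a , v) → u ≈ v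
      unique a u v (inj₁ (_ , p)) (inj₁ (_ , q)) =
        initialLimit-unique (sliceᵈ a T-def) (sliceᶠ a Z) u v p q
      unique a u v (inj₁ (e , _)) (inj₂ (n , _)) = ⊥-elim (n e)
      unique a u v (inj₂ (n , _)) (inj₁ (e , _)) = ⊥-elim (n e)
      unique a u v (inj₂ (_ , p)) (inj₂ (_ , q)) = trans p (sym q)

      Rel-def : IsDef (A ⊗ 𝐔) Rel′
      Rel-def = (nonempty-def ∧ᵈ
                 ∀ᵈ (at Validᵈ v0 ⇒ᵈ ∃ᵈ (at₂ T-def (S (S fstᶠ)) v0 ∧ᵈ
                   ∀ᵈ (at₂ T-def (S (S (S fstᶠ))) v0 ⇒ᵈ ¬ᵈ (<ᵈ′ (S v0) v0) ⇒ᵈ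
                     Bᵈ (S (S v0)) (Z ∘ᶠ (S (S (S fstᶠ)) ,ᶠ v0) -ᶠ S (S (S sndᶠ))))))) ∨ᵈ
                (¬ᵈ nonempty-def ∧ᵈ ≈ᵈ sndᶠ (constᶠ 0#))
        where
        nonempty-def : IsDef (A ⊗ 𝐔) (λ (a , u) → ∃[ s ] T (a , s))
        nonempty-def = ∃ᵈ (at₂ T-def (S fstᶠ) v0)

    -- The limit is characterised by a definable condition and is unique, so it depends definably on
    -- the parameter `a`. The value `0#` is assigned where `T` has an empty fibre.
    definableLimit : Σ[ y ∈ (Car A → Elem) ] DefFun A 𝐔 y ×
      (∀ a → (∃[ s ] T (a , s)) → ∀ π → Valid π → ∃[ s ] T (a , s) × B π (z (a , s) - y a))
    definableLimit = limit ,
      describe Rel-def (λ a → total′ a (decide _))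
        (λ a u r → unique a u (limit a) r (total′ a (decide _))) ,
      λ a e π v → adherent a e π v (total′ a (decide _))
      where
      adherent : ∀ a → (∃[ s ] T (a , s)) → ∀ π → Valid π → Rel′ (a , limit a) →
                 ∃[ s ] T (a , s) × B π (z (a , s) - limit a)
      adherent a e π v (inj₂ (n , _)) = ⊥-elim (n e)
      adherent a e π v (inj₁ (_ , l)) = let c , Tc , h = l π v in c , Tc , h c Tc irrefl

  -- Limits are taken in one coordinate after another, so that the selected points
  -- lie in the closures only.
  closedChoiceᵛ : ∀ k {A} {X : Car (A ⊗ 𝐕 k) → Set ℓ} → IsDef (A ⊗ 𝐕 k) X →
    ∀ {f : Car (A ⊗ 𝐕 k) → Elem} → DefFun (A ⊗ 𝐕 k) 𝐔 f →
    Σ[ y ∈ (Car A → Elem) ] DefFun A 𝐔 y ×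
      (∀ a → (∃[ p ] X (a , p)) → ∀ π → Valid π → ∃[ p ] X (a , p) × B π (f (a , p) - y a))
  closedChoiceᵛ zero {X = X} D {f} F = (λ a → f (a , [])) , F ∘ᶠ (idᶠ ,ᶠ constᶠ []) ,
    λ { a ([] , x) π v → [] , x , B-resp π (sym (x-x≈0 (f (a , [])))) (0∈B v) }
  closedChoiceᵛ (suc k) {A} {X} D {f} F = combine
    (closedChoiceᵛ k {A ⊗ 𝐍} {λ ((a , s) , q) → X (a , s ∷ q)} (at₂ D (fstᶠ ∘ᶠ fstᶠ) tupleᶠ)
                     (F ∘ᶠ (fstᶠ ∘ᶠ fstᶠ ,ᶠ tupleᶠ)))
    where
    tupleᶠ : DefFun ((A ⊗ 𝐍) ⊗ 𝐕 k) (𝐕 (suc k)) (λ ((a , s) , q) → s ∷ q)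
    tupleᶠ = consᶠ ∘ᶠ (sndᶠ ∘ᶠ fstᶠ ,ᶠ sndᶠ)
    Result : Set (lsuc ℓ)
    Result = Σ[ y ∈ (Car A → Elem) ] DefFun A 𝐔 y ×
      (∀ a → (∃[ p ] X (a , p)) → ∀ π → Valid π → ∃[ p ] X (a , p) × B π (f (a , p) - y a))
    combine : (Σ[ y ∈ (Car (A ⊗ 𝐍) → Elem) ] DefFun (A ⊗ 𝐍) 𝐔 y ×
      (∀ as → (∃[ q ] X (proj₁ as , proj₂ as ∷ q)) → ∀ π → Valid π →
         ∃[ q ] X (proj₁ as , proj₂ as ∷ q) × B π (f (proj₁ as , proj₂ as ∷ q) - y as))) → Result
    combine (y , Y , h) = combine′ (definableLimit {A} {λ (a , s) → ∃[ q ] X (a , s ∷ q)}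
        (∃ᵈ (at₂ D (S fstᶠ) (consᶠ ∘ᶠ (S sndᶠ ,ᶠ v0)))) Y)
      where
      combine′ : (Σ[ y′ ∈ (Car A → Elem) ] DefFun A 𝐔 y′ ×
        (∀ a → (∃[ s ] ∃[ q ] X (a , s ∷ q)) → ∀ π → Valid π →
           ∃[ s ] (∃[ q ] X (a , s ∷ q)) × B π (y (a , s) - y′ a))) → Result
      combine′ (y′ , Y′ , h′) = y′ , Y′ , λ a e π v → approximate a e π (halve π v)
        where
        approximate : ∀ a → (∃[ p ] X (a , p)) → ∀ π → Half π →
                      ∃[ p ] X (a , p) × B π (f (a , p) - y′ a)
        approximate a (s₀ ∷ q₀ , x₀) π H with h′ a (s₀ , q₀ , x₀) (Half.half H) (Half.ok H)
        ... | s , e , b with h (a , s) e (Half.half H) (Half.ok H)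
        ... | q , x , b′ = s ∷ q , x , B-resp π (sym (minus-split _ (y (a , s)) (y′ a)))
                                                (Half.plus H _ _ b′ b)

  private
    element′ : ∀ p → U p ⊎ ¬ U p → Elem
    element′ p (inj₁ u) = p , u
    element′ p (inj₂ _) = 0#

    element : Vec N arity → Elem
    element p = element′ p (decide (U p))

    element-def : DefFun (𝐕 arity) 𝐔 element
    element-def = describe
      (at₂ (Eqᵈ (𝐕 arity)) (codeᶠ {𝐔} ∘ᶠ sndᶠ) fstᶠ ∨ᵈ
       (¬ᵈ (∃ᵈ (at₂ (Eqᵈ (𝐕 arity)) (codeᶠ {𝐔} ∘ᶠ v0) (S fstᶠ))) ∧ᵈ ≈ᵈ sndᶠ (constᶠ 0#)))
      (λ p → total p (decide (U p))) (λ p u → unique p u (decide (U p)))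
      where
      Rel″ : Vec N arity → Elem → Set ℓ
      Rel″ p u = proj₁ u ≡ p ⊎ ((¬ (∃[ x ] proj₁ {B = U} x ≡ p)) × u ≈ 0#)
      total : ∀ p d → Rel″ p (element′ p d)
      total p (inj₁ u) = inj₁ refl
      total p (inj₂ n) = inj₂ ((λ { (x , refl) → n (proj₂ x) }) , refl)
      unique : ∀ p u d → Rel″ p u → u ≈ element′ p d
      unique p u (inj₁ _) (inj₁ e)       = e
      unique p u (inj₂ n) (inj₁ refl)    = ⊥-elim (n (proj₂ u))
      unique p u (inj₁ q) (inj₂ (n , _)) = ⊥-elim (n ((p , q) , refl))
      unique p u (inj₂ _) (inj₂ (_ , e)) = e

    element-code : ∀ u → element (proj₁ u) ≈ u
    element-code u = lemma (decide (U (proj₁ u)))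
      where
      lemma : ∀ d → element′ (proj₁ u) d ≈ u
      lemma (inj₁ _) = refl
      lemma (inj₂ n) = ⊥-elim (n (proj₂ u))

  abstract
    -- Elements are reached through their tuples of coordinates, to which the previous choice
    -- applies; a tuple outside `U` stands for `0#`.
    closedChoice : ∀ {A} {X : Car (A ⊗ 𝐔) → Set ℓ} → IsDef (A ⊗ 𝐔) X →
      Σ[ y ∈ (Car A → Elem) ] DefFun A 𝐔 y ×
        (∀ a → (∃[ u ] X (a , u)) → ∀ π → Valid π → ∃[ u ] X (a , u) × B π (u - y a))
    closedChoice {A} {X} D = simplify
      (closedChoiceᵛ arity {A} {λ (a , p) → X (a , element p)}
        (at₂ D fstᶠ (element-def ∘ᶠ sndᶠ)) (element-def ∘ᶠ sndᶠ))
      where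
      simplify : (Σ[ y ∈ (Car A → Elem) ] DefFun A 𝐔 y ×
        (∀ a → (∃[ p ] X (a , element p)) → ∀ π → Valid π →
           ∃[ p ] X (a , element p) × B π (element p - y a))) →
        Σ[ y ∈ (Car A → Elem) ] DefFun A 𝐔 y ×
          (∀ a → (∃[ u ] X (a , u)) → ∀ π → Valid π → ∃[ u ] X (a , u) × B π (u - y a))
      simplify (y , Y , h) = y , Y , λ a (u , x) π v →
        let p , x′ , b = h a (proj₁ u , IsDef-resp (sliceᵈ a D) {u} {element (proj₁ u)}
                                          (sym (element-code u)) x) π v
        in element p , x′ , b

-- Definable subgroups: transversal curves and finite index.

module Subgroups (em : ∀ {a} → ExcludedMiddle a) {ℓ} (𝒩 : OrderedStructure ℓ)
                 (om : IsOMinimal 𝒩) (R : DefinableRing 𝒩) (τ : GroupTopology 𝒩 R)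
                 (compact : DefinablyCompact 𝒩 (GroupTopology.manifold τ)) where

  open Definability 𝒩
  open Lines em 𝒩
  open Monotonicity em 𝒩
  open OrderedStructure 𝒩 using (_<_) renaming (Carrier to N)
  open OrderLine em 𝒩 om
  open Sides line
  open Boxes em 𝒩 line
  open FiniteFamilies em 𝒩 line
  open DefinableRing R renaming (m to arity)
  open GroupTopology τ
  open RingTopology em 𝒩 om R τ
  open SmallSets em 𝒩 om R τ
  open Limits compact
  open Choice em 𝒩 om R τ compact

  record IsSubgroup (P : Elem → Set ℓ) : Set ℓ where
    field
      P-def : IsDef 𝐔 P
      P-0   : P 0#
      P-+   : ∀ x y → P x → P y → P (x + y)
      P-neg : ∀ x → P x → P (- x)

    P-resp : ∀ {x y} → x ≈ y → P x → P y
    P-resp {x} {y} = IsDef-resp P-def {x} {y}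

    ~-refl : ∀ x → P (x - x)
    ~-refl x = P-resp (sym (x-x≈0 x)) P-0

    ~-sym : ∀ x y → P (x - y) → P (y - x)
    ~-sym x y p = P-resp (neg-minus x y) (P-neg (x - y) p)

    ~-trans : ∀ x y z → P (x - y) → P (y - z) → P (x - z)
    ~-trans x y z p q = P-resp (sym (minus-split x y z)) (P-+ (x - y) (y - z) p q)

  Transversal : (Elem → Set ℓ) → Set (lsuc ℓ)
  Transversal P = Σ[ γ ∈ (N → Elem) ] DefFun 𝐍 𝐔 γ × Inequivalent′ γ
    where
    Inequivalent′ : (N → Elem) → Set ℓ
    Inequivalent′ γ = ∃[ u ] ∃[ v ] u < v × (∀ x y → u < x → x < y → y < v → ¬ P (γ x - γ y))

  module _ {P : Elem → Set ℓ} (G : IsSubgroup P) where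
    open IsSubgroup G

    private
      ClassesBelow : (N → Elem) → Bound → Pred N ℓ
      ClassesBelow γ a c = ∀ x y → a ◁ x → x < y → y < c → P (γ x - γ y)

    transversal-or-eventually : ∀ {γ} → DefFun 𝐍 𝐔 γ → ∀ a → Transversal P ⊎ Ev a (ClassesBelow γ a)
    transversal-or-eventually {γ} Γ a = [ (λ t → inj₁ (γ , Γ , t)) , inj₂ ]′
      (transversal-or-constant line (valueOrder line idᶠ)
        (at P-def (Γ ∘ᶠ fstᶠ -ᶠ Γ ∘ᶠ sndᶠ)) (~-refl _) (~-sym _ _) (~-trans _ _ _) a)

    -- Without a transversal the image of each line in the first direction stays in one coset near
    -- `u`, on an interval that can be taken the same for all `q`. The slice at `s`, in one coset by
    -- induction, connects these lines.
    boxInClass-or-transversal : ∀ k {f} → DefFun (𝐕 k) 𝐔 f → ∀ (β : Box k) → Transversal P ⊎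
      (Σ[ β′ ∈ Box k ] β′ ⊑ β × (∀ p q → p ∈ β′ → q ∈ β′ → P (f p - f q)))
    boxInClass-or-transversal zero F β = inj₂ (β , (λ _ → id) , λ { [] [] _ _ → ~-refl _ })
    boxInClass-or-transversal (suc k) {f} F (box {u ∷ _} {v ∷ _} (u<v ∷ b)) =
      start (decide (Transversal P))
      where
      Result : Set ℓ
      Result = Σ[ β′ ∈ Box (suc k) ] β′ ⊑ box (u<v ∷ b) ×
               (∀ p q → p ∈ β′ → q ∈ β′ → P (f p - f q))
      val : N → Vec N k → Elem
      val x q = f (x ∷ q)
      valᶠ : ∀ {Γ g h} → DefFun Γ 𝐍 g → DefFun Γ (𝐕 k) h → DefFun Γ 𝐔 (λ γ → val (g γ) (h γ))
      valᶠ G H = F ∘ᶠ consᶠ ∘ᶠ (G ,ᶠ H)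
      K : N × Vec N k → Set ℓ
      K (c , q) = ClassesBelow (λ x → val x q) at⟨ u ⟩ c
      K-def : IsDef (𝐍 ⊗ 𝐕 k) K
      K-def = ∀ᵈ (∀ᵈ (<ᵈ′ (constᶠ u) (S v0) ⇒ᵈ <ᵈ′ (S v0) v0 ⇒ᵈ <ᵈ′ v0 (S (S fstᶠ)) ⇒ᵈ
                      at P-def (valᶠ (S v0) (S (S sndᶠ)) -ᶠ valᶠ v0 (S (S sndᶠ)))))
      start : Transversal P ⊎ ¬ Transversal P → Transversal P ⊎ Result
      start (inj₁ t) = inj₁ t
      start (inj₂ n) = continue (Uniform.uniformly (uniform k) (box b) at⟨ u ⟩ K-def
        (λ q _ → [ ⊥-elim ∘ n , id ]′ (transversal-or-eventually (valᶠ idᶠ (constᶠ q)) at⟨ u ⟩)))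
        where
        continue : (Σ[ β₁ ∈ Box k ] β₁ ⊑ box b × Ev at⟨ u ⟩ (λ c → ∀ q → q ∈ β₁ → K (c , q))) →
                   Transversal P ⊎ Result
        continue (β₁ , s₁ , e) with Ev-∃ (Ev-∧ e (Ev-< u<v))
        ... | c , u<c , k₁ , c<v with dense u<c
        ... | s , u<s , s<c = finish (boxInClass-or-transversal k (valᶠ (constᶠ s) idᶠ) β₁)
          where
          toSlice : ∀ x q → u < x → x < c → q ∈ β₁ → P (val x q - val s q)
          toSlice x q u<x x<c i with cmp x s
          ... | inj₁ x<s         = k₁ q i x s u<x x<s s<c
          ... | inj₂ (inj₁ refl) = ~-refl _
          ... | inj₂ (inj₂ s<x)  = ~-sym _ _ (k₁ q i s x u<s s<x x<c)
          finish : (Transversal P ⊎ (Σ[ β₂ ∈ Box k ] β₂ ⊑ β₁ ×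
                     (∀ p q → p ∈ β₂ → q ∈ β₂ → P (val s p - val s q)))) →
                   Transversal P ⊎ Result
          finish (inj₁ t) = inj₁ t
          finish (inj₂ (β₂ , s₂ , h)) = inj₂ (u<c ⨯ β₂ ,
            ⨯-⊑ u<c β₂ u<v b irrefl (asym c<v) (λ q → s₁ q ∘ s₂ q) ,
            λ { (x ∷ p) (y ∷ q) (u<x ∷ i , x<c ∷ j) (u<y ∷ i′ , y<c ∷ j′) →
              ~-trans (val x p) (val s p) (val y q)
                (toSlice x p u<x x<c (s₂ p (i , j)))
                (~-trans (val s p) (val s q) (val y q) (h p q (i , j) (i′ , j′))
                  (~-sym (val y q) (val s q) (toSlice y q u<y y<c (s₂ q (i′ , j′))))) })

    -- Applied to the inverse of the chart at `0#`: a chart box inside one coset, translated back to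
    -- `0#`, is a neighbourhood inside `P`.
    open-or-transversal : Transversal P ⊎ Small P
    open-or-transversal =
      [ inj₁ , inj₂ ∘ fromBox ]′ (boxInClass-or-transversal n point-def (proj₁ chartBox))
      where
      fromBox : (Σ[ β ∈ Box n ] β ⊑ proj₁ chartBox ×
                  (∀ p q → p ∈ β → q ∈ β → P (point⁻ p - point⁻ q))) → Small P
      fromBox (β , s , same) =
        Small-map inClass (neighbourhood⇒small (proj₂ chartBox q (s q q∈β)) q∈β)
        where
        q : Vec N n
        q = proj₁ (centre β)
        q∈β : q ∈ β
        q∈β = proj₂ (centre β)
        x : Elem
        x = point⁻ q
        inClass : ∀ u → Dom (x + u) × In (lo β) (hi β) (coord (x + u)) → P u
        inClass u (dom , i) = P-resp {(x + u) - x} {u} (add-cancel x u)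
          (P-resp {point⁻ (coord (x + u)) - x} {(x + u) - x}
            (minus-cong {point⁻ (coord (x + u))} {x + u} {x} {x} (point-coord (x + u) dom) refl)
            (same (coord (x + u)) q i q∈β))

    -- Otherwise a definable curve through infinitely many cosets would have a limit.
    module FiniteIndexOfOpen (P-small : Small P) where

      eventually-in-class : ∀ {γ} → DefFun 𝐍 𝐔 γ → ∀ a → ∃[ u ] Ev a (λ t → P (γ t - u))
      eventually-in-class {γ} Γ a = let u , lim = curve-limit Γ a in
        u , Ev-map (λ t → within P-small (γ t - u)) (lim (radius P-small) (valid P-small))

      FinitelyMany : (Elem → Set ℓ) → Set ℓ
      FinitelyMany T = Σ[ us ∈ List Elem ] (∀ u → T u → Any (λ r → P (u - r)) us)

      FinitelyMany-∪ : ∀ {T T₁ T₂} → FinitelyMany T₁ → FinitelyMany T₂ →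
                       (∀ u → T u → T₁ u ⊎ T₂ u) → FinitelyMany T
      FinitelyMany-∪ (us , h) (vs , k) split = us ++ˡ vs , λ u t →
        [ Any.++⁺ˡ ∘ h u , Any.++⁺ʳ us ∘ k u ]′ (split u t)

      FinitelyMany-⊆ : ∀ {T T′} → (∀ u → T u → T′ u) → FinitelyMany T′ → FinitelyMany T
      FinitelyMany-⊆ s (us , h) = us , λ u → h u ∘ s u

      module _ {G : Car (𝐍 ⊗ 𝐔) → Set ℓ} (G-def : IsDef (𝐍 ⊗ 𝐔) G)
               (saturated : ∀ s u v → P (u - v) → G (s , u) → G (s , v))
               (fibres : ∀ s → FinitelyMany (λ u → G (s , u))) where

        private
          Same : N → Elem → N → Set ℓ
          Same s u t = (G (s , u) → G (t , u)) × (G (t , u) → G (s , u))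

          Steady : N → Elem → Set ℓ
          Steady s u = Ev at⟨ s ⟩ (Same s u) × ᵒ.Ev at⟨ s ⟩ (Same s u)

          -- The fibre of `G`, seen as a set of cosets, changes at `s` in the coset of some `u`.
          -- Between jumps it is constant.
          Jump : N → Set ℓ
          Jump s = ∃[ u ] ¬ Steady s u

          Same-def : IsDef (𝐍 ⊗ (𝐍 ⊗ 𝐔)) (λ (t , s , u) → Same s u t)
          Same-def = (at₂ G-def (S fstᶠ) (S sndᶠ) ⇒ᵈ at₂ G-def v0 (S sndᶠ)) ∧ᵈ
                     (at₂ G-def v0 (S sndᶠ) ⇒ᵈ at₂ G-def (S fstᶠ) (S sndᶠ))

          Steady-def : IsDef (𝐍 ⊗ 𝐔) (λ (s , u) → Steady s u)
          Steady-def = Ev-atᵈ fstᶠ Same-def ∧ᵈ ᵒ.Ev-atᵈ fstᶠ Same-def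

          Jump-def : IsDef 𝐍 Jump
          Jump-def = ∃ᵈ (¬ᵈ (at₂ Steady-def (S idᶠ) v0))

          Same-resp : ∀ {s u v t} → P (u - v) → Same s u t → Same s v t
          Same-resp {s} {u} {v} {t} p (f , g) =
            (λ h → saturated t u v p (f (saturated s v u (~-sym u v p) h))) ,
            (λ h → saturated s u v p (g (saturated t v u (~-sym u v p) h)))

          Steady-resp : ∀ {s u v} → P (u - v) → Steady s u → Steady s v
          Steady-resp p (f , g) = Ev-map (λ _ → Same-resp p) f , ᵒ.Ev-map (λ _ → Same-resp p) g

          -- Closed choice gives a curve through cosets that change, and near `u` this curve stays
          -- in the coset of some `c`. But membership of `c` in the fibres is eventually constant,
          -- so nothing changes at `c`.
          no-jumping-interval : ∀ u v → u < v → ¬ (∀ s → u < s → s < v → Jump s)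
          no-jumping-interval u v u<v jump =
            select (closedChoice {𝐍} {λ (s , w) → ¬ Steady s w} (¬ᵈ Steady-def))
            where
            select : ¬ (Σ[ y ∈ (N → Elem) ] DefFun 𝐍 𝐔 y × (∀ s → (∃[ w ] ¬ Steady s w) →
                       ∀ π → Valid π → ∃[ w ] (¬ Steady s w) × B π (w - y s)))
            select (y , Y , h) with eventually-in-class Y at⟨ u ⟩
            ... | c , e = [ (λ p → constant (Ev-∧ p jumps) (λ a b → (λ _ → b) , (λ _ → a)))
                          , (λ p → constant (Ev-∧ p jumps) (λ a b → ⊥-elim ∘ a , ⊥-elim ∘ b)) ]′
                          (germ (at₂ G-def idᶠ (constᶠ c)) at⟨ u ⟩)
              where
              at-c : ∀ s → u < s → s < v → P (y s - c) → ¬ Steady s c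
              -- A point of the closure is good enough: `P` is a neighbourhood of `0#`, so a
              -- changing `w` is found in the coset of `y s` itself.
              at-c s u<s s<v p st with h s (jump s u<s s<v) (radius P-small) (valid P-small)
              ... | w , ¬st , b = ¬st (Steady-resp
                      (~-sym w c (~-trans w (y s) c (within P-small _ b) p)) st)
              jumps : Ev at⟨ u ⟩ (λ s → ¬ Steady s c)
              jumps = Ev-map◁ (λ s u<s (p , s<v) → at-c s u<s s<v p) (Ev-∧ e (Ev-< u<v))
              constant : ∀ {Q : Pred N ℓ} → Ev at⟨ u ⟩ (λ s → Q s × ¬ Steady s c) →
                         (∀ {s t} → Q s → Q t → Same s c t) → ⊥
              constant (ev d u<d k) same with dense u<d
              ... | s , u<s , s<d = let q , ¬st = k s u<s s<d in ¬st
                (ev d s<d (λ t s<t t<d → same q (proj₁ (k t (<-trans u<s s<t) t<d))) ,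
                 ev u u<s (λ t t<s u<t → same q (proj₁ (k t u<t (<-trans t<s s<d)))))

          points : List Segment → List N
          points []            = []
          points (inj₁ x ∷ ss) = x ∷ points ss
          points (inj₂ _ ∷ ss) = points ss

          inPoints : ∀ ss → (∀ t → Any (InSegment _<_ t) ss → Jump t) →
                     ∀ s → Any (InSegment _<_ s) ss → Any (s ≡_) (points ss)
          inPoints (inj₁ x ∷ ss) h s (here e)  = here e
          inPoints (inj₁ x ∷ ss) h s (there p) = there (inPoints ss (λ t → h t ∘ there) s p)
          inPoints (inj₂ _ ∷ ss) h s (there p) = inPoints ss (λ t → h t ∘ there) s p
          inPoints (inj₂ (b , c) ∷ ss) h s (here (p , q))
            with ◁-dense b p | ᵒ.◁-dense c q
          ... | l , b◁l , l<s | r , r▷c , s<r = ⊥-elim (no-jumping-interval l r (<-trans l<s s<r)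
                λ t l<t t<r → h t (here (◁-trans b b◁l l<t , ᵒ.◁-trans c r▷c t<r)))

          jumps : Σ[ xs ∈ List N ] (∀ s → Jump s → Any (s ≡_) xs)
          jumps = let ss , h = segments Jump-def in
            points ss , λ s j → inPoints ss (λ t → from (h t)) s (to (h s) j)

          Between : Bound → Bound → N → Set ℓ
          Between a b s = a ◁ s × b ᵒ.◁ s

          steady : ∀ a b → (∀ s → Between a b s → ¬ Jump s) →
                   ∀ s t u → Between a b s → Between a b t → s < t → Same s u t
          steady a b none s t u (p , _) (_ , q) s<t = propagate
            (at₃ Same-def sndᶠ fstᶠ (constᶠ u))
            (λ (f , g) (f′ , g′) → f′ ∘ f , g ∘ g′) s<t
            (λ z z≮s t≮z → proj₁ (st z z≮s t≮z))
            (λ z s<z t≮z → ᵒ.Ev-map (λ _ (f , g) → g , f) (proj₂ (st z (asym s<z) t≮z)))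
            where
            inside : ∀ z → ¬ z < s → ¬ t < z → Between a b z
            inside z z≮s t≮z = left (≤-split z≮s) , right (≤-split t≮z)
              where
              left : s < z ⊎ s ≡ z → a ◁ z
              left (inj₁ r)    = ◁-trans a p r
              left (inj₂ refl) = p
              right : z < t ⊎ z ≡ t → b ᵒ.◁ z
              right (inj₁ r)    = ᵒ.◁-trans b q r
              right (inj₂ refl) = q
            st : ∀ z → ¬ z < s → ¬ t < z → Steady z u
            st z l r = byContra λ n → none z (inside z l r) (u , n)

          -- Cutting at the jumps leaves intervals on each of which any one fibre represents all;
          -- the fibres over the cut points are added.
          onInterval : ∀ xs a b → (∀ s → Between a b s → Jump s → Any (s ≡_) xs) →
                       FinitelyMany (λ u → ∃[ s ] Between a b s × G (s , u))
          onInterval [] a b h with decide (∃ (Between a b))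
          ... | inj₂ empty = [] , λ u (s , i , _) → ⊥-elim (empty (s , i))
          ... | inj₁ (s , i) = FinitelyMany-⊆ toFibre (fibres s)
            where
            none : ∀ t → Between a b t → ¬ Jump t
            none t j k with h t j k
            ... | ()
            toFibre : ∀ u → (∃[ t ] Between a b t × G (t , u)) → G (s , u)
            toFibre u (t , j , g) with cmp s t
            ... | inj₁ r           = proj₂ (steady a b none s t u i j r) g
            ... | inj₂ (inj₁ refl) = g
            ... | inj₂ (inj₂ r)    = proj₁ (steady a b none t s u j i r) g
          onInterval (x ∷ xs) a b h with decide (Between a b x)
          ... | inj₂ outside = onInterval xs a b (λ s i j → discard s i (h s i j))
            where
            discard : ∀ s → Between a b s → Any (s ≡_) (x ∷ xs) → Any (s ≡_) xs
            discard s i (here refl) = ⊥-elim (outside i)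
            discard s i (there p)   = p
          ... | inj₁ (a◁x , x▷b) = FinitelyMany-∪ {T₂ = λ u → G (x , u) ⊎ Right u}
              (onInterval xs a at⟨ x ⟩ (λ s (p , s<x) j →
                discard s (λ e → irrefl (subst (_< x) e s<x)) (h s (p , ᵒ.◁-trans b x▷b s<x) j)))
              (FinitelyMany-∪ (fibres x) (onInterval xs at⟨ x ⟩ b (λ s (x<s , q) j →
                discard s (λ e → irrefl (subst (x <_) e x<s)) (h s (◁-trans a a◁x x<s , q) j)))
                (λ _ → id))
              split
            where
            Right : Elem → Set ℓ
            Right u = ∃[ s ] Between at⟨ x ⟩ b s × G (s , u)
            discard : ∀ s → s ≢ x → Any (s ≡_) (x ∷ xs) → Any (s ≡_) xs
            discard s n (here e)  = ⊥-elim (n e)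
            discard s n (there p) = p
            split : ∀ u → (∃[ s ] Between a b s × G (s , u)) →
                    (∃[ s ] Between a at⟨ x ⟩ s × G (s , u)) ⊎ (G (x , u) ⊎ Right u)
            split u (s , (p , q) , g) with cmp s x
            ... | inj₁ r           = inj₁ (s , (p , r) , g)
            ... | inj₂ (inj₁ refl) = inj₂ (inj₁ g)
            ... | inj₂ (inj₂ r)    = inj₂ (inj₂ (s , (r , q) , g))

        finitelyMany-total : FinitelyMany (λ u → ∃[ s ] G (s , u))
        finitelyMany-total = let xs , h = jumps in
          FinitelyMany-⊆ (λ u (s , g) → s , (⊤ₚ.tt , ⊤ₚ.tt) , g)
                         (onInterval xs ∞ ∞ (λ s _ → h s))

      -- The coordinates of `p` are projected away one at a time. Saturation under `P` survives a
      -- projection, and finiteness of the new fibres is the case of one variable.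
      finitelyMany-family : ∀ k {G : Car (𝐕 k ⊗ 𝐔) → Set ℓ} → IsDef (𝐕 k ⊗ 𝐔) G →
        (∀ p u v → P (u - v) → G (p , u) → G (p , v)) →
        (∀ p → FinitelyMany (λ u → G (p , u))) → FinitelyMany (λ u → ∃[ p ] G (p , u))
      finitelyMany-family zero D sat fib = FinitelyMany-⊆ (λ { u ([] , g) → g }) (fib [])
      finitelyMany-family (suc k) {G} D sat fib = FinitelyMany-⊆
        (λ { u (s ∷ q , g) → q , s , g })
        (finitelyMany-family k {λ (q , u) → ∃[ s ] G (s ∷ q , u)}
          (∃ᵈ (at₂ D (consᶠ ∘ᶠ (v0 ,ᶠ S fstᶠ)) (S sndᶠ)))
          (λ q u v p (s , g) → s , sat (s ∷ q) u v p g)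
          (λ q → finitelyMany-total {λ (s , u) → G (s ∷ q , u)}
            (at₂ D (consᶠ ∘ᶠ (fstᶠ ,ᶠ constᶠ q)) sndᶠ)
            (λ s → sat (s ∷ q)) (λ s → fib (s ∷ q))))

      -- The cosets are parametrised by the coordinates of their points, with at most one coset in
      -- each fibre.
      finiteIndex : FinitelyMany (λ _ → ⊤ₚ.⊤)
      finiteIndex = FinitelyMany-⊆ (λ u _ → proj₁ u , u , refl , ~-refl u)
        (finitelyMany-family arity
          {λ (p , u) → ∃[ x ] proj₁ {B = U} x ≡ p × P (u - x)}
          (∃ᵈ (at₂ (Eqᵈ (𝐕 arity)) (codeᶠ {𝐔} ∘ᶠ v0) (S fstᶠ) ∧ᵈ at P-def (S sndᶠ -ᶠ v0)))
          (λ p u v q (x , e , r) → x , e , ~-trans v u x (~-sym u v q) r)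
          fibre)
        where
        fibre : ∀ p → FinitelyMany (λ u → ∃[ x ] proj₁ {B = U} x ≡ p × P (u - x))
        fibre p with decide (U p)
        ... | inj₂ n = [] , λ { u (x , refl , _) → ⊥-elim (n (proj₂ x)) }
        ... | inj₁ i = (p , i) ∷ [] , λ { u (x , refl , q) →
                here (P-resp {u - x} {u - (p , i)} (minus-cong {u} {u} {x} {p , i} refl refl) q) }

    module _ (connected : DefinablyConnected 𝒩 R) where

      private
        H : Pred (Vec N arity) ℓ
        H v = Σ[ v∈U ∈ U v ] P (v , v∈U)

        ⇒H : ∀ x → P x → H (proj₁ x)
        ⇒H x p = proj₂ x , p

        H⇒ : ∀ x → H (proj₁ x) → P x
        H⇒ x (i , p) = P-resp {proj₁ x , i} {x} refl p

        H-def : Definable 𝒩 H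
        H-def = IsDef⇒Definable (mapDef
          (λ v → mk⇔ (λ { (u , refl , p) → ⇒H u p }) (λ (i , p) → (v , i) , refl , p))
          (∃ᵈ (at₂ (Eqᵈ (𝐕 arity)) (codeᶠ {𝐔} ∘ᶠ v0) (S idᶠ) ∧ᵈ at P-def v0)))

        H-subgroup : IsDefinableSubgroup 𝒩 R H
        H-subgroup = record
          { H-definable = H-def
          ; H⊆U         = proj₁
          ; 0∈H         = ⇒H 0# P-0
          ; +-closed    = λ x y p q → ⇒H (x + y) (P-+ x y (H⇒ x p) (H⇒ y q))
          ; neg-closed  = λ x p → ⇒H (- x) (P-neg x (H⇒ x p))
          }

      -- The alternative to a transversal is that `P` is open; it then has finite index, and
      -- connectedness forces it to contain `x`.
      proper⇒transversal : ∀ x → ¬ P x → Transversal P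
      proper⇒transversal x ¬Px with open-or-transversal
      ... | inj₁ t = t
      ... | inj₂ s = ⊥-elim (¬Px (H⇒ x (connected H H-subgroup (index (finiteIndex)) (proj₂ x))))
        where
        open FiniteIndexOfOpen s
        index : FinitelyMany (λ _ → ⊤ₚ.⊤) → FiniteIndex 𝒩 R H
        index (us , h) = us , λ u → Any-map (λ {r} → ⇒H (u - r)) (h u ⊤ₚ.tt)

-- Continuity of multiplication, small ideals, and cubes of growing dimension.

module ZeroMultiplication (em : ∀ {a} → ExcludedMiddle a) {ℓ} (𝒩 : OrderedStructure ℓ)
                          (om : IsOMinimal 𝒩) (R : DefinableRing 𝒩) (τ : GroupTopology 𝒩 R)
                          (connected : DefinablyConnected 𝒩 R)
                          (compact : DefinablyCompact 𝒩 (GroupTopology.manifold τ)) where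

  open Definability 𝒩
  open Lines em 𝒩
  open Monotonicity em 𝒩
  open OrderedStructure 𝒩 using (_<_) renaming (Carrier to N)
  open OrderLine em 𝒩 om
  open Sides line
  open Boxes em 𝒩 line
  open FiniteFamilies em 𝒩 line
  open DefinableRing R renaming (m to arity)
  open GroupTopology τ
  open RingTopology em 𝒩 om R τ
  open SmallSets em 𝒩 om R τ
  open Limits compact
  open Choice em 𝒩 om R τ compact
  open Subgroups em 𝒩 om R τ compact
  open IsSubgroup
  open ≈-Reasoning using (begin_; step-≈-⟩; step-≈-⟨; _∎)

  left : ∀ k {m} → Vec N (k ℕ.+ m) → Vec N k
  left zero    v = []
  left (suc k) v = Vec.head v ∷ left k (Vec.tail v)

  right : ∀ k {m} → Vec N (k ℕ.+ m) → Vec N m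
  right zero    v = v
  right (suc k) v = right k (Vec.tail v)

  leftᶠ : ∀ k {m} → DefFun (𝐕 (k ℕ.+ m)) (𝐕 k) (left k)
  leftᶠ zero    = constᶠ []
  leftᶠ (suc k) = consᶠ ∘ᶠ (headᶠ ,ᶠ leftᶠ k ∘ᶠ tailᶠ)

  rightᶠ : ∀ k {m} → DefFun (𝐕 (k ℕ.+ m)) (𝐕 m) (right k)
  rightᶠ zero    = idᶠ
  rightᶠ (suc k) = rightᶠ k ∘ᶠ tailᶠ

  left-++ : ∀ {k m} (p : Vec N k) (q : Vec N m) → left k (p ++ q) ≡ p
  left-++ []      q = refl
  left-++ (x ∷ p) q = cong (x ∷_) (left-++ p q)

  right-++ : ∀ {k m} (p : Vec N k) (q : Vec N m) → right k (p ++ q) ≡ q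
  right-++ []      q = refl
  right-++ (x ∷ p) q = right-++ p q

  Pointwise-left : ∀ k {m} {x y : Vec N (k ℕ.+ m)} → Pointwise _<_ x y →
                   Pointwise _<_ (left k x) (left k y)
  Pointwise-left zero    a       = []
  Pointwise-left (suc k) (p ∷ a) = p ∷ Pointwise-left k a

  Pointwise-right : ∀ k {m} {x y : Vec N (k ℕ.+ m)} → Pointwise _<_ x y →
                    Pointwise _<_ (right k x) (right k y)
  Pointwise-right zero    a       = a
  Pointwise-right (suc k) (p ∷ a) = Pointwise-right k a

  Pointwise-join : ∀ k {m} {x y : Vec N (k ℕ.+ m)} → Pointwise _<_ (left k x) (left k y) →
                   Pointwise _<_ (right k x) (right k y) → Pointwise _<_ x y
  Pointwise-join zero    _       b = b
  Pointwise-join (suc k) {x = _ ∷ _} {_ ∷ _} (p ∷ a) b = p ∷ Pointwise-join k a b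

  abstract
    -- A definable map is continuous at some point of the chart, and the increments of an additive
    -- map are the same at every point.
    additive⇒continuous : ∀ {h} → DefFun 𝐔 𝐔 h → (∀ x y → h (x + y) ≈ (h x + h y)) →
                          ∀ π → Valid π → Small (λ u → B π (h u))
    additive⇒continuous {h} H h-+ π v =
      fromPoint (generic-point (H ∘ᶠ point-def) (proj₁ chartBox))
      where
      fromPoint : (∃[ p ] p ∈ proj₁ chartBox × (∀ π → Valid π →
                     Neighbourhood p (λ q → B π (h (point⁻ q) - h (point⁻ p))))) →
                  Small (λ u → B π (h u))
      fromPoint (p , i , near) = fromNear (near π v)
        where
        x : Elem
        x = point⁻ p
        fromNear : Neighbourhood p (λ q → B π (h (point⁻ q) - h x)) → Small (λ u → B π (h u))
        fromNear (l , r , j , k) = Small-map transfer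
          (neighbourhood⇒small (proj₂ chartBox p i) j)
          where
          transfer : ∀ u → Dom (x + u) × In l r (coord (x + u)) → B π (h u)
          transfer u (d , c) = B-resp π (begin
            h (point⁻ (coord (x + u))) - h x
              ≈⟨ minus-cong {h (point⁻ (coord (x + u)))} {h (x + u)} {h x} {h x}
                   (DefFun-resp H {point⁻ (coord (x + u))} {x + u} (point-coord (x + u) d)) refl ⟩
            h (x + u) - h x
              ≈⟨ minus-cong {h (x + u)} {h x + h u} {h x} {h x} (h-+ x u) refl ⟩
            (h x + h u) - h x
              ≈⟨ add-cancel (h x) (h u) ⟩
            h u ∎) (k (coord (x + u)) c)

  -- Recovers a bilinear map near zero from its behaviour near any other point `(x , y)`.
  product-expansion : ∀ x y u v →
    ((((x + u) * (y + v)) - (x * y)) - ((x * v) + (u * y))) ≈ (u * v)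
  product-expansion x y u v = begin
    (((x + u) * (y + v)) - (x * y)) - ((x * v) + (u * y))
      ≈⟨ minus-cong {((x + u) * (y + v)) - (x * y)} {((x * v) + (u * y)) + (u * v)}
                    {(x * v) + (u * y)} {(x * v) + (u * y)} inner refl ⟩
    (((x * v) + (u * y)) + (u * v)) - ((x * v) + (u * y))
      ≈⟨ add-cancel ((x * v) + (u * y)) (u * v) ⟩
    u * v ∎
    where
    inner : (((x + u) * (y + v)) - (x * y)) ≈ (((x * v) + (u * y)) + (u * v))
    inner = begin
      ((x + u) * (y + v)) - (x * y)
        ≈⟨ minus-cong {(x + u) * (y + v)} {(x * (y + v)) + (u * (y + v))} {x * y} {x * y}
                      (mulʳ-+ (y + v) x u) refl ⟩
      ((x * (y + v)) + (u * (y + v))) - (x * y)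
        ≈⟨ minus-cong {(x * (y + v)) + (u * (y + v))}
                      {((x * y) + (x * v)) + ((u * y) + (u * v))} {x * y} {x * y}
             (+-cong {x * (y + v)} {(x * y) + (x * v)} {u * (y + v)} {(u * y) + (u * v)}
                     (mulˡ-+ x y v) (mulˡ-+ u y v)) refl ⟩
      (((x * y) + (x * v)) + ((u * y) + (u * v))) - (x * y)
        ≈⟨ minus-cong {((x * y) + (x * v)) + ((u * y) + (u * v))}
                      {(x * y) + ((x * v) + ((u * y) + (u * v)))} {x * y} {x * y}
                      (+-assoc (x * y) (x * v) ((u * y) + (u * v))) refl ⟩
      ((x * y) + ((x * v) + ((u * y) + (u * v)))) - (x * y)
        ≈⟨ add-cancel (x * y) ((x * v) + ((u * y) + (u * v))) ⟩
      (x * v) + ((u * y) + (u * v))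
        ≈⟨ +-assoc (x * v) (u * y) (u * v) ⟨
      ((x * v) + (u * y)) + (u * v) ∎

  abstract
    -- The product is continuous at some point `(x , y)` of the square of a chart box, and `u * v`
    -- is a combination of the increments there by `(u , v)`, `(0# , v)` and `(u , 0#)`.
    product-small : ∀ π → Valid π →
      Σ[ π′ ∈ Car 𝐏 ] Valid π′ × (∀ u v → B π′ u → B π′ v → B π (u * v))
    product-small π v = fromPoint (generic-point F (box (double (lo<hi β))))
      where
      β : Box n
      β = proj₁ chartBox
      f : Vec N (n ℕ.+ n) → Elem
      f p = point⁻ (left n p) * point⁻ (right n p)
      F : DefFun (𝐕 (n ℕ.+ n)) 𝐔 f
      F = point-def ∘ᶠ leftᶠ n *ᶠᶠ point-def ∘ᶠ rightᶠ n
      double : ∀ {k} {l h : Vec N k} → Pointwise _<_ l h → Pointwise _<_ (l ++ l) (h ++ h)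
      double a = Pw.++⁺ a a
      H : Half π
      H = halve π v
      -- Two halvings leave room for the three increments.
      H′ : Half (Half.half H)
      H′ = halve (Half.half H) (Half.ok H)
      π₂ : Car 𝐏
      π₂ = Half.half H′
      fromPoint : (∃[ p ] p ∈ box (double (lo<hi β)) × (∀ π → Valid π →
                     Neighbourhood p (λ q → B π (f q - f p)))) →
                  Σ[ π′ ∈ Car 𝐏 ] Valid π′ × (∀ u v → B π′ u → B π′ v → B π (u * v))
      fromPoint (p , (i , j) , near) = fromNear (near π₂ (Half.ok H′))
        where
        x y : Elem
        x = point⁻ (left n p)
        y = point⁻ (right n p)
        inLeft : left n p ∈ β
        inLeft = subst (λ l → Pointwise _<_ l (left n p)) (left-++ (lo β) (lo β)) (Pointwise-left n i) ,
                 subst (Pointwise _<_ (left n p)) (left-++ (hi β) (hi β)) (Pointwise-left n j)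
        inRight : right n p ∈ β
        inRight = subst (λ l → Pointwise _<_ l (right n p)) (right-++ (lo β) (lo β)) (Pointwise-right n i) ,
                  subst (Pointwise _<_ (right n p)) (right-++ (hi β) (hi β)) (Pointwise-right n j)
        fromNear : Neighbourhood p (λ q → B π₂ (f q - f p)) →
                   Σ[ π′ ∈ Car 𝐏 ] Valid π′ × (∀ u v → B π′ u → B π′ v → B π (u * v))
        fromNear (l , h , (a , b) , k) = radius both , valid both , λ u v p q →
          B-resp π (product-expansion x y u v) (Half.minus H _ _
            (Half.incl H′ _ (increment u v (proj₁ (within both u p)) (proj₂ (within both v q))))
            (Half.plus H′ _ _
              (B-resp π₂ (increment-right v)
                (increment 0# v (proj₁ (within both 0# (0∈B (valid both)))) (proj₂ (within both v q))))
              (B-resp π₂ (increment-left u)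
                (increment u 0# (proj₁ (within both u p)) (proj₂ (within both 0# (0∈B (valid both))))))))
          where
          NearX NearY : Elem → Set ℓ
          NearX u = Dom (x + u) × In (left n l) (left n h) (coord (x + u))
          NearY v = Dom (y + v) × In (right n l) (right n h) (coord (y + v))
          both : Small (λ u → NearX u × NearY u)
          both = Small-∩
            (neighbourhood⇒small (proj₂ chartBox _ inLeft) (Pointwise-left n a , Pointwise-left n b))
            (neighbourhood⇒small (proj₂ chartBox _ inRight) (Pointwise-right n a , Pointwise-right n b))
          increment : ∀ u v → NearX u → NearY v → B π₂ (((x + u) * (y + v)) - (x * y))
          increment u v (d , c , c′) (e , c″ , c‴) = B-resp π₂
            (minus-cong {f q} {(x + u) * (y + v)} {x * y} {x * y}
              (*-cong {point⁻ (left n q)} {x + u} {point⁻ (right n q)} {y + v}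
                (trans (cong (proj₁ ∘ point⁻) left-q) (point-coord (x + u) d))
                (trans (cong (proj₁ ∘ point⁻) right-q) (point-coord (y + v) e))) refl)
            (k q (Pointwise-join n (subst (Pointwise _<_ (left n l)) (sym left-q) c)
                                   (subst (Pointwise _<_ (right n l)) (sym right-q) c″) ,
                  Pointwise-join n (subst (λ z → Pointwise _<_ z (left n h)) (sym left-q) c′)
                                   (subst (λ z → Pointwise _<_ z (right n h)) (sym right-q) c‴)))
            where
            q : Vec N (n ℕ.+ n)
            q = coord (x + u) ++ coord (y + v)
            left-q : left n q ≡ coord (x + u)
            left-q = left-++ (coord (x + u)) (coord (y + v))
            right-q : right n q ≡ coord (y + v)
            right-q = right-++ (coord (x + u)) (coord (y + v))
          increment-right : ∀ v → (((x + 0#) * (y + v)) - (x * y)) ≈ (x * v)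
          increment-right v = begin
            ((x + 0#) * (y + v)) - (x * y)
              ≈⟨ minus-cong {(x + 0#) * (y + v)} {x * (y + v)} {x * y} {x * y}
                   (*-cong {x + 0#} {x} {y + v} {y + v} (+-identityʳ x) refl) refl ⟩
            (x * (y + v)) - (x * y)
              ≈⟨ minus-cong {x * (y + v)} {(x * y) + (x * v)} {x * y} {x * y} (mulˡ-+ x y v) refl ⟩
            ((x * y) + (x * v)) - (x * y)
              ≈⟨ add-cancel (x * y) (x * v) ⟩
            x * v ∎
          increment-left : ∀ u → (((x + u) * (y + 0#)) - (x * y)) ≈ (u * y)
          increment-left u = begin
            ((x + u) * (y + 0#)) - (x * y)
              ≈⟨ minus-cong {(x + u) * (y + 0#)} {(x + u) * y} {x * y} {x * y}
                   (*-cong {x + u} {x + u} {y + 0#} {y} refl (+-identityʳ y)) refl ⟩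
            ((x + u) * y) - (x * y)
              ≈⟨ minus-cong {(x + u) * y} {(x * y) + (u * y)} {x * y} {x * y} (mulʳ-+ y x u) refl ⟩
            ((x * y) + (u * y)) - (x * y)
              ≈⟨ add-cancel (x * y) (u * y) ⟩
            u * y ∎

  Annihilator : Elem → Set ℓ
  Annihilator x = ∀ y → (x * y) ≈ 0#

  plus-null : ∀ {x y} → x ≈ 0# → y ≈ 0# → (x + y) ≈ 0#
  plus-null {x} {y} p q = trans (+-cong {x} {0#} {y} {0#} p q) (+-identityˡ 0#)

  neg-null : ∀ {x} → x ≈ 0# → (- x) ≈ 0#
  neg-null {x} p = trans (sym (+-identityˡ (- x))) (minus≈0 0# x (sym p))

  annihilator : IsSubgroup Annihilator
  annihilator = record
    { P-def = ∀ᵈ (≈ᵈ (S idᶠ *ᶠᶠ v0) (constᶠ 0#))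
    ; P-0   = Right.h-0
    ; P-+   = λ x y p q z → trans (mulʳ-+ z x y) (plus-null {x * z} {y * z} (p z) (q z))
    ; P-neg = λ x p z → trans (Right.h-neg z x) (neg-null {x * z} (p z))
    }

  module _ {σ : N → Elem} (Σᶠ : DefFun 𝐍 𝐔 σ) {a : N} (σ→0 : ∀ π → Valid π → Ev at⟨ a ⟩ (λ t → B π (σ t)))
           where

    -- Otherwise closed choice would give η t → y with σ t * η t bounded away from
    -- 0#, although σ t * η t → 0# * y.
    eventually-small-ideal : ∀ π → Valid π → Ev at⟨ a ⟩ (λ t → ∀ y → B π (σ t * y))
    eventually-small-ideal π v =
      [ id , ⊥-elim ∘ (λ e → impossible e (closedChoice {𝐍} {λ (t , y) → ¬ B π (σ t * y)} bad-def)) ]′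
      (germ (∀ᵈ (Bᵈ (constᶠ π) (Σᶠ ∘ᶠ S idᶠ *ᶠᶠ v0))) at⟨ a ⟩)
      where
      bad-def : IsDef (𝐍 ⊗ 𝐔) (λ (t , y) → ¬ B π (σ t * y))
      bad-def = ¬ᵈ (Bᵈ (constᶠ π) (Σᶠ ∘ᶠ fstᶠ *ᶠᶠ sndᶠ))
      H : Half π
      H = halve π v
      π₁ : Car 𝐏
      π₁ = Half.half H
      H′ : Half π₁
      H′ = halve π₁ (Half.ok H)
      π₂ : Car 𝐏
      π₂ = Half.half H′
      impossible : Ev at⟨ a ⟩ (λ t → ¬ (∀ y → B π (σ t * y))) →
        ¬ (Σ[ η ∈ (N → Elem) ] DefFun 𝐍 𝐔 η × (∀ t → (∃[ y ] ¬ B π (σ t * y)) →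
             ∀ π′ → Valid π′ → ∃[ y ] (¬ B π (σ t * y)) × B π′ (y - η t)))
      impossible e (η , Η , near) = limit (curve-limit Η at⟨ a ⟩)
        where
        limit : ¬ ∃ (Converges η at⟨ a ⟩)
        limit (y∞ , lim) = compare (product-small π₂ (Half.ok H′))
          where
          ρ-small : Small (λ u → B π₂ (u * y∞))
          ρ-small = additive⇒continuous (idᶠ *ᶠᶠ constᶠ y∞) (mulʳ-+ y∞) π₂ (Half.ok H′)
          compare : ¬ (Σ[ π′ ∈ Car 𝐏 ] Valid π′ × (∀ u v → B π′ u → B π′ v → B π₂ (u * v)))
          compare (π′ , v′ , mul) = atPoint (Ev-∃ (Ev-∧ e (Ev-∧ (lim π′ v′)
                                    (Ev-∧ (σ→0 π′ v′) (σ→0 (radius ρ-small) (valid ρ-small))))))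
            where
            atPoint : ¬ (∃[ t ] a < t × (¬ (∀ y → B π (σ t * y))) × B π′ (η t - y∞) ×
                           B π′ (σ t) × B (radius ρ-small) (σ t))
            -- With `t` fixed, left multiplication by `σ t` is continuous, so `y` can be chosen near
            -- enough to `η t` for `σ t * (y - η t)` to be small. This radius may depend on `t`, as
            -- the approximation is chosen last.
            atPoint (t , _ , big , η-near , σ-small , σ-small′) = conclude
              (near t (byContra λ no → big λ y → byContra λ b → no (y , b)) (radius λ-small) (valid λ-small))
              where
              λ-small : Small (λ u → B π₁ (σ t * u))
              λ-small = additive⇒continuous (constᶠ (σ t) *ᶠᶠ idᶠ) (mulˡ-+ (σ t)) π₁ (Half.ok H)
              sum : ∀ y → (σ t * y) ≈ ((σ t * (y - η t)) + ((σ t * (η t - y∞)) + (σ t * y∞)))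
              sum y = begin
                σ t * y
                  ≈⟨ *-cong {σ t} {σ t} {(y - η t) + η t} {y} refl (minus-add y (η t)) ⟨
                σ t * ((y - η t) + η t)
                  ≈⟨ mulˡ-+ (σ t) (y - η t) (η t) ⟩
                (σ t * (y - η t)) + (σ t * η t)
                  ≈⟨ +-congˡ {σ t * (y - η t)} (*-cong {σ t} {σ t} {(η t - y∞) + y∞} {η t} refl
                       (minus-add (η t) y∞)) ⟨
                (σ t * (y - η t)) + (σ t * ((η t - y∞) + y∞))
                  ≈⟨ +-congˡ {σ t * (y - η t)} (mulˡ-+ (σ t) (η t - y∞) y∞) ⟩
                (σ t * (y - η t)) + ((σ t * (η t - y∞)) + (σ t * y∞)) ∎
              conclude : ¬ (∃[ y ] (¬ B π (σ t * y)) × B (radius λ-small) (y - η t))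
              conclude (y , y-big , y-near) = y-big (B-resp π (sym (sum y)) (Half.plus H _ _
                (within λ-small (y - η t) y-near)
                (Half.plus H′ _ _ (mul (σ t) (η t - y∞) σ-small η-near) (within ρ-small (σ t) σ-small′))))

  -- Multiplication need not be associative, so the set of the products `s * y` is in general only
  -- an additive subgroup; it is called an ideal for short.
  SmallIdeals : Set ℓ
  SmallIdeals = ∀ π → Valid π → ∃[ s ] (∀ y → B π (s * y)) × (∃[ y ] ¬ (s * y) ≈ 0#)

  transversal⇒smallIdeals : Transversal Annihilator → SmallIdeals
  transversal⇒smallIdeals (γ , Γ , u , v , u<v , t) π valid-π = fromLimit (curve-limit Γ at⟨ u ⟩)
    where
    fromLimit : ∃ (Converges γ at⟨ u ⟩) → ∃[ s ] (∀ y → B π (s * y)) × (∃[ y ] ¬ (s * y) ≈ 0#)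
    fromLimit (w , lim) = pick (Ev-∃ (Ev-∧ (eventually-small-ideal Σᶠ lim π valid-π)
      ([ ⊥-elim ∘ two , id ]′ (germ (at (P-def annihilator) Σᶠ) at⟨ u ⟩))))
      where
      σ : N → Elem
      σ x = γ x - w
      Σᶠ : DefFun 𝐍 𝐔 σ
      Σᶠ = Γ -ᶠ constᶠ w
      -- Two points with `σ x` in the annihilator would put two values of `γ` into the coset of `w`,
      -- against transversality.
      two : ¬ Ev at⟨ u ⟩ (λ x → Annihilator (σ x))
      two e with Ev-∃ (Ev-∧ e (Ev-< u<v))
      ... | y , u<y , p , y<v with Ev-∃ (Ev-∧ e (Ev-< u<y))
      ... | x , u<x , q , x<y = t x y u<x x<y y<v
              (~-trans annihilator (γ x) w (γ y) q (~-sym annihilator (γ y) w p))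
      pick : (∃[ x ] u < x × (∀ y → B π (σ x * y)) × ¬ Annihilator (σ x)) →
             ∃[ s ] (∀ y → B π (s * y)) × (∃[ y ] ¬ (s * y) ≈ 0#)
      pick (x , _ , small-ideal , n) = σ x , small-ideal ,
        byContra λ no → n λ y → byContra λ m → no (y , m)

  -- Beside the cube the induction carries a subgroup `K` containing it, modulo which the next
  -- direction is to be injective, and the bound `π`, by which `K` can be kept away from a given
  -- element.
  record SmallCube (r : ℕ) (π : Car 𝐏) : Set (lsuc ℓ) where
    field
      {K}      : Elem → Set ℓ
      subgroup : IsSubgroup K
      K⊆B      : ∀ u → K u → B π u
      {f}      : Vec N r → Elem
      f-def    : DefFun (𝐕 r) 𝐔 f
      cube     : Box r
      f∈K      : ∀ p → p ∈ cube → K (f p)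
      f-inj    : InjectiveOn cube f _≈_

  module _ (ideals : SmallIdeals) where

    private
      emptyCube : ∀ π → Valid π → SmallCube zero π
      emptyCube π v = record
        { subgroup = record
          { P-def = ≈ᵈ idᶠ (constᶠ 0#)
          ; P-0   = refl
          ; P-+   = λ x y → plus-null {x} {y}
          ; P-neg = λ x → neg-null {x}
          }
        ; K⊆B   = λ u e → B-resp π (sym e) (0∈B v)
        ; f-def = constᶠ 0#
        ; cube  = box []
        ; f∈K   = λ _ _ → refl
        ; f-inj = λ { [] [] _ _ _ → refl }
        }

      -- The ideal s U is small but not contained in the much smaller subgroup K,
      -- so that it contributes one more dimension.
      module Extend {r π} (H : Half π) (s : Elem) (small-ideal : ∀ y → B (Half.half H) (s * y))
                    (y₀ : Elem) (C : SmallCube r (Half.half H))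
                    (escapes : ¬ SmallCube.K C (s * y₀)) where
        open SmallCube C
        module K = IsSubgroup subgroup

        K′ : Elem → Set ℓ
        K′ u = ∃[ y ] ∃[ k ] K k × u ≈ (k + (s * y))

        K′-subgroup : IsSubgroup K′
        K′-subgroup = record
          { P-def = ∃ᵈ (∃ᵈ (at K.P-def v0 ∧ᵈ ≈ᵈ (S (S idᶠ)) (v0 +ᶠᶠ (constᶠ s *ᶠᶠ S v0))))
          ; P-0   = 0# , 0# , K.P-0 , sym (trans (+-congˡ {0#} (Left.h-0 s)) (+-identityˡ 0#))
          ; P-+   = λ { u v (y , k , p , e) (y′ , k′ , p′ , e′) → y + y′ , k + k′ , K.P-+ k k′ p p′ , (begin
              u + v                                ≈⟨ +-cong {u} {k + (s * y)} {v} {k′ + (s * y′)} e e′ ⟩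
              (k + (s * y)) + (k′ + (s * y′))      ≈⟨ interchange k (s * y) k′ (s * y′) ⟩
              (k + k′) + ((s * y) + (s * y′))      ≈⟨ +-congˡ {k + k′} (mulˡ-+ s y y′) ⟨
              (k + k′) + (s * (y + y′))            ∎) }
          ; P-neg = λ { u (y , k , p , e) → - y , - k , K.P-neg k p , (begin
              - u                          ≈⟨ neg-cong {u} {k + (s * y)} e ⟩
              - (k + (s * y))              ≈⟨ neg-+ k (s * y) ⟨
              (- k) + (- (s * y))          ≈⟨ +-congˡ {(- k)} (Left.h-neg s y) ⟨
              (- k) + (s * (- y))          ∎) }
          }

        P : Elem → Set ℓ
        P y = K (s * y)

        P-subgroup : IsSubgroup P
        P-subgroup = record
          { P-def = at K.P-def (constᶠ s *ᶠᶠ idᶠ)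
          ; P-0   = K.P-resp (sym (Left.h-0 s)) K.P-0
          ; P-+   = λ x y p q → K.P-resp (sym (mulˡ-+ s x y)) (K.P-+ (s * x) (s * y) p q)
          ; P-neg = λ x p → K.P-resp (sym (Left.h-neg s x)) (K.P-neg (s * x) p)
          }

        fromTransversal : Transversal P → SmallCube (suc r) π
        fromTransversal (γ , Γ , a , b , a<b , t) = record
          { subgroup = K′-subgroup
          ; K⊆B   = λ { u (y , k , p , e) → B-resp π (sym e)
                      (Half.plus H k (s * y) (K⊆B k p) (small-ideal y)) }
          -- The new direction runs along `s * γ x`, which meets each coset of `K` at most once,
          -- while the old cube stays inside `K`.
          ; f-def = (f-def ∘ᶠ tailᶠ) +ᶠᶠ (constᶠ s *ᶠᶠ Γ ∘ᶠ headᶠ)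
          ; cube  = a<b ⨯ cube
          ; f∈K   = λ { (x ∷ p) (_ ∷ i , _ ∷ j) → γ x , f p , f∈K p (i , j) , refl }
          ; f-inj = λ { (x ∷ p) (y ∷ q) (a<x ∷ i , x<b ∷ j) (a<y ∷ i′ , y<b ∷ j′) e →
                        inj x p y q a<x x<b (i , j) a<y y<b (i′ , j′) e }
          }
          where
          same-class : ∀ x p y q → p ∈ cube → q ∈ cube →
                       (f p + (s * γ x)) ≈ (f q + (s * γ y)) → P (γ x - γ y)
          same-class x p y q i j e = K.P-resp {f q - f p} {s * (γ x - γ y)} (begin
              f q - f p              ≈⟨ minus≈0⇒≈ (f q - f p) ((s * γ x) - (s * γ y)) (begin
                (f q - f p) - ((s * γ x) - (s * γ y))
                  ≈⟨ +-congˡ {f q - f p} (neg-minus (s * γ x) (s * γ y)) ⟩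
                (f q - f p) + ((s * γ y) - (s * γ x))
                  ≈⟨ minus-interchange (f q) (s * γ y) (f p) (s * γ x) ⟨
                (f q + (s * γ y)) - (f p + (s * γ x))
                  ≈⟨ minus≈0 (f q + (s * γ y)) (f p + (s * γ x)) (sym e) ⟩
                0# ∎) ⟩
              (s * γ x) - (s * γ y)  ≈⟨ Left.h-minus s (γ x) (γ y) ⟨
              s * (γ x - γ y)        ∎)
            (K.P-+ (f q) (- f p) (f∈K q j) (K.P-neg (f p) (f∈K p i)))
          inj : ∀ x p y q → a < x → x < b → p ∈ cube → a < y → y < b → q ∈ cube →
                (f p + (s * γ x)) ≈ (f q + (s * γ y)) → x ∷ p ≡ y ∷ q
          inj x p y q a<x x<b i a<y y<b j e with cmp x y
          ... | inj₁ x<y = ⊥-elim (t x y a<x x<y y<b (same-class x p y q i j e))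
          ... | inj₂ (inj₂ y<x) = ⊥-elim (t y x a<y y<x x<b (same-class y q x p j i (sym e)))
          ... | inj₂ (inj₁ refl) = cong (x ∷_) (f-inj p q i j (begin
                f p                                  ≈⟨ cancel (f p) ⟨
                (f p + (s * γ x)) - (s * γ x)        ≈⟨ minus-cong {f p + (s * γ x)} {f q + (s * γ x)}
                                                          {s * γ x} {s * γ x} e refl ⟩
                (f q + (s * γ x)) - (s * γ x)        ≈⟨ cancel (f q) ⟩
                f q                                  ∎))
            where
            cancel : ∀ z → ((z + (s * γ x)) - (s * γ x)) ≈ z
            cancel z = trans (minus-cong {z + (s * γ x)} {(s * γ x) + z} {s * γ x} {s * γ x}
                               (+-comm z (s * γ x)) refl) (add-cancel (s * γ x) z)

        extended : SmallCube (suc r) π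
        -- The elements that `s` multiplies into `K` form a definable subgroup, proper because it
        -- omits `y₀`.
        extended = fromTransversal (proper⇒transversal P-subgroup connected y₀ escapes)

    smallCube : ∀ r π → Valid π → SmallCube r π
    smallCube zero    π v = emptyCube π v
    smallCube (suc r) π v = fromIdeal (ideals (Half.half H) (Half.ok H))
      where
      H : Half π
      H = halve π v
      fromIdeal : (∃[ s ] (∀ y → B (Half.half H) (s * y)) × (∃[ y ] ¬ (s * y) ≈ 0#)) →
                  SmallCube (suc r) π
      fromIdeal (s , small-ideal , y₀ , n) = fromSeparation (separate (s * y₀) n)
        where
        fromSeparation : (∃[ π′ ] Valid π′ × ¬ B π′ (s * y₀)) → SmallCube (suc r) π
        fromSeparation (π′ , v′ , s*y₀∉B) = Extend.extended H s small-ideal y₀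
          (record
            { subgroup = subgroup
            ; K⊆B      = λ u p → proj₁ (within both u (K⊆B u p))
            ; f-def    = f-def
            ; cube     = cube
            ; f∈K      = f∈K
            ; f-inj    = f-inj
            })
          (λ p → s*y₀∉B (proj₂ (within both (s * y₀) (K⊆B (s * y₀) p))))
          where
          both : Small (λ u → B (Half.half H) u × B π′ u)
          both = Small-∩ (small _ (Half.ok H) (λ _ → id)) (small _ v′ (λ _ → id))
          -- The smaller cube is chosen only after `s` and `y₀`, so near to zero that its subgroup
          -- omits `s * y₀`. Hence the recursion is over all radii.
          open SmallCube (smallCube r (radius both) (valid both))

    no-smallIdeals : ⊥
    -- The cube has one dimension more than elements of `U` have coordinates.
    no-smallIdeals = no-injection arity (codeᶠ {𝐔} ∘ᶠ f-def) cube f-inj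
      where open SmallCube (smallCube (suc arity) (proj₁ some-radius) (proj₂ some-radius))

  zero-multiplication : ∀ x y → (x * y) ≈ 0#
  zero-multiplication x y = byContra λ n → no-smallIdeals (transversal⇒smallIdeals
    (proper⇒transversal annihilator connected x (λ p → n (p y))))

theorem8p2 : (∀ {a} → ExcludedMiddle a) →
    ∀ {ℓ} (𝒩 : OrderedStructure ℓ) → IsOMinimal 𝒩 →
    (R : DefinableRing 𝒩) (τ : GroupTopology 𝒩 R) →
    DefinablyConnected 𝒩 R →
    DefinablyCompact 𝒩 (GroupTopology.manifold τ) →
    let open DefinableRing R in ∀ x y → x * y ≈ 0#
theorem8p2 em 𝒩 om R τ connected compact =
  ZeroMultiplication.zero-multiplication em 𝒩 om R τ connected compact
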